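{- Let $a$ and $b$ be positive square-free integers with $\gcd(a,b) \leq 2$. Then $g_{a,b}(2) = 3$.
   Context: For integers $a,b$, let $LQ_{a,b}$ denote the quaternion ring $\{\alpha_0 + \alpha_1 \mathbf{i} + \alpha_2 \mathbf{j} + \alpha_3 \mathbf{k} \mid \alpha_0,\alpha_1,\alpha_2,\alpha_3 \in \mathbb{Z}\}$ with $\mathbf{i}^2 = -a$, $\mathbf{j}^2 = -b$, $\mathbf{i}\mathbf{j} = -\mathbf{j}\mathbf{i} = \mathbf{k}$. For $k \geq 2$, let $LQ_{a,b}^k$ denote the additive group generated by all $k$-th powers of elements of $LQ_{a,b}$. The Waring number $g_{a,b}(k)$ is the least positive integer $g$ such that every element of $LQ_{a,b}^k$ can be written as a sum of at most $g$ $k$-th powers of elements of $LQ_{a,b}$. -}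

module Defs where

open import Data.Nat as ℕ using (ℕ; zero; suc)
open import Data.Integer using (ℤ; +_; _+_; _-_; _*_; -_; ∣_∣)
open import Data.Integer.Divisibility using (_∣_)
open import Data.List using (List; []; _∷_; length)
open import Data.Product using (Σ; _×_; _,_)
open import Relation.Binary.PropositionalEquality using (_≡_)
open import Relation.Nullary using (¬_)

SquareFree : ℤ → Set
SquareFree n = ∀ (d : ℤ) → (d * d) ∣ n → ∣ d ∣ ≡ 1

-- Elements α₀ + α₁ i + α₂ j + α₃ k of LQ_{a,b}, α_t ∈ ℤ.
record LQ : Set where
  constructor quat
  field
    c0 c1 c2 c3 : ℤ
open LQ public

zeroQ : LQ
zeroQ = quat (+ 0) (+ 0) (+ 0) (+ 0)

oneQ : LQ
oneQ = quat (+ 1) (+ 0) (+ 0) (+ 0)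

addQ : LQ → LQ → LQ
addQ (quat x0 x1 x2 x3) (quat y0 y1 y2 y3) =
  quat (x0 + y0) (x1 + y1) (x2 + y2) (x3 + y3)

negQ : LQ → LQ
negQ (quat x0 x1 x2 x3) = quat (- x0) (- x1) (- x2) (- x3)

-- Multiplication in LQ_{a,b}: i² = -a, j² = -b, ij = -ji = k
-- (hence k² = -ab, ik = -a j, ki = a j, jk = b i, kj = -b i).
mulQ : ℤ → ℤ → LQ → LQ → LQ
mulQ a b (quat x0 x1 x2 x3) (quat y0 y1 y2 y3) =
  quat (x0 * y0 - a * (x1 * y1) - b * (x2 * y2) - (a * b) * (x3 * y3))
       (x0 * y1 + x1 * y0 + b * (x2 * y3 - x3 * y2))
       (x0 * y2 + x2 * y0 + a * (x3 * y1 - x1 * y3))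
       (x0 * y3 + x3 * y0 + x1 * y2 - x2 * y1)

powQ : ℤ → ℤ → LQ → ℕ → LQ
powQ a b x zero = oneQ
powQ a b x (suc k) = mulQ a b x (powQ a b x k)

data InLQk (a b : ℤ) (k : ℕ) : LQ → Set where
  gen  : ∀ x → InLQk a b k (powQ a b x k)
  zro  : InLQk a b k zeroQ
  neg  : ∀ {y} → InLQk a b k y → InLQk a b k (negQ y)
  add  : ∀ {y z} → InLQk a b k y → InLQk a b k z → InLQk a b k (addQ y z)

sumPow : ℤ → ℤ → ℕ → List LQ → LQ
sumPow a b k [] = zeroQ
sumPow a b k (x ∷ xs) = addQ (powQ a b x k) (sumPow a b k xs)

SumOfAtMost : ℤ → ℤ → ℕ → ℕ → LQ → Set
SumOfAtMost a b k g y = Σ (List LQ) λ xs → (length xs ℕ.≤ g) × (sumPow a b k xs ≡ y)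

WaringBound : ℤ → ℤ → ℕ → ℕ → Set
WaringBound a b k g = ∀ y → InLQk a b k y → SumOfAtMost a b k g y

IsWaringNumber : ℤ → ℤ → ℕ → ℕ → Set
IsWaringNumber a b k g =
  (0 ℕ.< g) × WaringBound a b k g × (∀ h → 0 ℕ.< h → h ℕ.< g → ¬ WaringBound a b k h)

{-# OPTIONS --safe #-}

-- The additive group LQ² consists of the A + 2B₁i + 2B₂j + 2B₃k, and such an element is a sum of three squares iff there
-- are u, v₁, v₂, v₃ ∈ ℤ³ with u·vᵢ = Bᵢ and |u|² − a|v₁|² − b|v₂|² − ab|v₃|² = A.
--
-- Lower bound. For y = A + 2i with A ∈ {2, 4} chosen by a mod 4, two squares would give u, vᵢ ∈ ℤ² with u·v₁ = 1 and
-- v₂, v₃ orthogonal to u. Positivity of A forces v₂ = v₃ = 0, and then |v₁|²(A + a|v₁|²) = 1 + det(u, v₁)², impossible mod 4.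
--
-- Upper bound. Fix the last two coordinates (x, y) of u and the first coordinates −R of the vᵢ. If x² + y² − N(R) is,
-- up to a square factor q², itself a value N(M) of the form N = aX₁² + bX₂² + abX₃², then the representations with this
-- data contain lines along which A runs through an arithmetic progression A₀ + 2Lτ. Here L is an affine function of the
-- remaining parameters; if its coefficients are coprime, L can be made equal to 1 (or a small power of 2), and
-- congruences modulo 2, 4, 8, 16 finish the proof.
--
-- To find (x, y, R, M), one needs p = g² + Y² of the form A₁|α|² + A₂|β|² + A₃ with α, β ∈ ℤ[i] and gcd(g, Y) = 1.
-- Such p arise by moving along an isotropic vector of P² − a|s|² − b|t|², which exists by a Legendre-type descent over
-- ℤ[i] and is made coprime to 2ab by reflections. Multiplying α, β and g + Yi by suitable k ± i with k in prescribed
-- residue classes makes the coefficients of L coprime.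

module Submission where

open import Defs
open import Data.Integer using (ℤ; +_; _<_; _≤_)
open import Data.Integer.GCD using (gcd)
open import Data.Integer using (-[1+_]; _+_; _-_; _*_; -_; 0ℤ; 1ℤ) renaming (∣_∣ to abs)
open import Data.Integer.GCD using (gcd-greatest)
open import Data.Nat as ℕ using (ℕ; zero; suc; _≤ᵇ_; _≡ᵇ_; ⌊_/2⌋; z≤n; s≤s)
import Data.Nat.Properties as ℕ
import Data.Nat.Divisibility as ℕ∣
import Data.Nat.Tactic.RingSolver as NatRing
open import Data.Nat.GCD using (module Bézout; module GCD; gcd[m,n]≢0)
open import Data.Nat.ListAction using (product)
open import Data.Nat.Primality using (Prime; euclidsLemma; prime⇒nonZero; prime⇒nonTrivial; prime[2]; ¬prime[1]; prime⇒irreducible)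
open import Data.Nat.Primality.Factorisation using (factorise; PrimeFactorisation)
import Data.Integer as ℤ
import Data.Integer.Properties as ℤ
open import Data.Integer.DivMod using (_%ℕ_; _/ℕ_; n%ℕd<d; a≡a%ℕn+[a/ℕn]*n)
open import Data.Integer.Divisibility.Signed
open import Data.Integer.Tactic.RingSolver using (solve-∀)
open import Data.Fin using (Fin; toℕ; fromℕ<)
open import Data.Fin.Properties using (pigeonhole; toℕ<n; fromℕ<-injective)
open import Data.List using (List; []; _∷_; length)
open import Data.List.Relation.Unary.All using (All; []; _∷_)
open import Data.Product using (∃; ∃₂; _×_; _,_; proj₁; proj₂)
open import Data.Sum using (_⊎_; inj₁; inj₂)
open import Data.Empty using (⊥; ⊥-elim)
open import Relation.Nullary using (¬_; yes; no; Dec; ¬?; _×-dec_; _⊎-dec_)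
open import Relation.Nullary.Decidable using (from-no)
open import Relation.Binary.Definitions using (tri<; tri≈; tri>)
open import Relation.Binary.PropositionalEquality
open import Data.Bool using (Bool; true; false; if_then_else_; T)
open import Data.Unit using (tt)

-- On a line the coefficient of τ² is a multiple of q²(x² + y² - N(R)) - N(M); this is why x² + y² -
-- N(R) has to be a value of N. For q = 1 the condition reads x² + y² = N(R) + N(M), a relation
-- between |x + yi|² and the norms of the Gaussian integers Rᵢ + Mᵢi. It survives multiplication of
-- each of them by k + i or k - i, so one solution yields a whole family. The conjugate factors must
-- be mixed: with k - i in the third coordinate and k + i in the other two, the divisibility of the
-- coefficients of L by an odd prime depends on k, and one of k ≡ 0, 1 always works. As k is a
-- multiple of 16, it does not disturb the prime 2. The remaining difficulty is 2. A must agree with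
-- A₀ modulo 2L, and A₀ is tied to L through the same parameters. Even for L = 1 a single starting
-- point sees only one parity of A, so that a second one with the same L, or a larger L, is needed.
-- If both coefficients are even, L is always even, and the classes of A are shared among steps of
-- 4, 8 and 16.

-- Polynomial identities by normalisation

infixl 6 _:+_ _:-_
infixl 7 _:*_
infix 8 :-_
infix 9 #_
infix 4 _:=_

-- An identity is verified by one Boolean computation; the proof terms of the library's ring solver would be too large.
data Expr : Set where
  var : ℕ → Expr
  #_ : ℕ → Expr
  _:+_ _:-_ _:*_ : Expr → Expr → Expr
  :-_ : Expr → Expr

data Equation : Set where
  _:=_ : Expr → Expr → Equation

lookup : List ℤ → ℕ → ℤ
lookup [] _ = 0ℤ
lookup (x ∷ _) zero = x
lookup (_ ∷ ρ) (suc i) = lookup ρ i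

⟦_⟧ : Expr → List ℤ → ℤ
⟦ var i ⟧ ρ = lookup ρ i
⟦ # n ⟧ ρ = + n
⟦ e :+ f ⟧ ρ = ⟦ e ⟧ ρ + ⟦ f ⟧ ρ
⟦ e :- f ⟧ ρ = ⟦ e ⟧ ρ - ⟦ f ⟧ ρ
⟦ e :* f ⟧ ρ = ⟦ e ⟧ ρ * ⟦ f ⟧ ρ
⟦ :- e ⟧ ρ = - ⟦ e ⟧ ρ

Mono : Set
Mono = List ℕ

Poly : Set
Poly = List (ℤ × Mono)

mono-mul : Mono → Mono → Mono
mono-mul [] n = n
mono-mul m@(_ ∷ _) [] = m
mono-mul (i ∷ m) (j ∷ n) = if i ≤ᵇ j then i ∷ mono-mul m (j ∷ n) else j ∷ mono-mul (i ∷ m) n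

mono-≡ : Mono → Mono → Bool
mono-≡ [] [] = true
mono-≡ (i ∷ m) (j ∷ n) = if i ≡ᵇ j then mono-≡ m n else false
mono-≡ _ _ = false

-- The order is lexicographic, hence compatible with multiplication, so that sums of products stay sorted.
mono-≤ : Mono → Mono → Bool
mono-≤ [] _ = false
mono-≤ (_ ∷ _) [] = true
mono-≤ (i ∷ m) (j ∷ n) = if i ≡ᵇ j then mono-≤ m n else i ≤ᵇ j

plus : Poly → Poly → Poly
plus [] q = q
plus p@(_ ∷ _) [] = p
plus ((c , m) ∷ p) ((d , n) ∷ q) =
  if mono-≡ m n then (c + d , m) ∷ plus p q
  else if mono-≤ m n then (c , m) ∷ plus p ((d , n) ∷ q) else (d , n) ∷ plus ((c , m) ∷ p) q

scale : ℤ → Mono → Poly → Poly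
scale c m [] = []
scale c m ((d , n) ∷ p) = (c * d , mono-mul m n) ∷ scale c m p

times : Poly → Poly → Poly
times [] q = []
times ((c , m) ∷ p) q = plus (scale c m q) (times p q)

normalise : Expr → Poly
normalise (var i) = (1ℤ , i ∷ []) ∷ []
normalise (# n) = (+ n , []) ∷ []
normalise (e :+ f) = plus (normalise e) (normalise f)
normalise (e :- f) = plus (normalise e) (scale (- 1ℤ) [] (normalise f))
normalise (e :* f) = times (normalise e) (normalise f)
normalise (:- e) = scale (- 1ℤ) [] (normalise e)

vanishes : Poly → Bool
vanishes [] = true
vanishes ((+ 0 , _) ∷ p) = vanishes p
vanishes (_ ∷ _) = false

mono-≡-sound : ∀ m n → mono-≡ m n ≡ true → m ≡ n
mono-≡-sound [] [] _ = refl
mono-≡-sound (i ∷ m) (j ∷ n) e with i ≡ᵇ j in i≡j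
... | true = cong₂ _∷_ (ℕ.≡ᵇ⇒≡ i j (subst T (sym i≡j) tt)) (mono-≡-sound m n e)

if-elim : ∀ {A B : Set} b (f : A → B) {x y z} → (b ≡ true → f x ≡ z) → f y ≡ z → f (if b then x else y) ≡ z
if-elim true f p _ = p refl
if-elim false f _ q = q

module _ (ρ : List ℤ) where
  eval-mono : Mono → ℤ
  eval-mono [] = 1ℤ
  eval-mono (i ∷ m) = lookup ρ i * eval-mono m

  eval : Poly → ℤ
  eval [] = 0ℤ
  eval ((c , m) ∷ p) = c * eval-mono m + eval p

  eval-mono-mul : ∀ m n → eval-mono (mono-mul m n) ≡ eval-mono m * eval-mono n
  eval-mono-mul [] n = sym (ℤ.*-identityˡ (eval-mono n))
  eval-mono-mul (i ∷ m) [] = sym (ℤ.*-identityʳ (lookup ρ i * eval-mono m))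
  eval-mono-mul (i ∷ m) (j ∷ n) = if-elim (i ≤ᵇ j) eval-mono
      (λ _ → trans (cong (lookup ρ i *_) (eval-mono-mul m (j ∷ n))) (sym (ℤ.*-assoc (lookup ρ i) (eval-mono m) (lookup ρ j * eval-mono n))))
      (trans (cong (lookup ρ j *_) (eval-mono-mul (i ∷ m) n)) (lem (lookup ρ j) (lookup ρ i * eval-mono m) (eval-mono n)))
    where lem : ∀ x y z → x * (y * z) ≡ y * (x * z)
          lem = solve-∀

  eval-plus : ∀ p q → eval (plus p q) ≡ eval p + eval q
  eval-plus [] q = sym (ℤ.+-identityˡ (eval q))
  eval-plus (t ∷ p) [] = sym (ℤ.+-identityʳ (eval (t ∷ p)))
  eval-plus ((c , m) ∷ p) ((d , n) ∷ q) = if-elim (mono-≡ m n) eval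
      (λ m≡n → trans (cong (λ z → (c + d) * eval-mono m + z) (eval-plus p q))
        (trans (lem c d (eval-mono m) (eval p) (eval q)) (cong (λ k → c * eval-mono m + eval p + (d * eval-mono k + eval q)) (mono-≡-sound m n m≡n))))
      (if-elim (mono-≤ m n) eval
        (λ _ → trans (cong (λ z → c * eval-mono m + z) (eval-plus p ((d , n) ∷ q))) (sym (ℤ.+-assoc (c * eval-mono m) (eval p) (d * eval-mono n + eval q))))
        (trans (cong (λ z → d * eval-mono n + z) (eval-plus ((c , m) ∷ p) q)) (lem′ (d * eval-mono n) (c * eval-mono m + eval p) (eval q))))
    where
    lem : ∀ c d m p q → (c + d) * m + (p + q) ≡ c * m + p + (d * m + q)
    lem = solve-∀
    lem′ : ∀ x y z → x + (y + z) ≡ y + (x + z)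
    lem′ = solve-∀

  eval-scale : ∀ c m p → eval (scale c m p) ≡ c * eval-mono m * eval p
  eval-scale c m [] = sym (ℤ.*-zeroʳ (c * eval-mono m))
  eval-scale c m ((d , n) ∷ p) = trans (cong₂ (λ y z → c * d * y + z) (eval-mono-mul m n) (eval-scale c m p)) (lem c d (eval-mono m) (eval-mono n) (eval p))
    where lem : ∀ c d m n p → c * d * (m * n) + c * m * p ≡ c * m * (d * n + p)
          lem = solve-∀

  eval-times : ∀ p q → eval (times p q) ≡ eval p * eval q
  eval-times [] q = refl
  eval-times ((c , m) ∷ p) q = trans (eval-plus (scale c m q) (times p q)) (trans (cong₂ _+_ (eval-scale c m q) (eval-times p q)) (sym (ℤ.*-distribʳ-+ (eval q) (c * eval-mono m) (eval p))))

  eval-neg : ∀ p → eval (scale (- 1ℤ) [] p) ≡ - eval p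
  eval-neg p = trans (eval-scale (- 1ℤ) [] p) (ℤ.-1*i≡-i (eval p))

  -- Soundness does not rest on sortedness: in a badly ordered sum like terms would merely fail to
  -- meet, and the check would reject, never accept a false identity.
  normalise-sound : ∀ e → eval (normalise e) ≡ ⟦ e ⟧ ρ
  normalise-sound (var i) = lem (lookup ρ i)
    where lem : ∀ x → 1ℤ * (x * 1ℤ) + 0ℤ ≡ x
          lem = solve-∀
  normalise-sound (# n) = lem (+ n)
    where lem : ∀ x → x * 1ℤ + 0ℤ ≡ x
          lem = solve-∀
  normalise-sound (e :+ f) = trans (eval-plus (normalise e) (normalise f)) (cong₂ _+_ (normalise-sound e) (normalise-sound f))
  normalise-sound (e :- f) = trans (eval-plus (normalise e) (scale (- 1ℤ) [] (normalise f))) (cong₂ _+_ (normalise-sound e) (trans (eval-neg (normalise f)) (cong -_ (normalise-sound f))))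
  normalise-sound (e :* f) = trans (eval-times (normalise e) (normalise f)) (cong₂ _*_ (normalise-sound e) (normalise-sound f))
  normalise-sound (:- e) = trans (eval-neg (normalise e)) (cong -_ (normalise-sound e))

  eval-vanishes : ∀ p → vanishes p ≡ true → eval p ≡ 0ℤ
  eval-vanishes [] _ = refl
  eval-vanishes ((+ 0 , m) ∷ p) h = trans (ℤ.+-identityˡ (eval p)) (eval-vanishes p h)

Holds : Equation → List ℤ → Set
Holds (e := f) ρ = ⟦ e ⟧ ρ ≡ ⟦ f ⟧ ρ

check : Equation → Bool
check (e := f) = vanishes (normalise (e :- f))

holds : ∀ eq → check eq ≡ true → ∀ ρ → Holds eq ρ
holds (e := f) h ρ = ℤ.i-j≡0⇒i≡j (⟦ e ⟧ ρ) (⟦ f ⟧ ρ) (trans (sym (normalise-sound ρ (e :- f))) (eval-vanishes ρ (normalise (e :- f)) h))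

Op : ℕ → Set
Op zero = Equation
Op (suc n) = Expr → Op n

close : ∀ n → ℕ → Op n → Equation
close zero _ e = e
close (suc n) i f = close n (suc i) (f (var i))

Forall : ℕ → (List ℤ → Set) → Set
Forall zero P = P []
Forall (suc n) P = ∀ x → Forall n (λ ρ → P (x ∷ ρ))

forall-intro : ∀ n (P : List ℤ → Set) → (∀ ρ → P ρ) → Forall n P
forall-intro zero P h = h []
forall-intro (suc n) P h x = forall-intro n (λ ρ → P (x ∷ ρ)) (λ ρ → h (x ∷ ρ))

-- `f` is given in higher-order form; `close` supplies the variables 0, ..., n - 1, and the
-- conclusion unfolds by evaluation to the plain identity over ℤ. The proof of `check` is `refl` at
-- every use.
ring! : ∀ n (f : Op n) → check (close n 0 f) ≡ true → Forall n (Holds (close n 0 f))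
ring! n f h = forall-intro n (Holds (close n 0 f)) (holds (close n 0 f) h)

-- Divisibility and Bézout relations

by1 : ∀ {d x y} c → x ≡ c * y → d ∣ y → d ∣ x
by1 c refl d∣y = ∣n⇒∣m*n c d∣y

by2 : ∀ {d x y z} c e → x ≡ c * y + e * z → d ∣ y → d ∣ z → d ∣ x
by2 c e refl p q = ∣m∣n⇒∣m+n (∣n⇒∣m*n c p) (∣n⇒∣m*n e q)

by3 : ∀ {d x y z w} c e f → x ≡ c * y + e * z + f * w → d ∣ y → d ∣ z → d ∣ w → d ∣ x
by3 c e f refl p q r = ∣m∣n⇒∣m+n (by2 c e refl p q) (∣n⇒∣m*n f r)

by4 : ∀ {d x y z w v} c e f g → x ≡ c * y + e * z + f * w + g * v → d ∣ y → d ∣ z → d ∣ w → d ∣ v → d ∣ x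
by4 c e f g refl p q r s = ∣m∣n⇒∣m+n (by3 c e f refl p q r) (∣n⇒∣m*n g s)

-- Equality modulo the relations l ≡ r, with explicit cofactors.
mod1 : ∀ {x y l r} c → x - y ≡ c * (l - r) → l ≡ r → x ≡ y
mod1 {x} {y} {l} c e refl = ℤ.i-j≡0⇒i≡j x y (trans e (trans (cong (c *_) (ℤ.+-inverseʳ l)) (ℤ.*-zeroʳ c)))

mod2 : ∀ {x y l r l′ r′} c e → x - y ≡ c * (l - r) + e * (l′ - r′) → l ≡ r → l′ ≡ r′ → x ≡ y
mod2 {x} {y} {l} {l′ = l′} c e eq refl refl = mod1 {l = l} {r = l} c (trans eq (lem c e l l′)) refl
  where lem : ∀ c e l l′ → c * (l - l) + e * (l′ - l′) ≡ c * (l - l)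
        lem = solve-∀

cancelˡ : ∀ {c x y} → c ≢ 0ℤ → c * x ≡ c * y → x ≡ y
cancelˡ {c} {x} {y} c≢0 = ℤ.*-cancelˡ-≡ c x y {{ℤ.≢-nonZero c≢0}}

no-zero-div : ∀ {x y} → x * y ≡ 0ℤ → x ≢ 0ℤ → y ≡ 0ℤ
no-zero-div {x} {y} e x≢0 with ℤ.i*j≡0⇒i≡0∨j≡0 x e
... | inj₁ p = ⊥-elim (x≢0 p)
... | inj₂ p = p

*-≢0 : ∀ {x y} → x ≢ 0ℤ → y ≢ 0ℤ → x * y ≢ 0ℤ
*-≢0 p q e = q (no-zero-div e p)

∤⇒≢0 : ∀ {d x} → ¬ d ∣ x → x ≢ 0ℤ
∤⇒≢0 {d} d∤x refl = d∤x (divides 0ℤ refl)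

euclid : ∀ {p x y} → Prime p → + p ∣ x * y → + p ∣ x ⊎ + p ∣ y
euclid {p} {x} {y} pr h with euclidsLemma (abs x) (abs y) pr (subst (p ℕ∣.∣_) (ℤ.abs-* x y) (∣⇒∣ᵤ h))
... | inj₁ q = inj₁ (∣ᵤ⇒∣ q)
... | inj₂ q = inj₂ (∣ᵤ⇒∣ q)

∤-* : ∀ {p x y} → Prime p → ¬ + p ∣ x → ¬ + p ∣ y → ¬ + p ∣ x * y
∤-* pr p q h with euclid pr h
... | inj₁ e = p e
... | inj₂ e = q e

∣-square : ∀ {p x} → Prime p → + p ∣ x * x → + p ∣ x
∣-square pr h with euclid pr h
... | inj₁ e = e
... | inj₂ e = e

prime∤1 : ∀ {p} → Prime p → ¬ + p ∣ 1ℤ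
prime∤1 {p} pr h with ℕ∣.∣1⇒≡1 (∣⇒∣ᵤ h)
... | refl = ¬prime[1] pr

∣-prime : ∀ {p q} → Prime p → Prime q → + p ∣ + q → p ≡ q
∣-prime {p} pp pq h with prime⇒irreducible pq (∣⇒∣ᵤ h)
... | inj₁ refl = ⊥-elim (¬prime[1] pp)
... | inj₂ e = e

odd-prime∤2 : ∀ {p} → Prime p → p ≢ 2 → ¬ + p ∣ + 2
odd-prime∤2 pr p≢2 h = p≢2 (∣-prime pr prime[2] h)

prime≢0 : ∀ {p} → Prime p → + p ≢ 0ℤ
prime≢0 pr e = ℕ.≢-nonZero⁻¹ _ {{prime⇒nonZero pr}} (ℤ.+-injective e)

-- Induction over the prime factors with multiplicity. That the cofactor is nonzero lets a step
-- bound `p` by `p * n`.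
product-ind : (P : ℕ → Set) → P 1 → (∀ p n → Prime p → n ≢ 0 → P n → P (p ℕ.* n)) → ∀ n → n ≢ 0 → P n
product-ind P P1 step n n≢0 = subst P (sym (PrimeFactorisation.isFactorisation f)) (go _ (PrimeFactorisation.factorsPrime f))
  where
  f = factorise n {{ℕ.≢-nonZero n≢0}}
  nz : ∀ ps → All Prime ps → product ps ≢ 0
  nz [] [] ()
  nz (p ∷ ps) (pr ∷ prs) e with ℕ.m*n≡0⇒m≡0∨n≡0 p e
  ... | inj₁ z = ℕ.≢-nonZero⁻¹ p {{prime⇒nonZero pr}} z
  ... | inj₂ z = nz ps prs z
  go : ∀ ps → All Prime ps → P (product ps)
  go [] [] = P1
  go (p ∷ ps) (pr ∷ prs) = step p (product ps) pr (nz ps prs) (go ps prs)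

prime-divisor : ∀ n → n ≢ 1 → ∃ λ p → Prime p × + p ∣ + n
prime-divisor zero _ = 2 , prime[2] , divides 0ℤ refl
prime-divisor n@(suc _) = product-ind (λ n → n ≢ 1 → ∃ λ p → Prime p × + p ∣ + n)
  (λ h → ⊥-elim (h refl))
  (λ p m pr _ _ _ → p , pr , divides (+ m) (trans (ℤ.pos-* p m) (ℤ.*-comm (+ p) (+ m)))) n (λ ())

abs-multiple : ∀ z → ∃ λ e → e * z ≡ + abs z
abs-multiple (+ n) = 1ℤ , ℤ.*-identityˡ (+ n)
abs-multiple -[1+ n ] = - 1ℤ , ℤ.-1*i≡-i -[1+ n ]

bezout : ∀ x y → ∃ λ g → ∃₂ λ u v → u * x + v * y ≡ g × g ∣ x × g ∣ y
bezout x y = go (Bézout.lemma (abs x) (abs y))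
  where
  ex = proj₁ (abs-multiple x)
  ey = proj₁ (abs-multiple y)
  cast : ∀ d m n k l → d ℕ.+ m ℕ.* n ≡ k ℕ.* l → + d + + m * + n ≡ + k * + l
  cast d m n k l e = trans (cong (λ z → + d + z) (sym (ℤ.pos-* m n))) (trans (sym (ℤ.pos-+ d (m ℕ.* n))) (trans (cong +_ e) (ℤ.pos-* k l)))
  comb : ∀ m n d p q → ex * x ≡ p → ey * y ≡ q → d + n * q ≡ m * p → m * ex * x + - n * ey * y ≡ d
  comb m n d p q refl refl e = mod1 (- 1ℤ) (lem m n d ex x ey y) e
    where lem : ∀ m n d ex x ey y → m * ex * x + - n * ey * y - d ≡ - 1ℤ * (d + n * (ey * y) - m * (ex * x))
          lem = solve-∀
  comb′ : ∀ m n d p q → ex * x ≡ p → ey * y ≡ q → d + m * p ≡ n * q → - m * ex * x + n * ey * y ≡ d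
  comb′ m n d p q refl refl e = mod1 (- 1ℤ) (lem m n d ex x ey y) e
    where lem : ∀ m n d ex x ey y → - m * ex * x + n * ey * y - d ≡ - 1ℤ * (d + m * (ex * x) - n * (ey * y))
          lem = solve-∀
  coef : ∀ d → Bézout.Identity.Identity d (abs x) (abs y) → ∃₂ λ u v → u * x + v * y ≡ + d
  coef d (Bézout.Identity.+- m n e) = + m * ex , - (+ n) * ey ,
    comb (+ m) (+ n) (+ d) _ _ (proj₂ (abs-multiple x)) (proj₂ (abs-multiple y)) (cast d n _ m _ e)
  coef d (Bézout.Identity.-+ m n e) = - (+ m) * ex , + n * ey ,
    comb′ (+ m) (+ n) (+ d) _ _ (proj₂ (abs-multiple x)) (proj₂ (abs-multiple y)) (cast d m _ n _ e)
  go : Bézout.Lemma (abs x) (abs y) → ∃ λ g → ∃₂ λ u v → u * x + v * y ≡ g × g ∣ x × g ∣ y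
  go (Bézout.result d g b) = let u , v , e = coef d b in
    + d , u , v , e , ∣-trans (∣ᵤ⇒∣ {+ d} {+ abs x} (GCD.gcd∣m g)) ∣m∣∣m , ∣-trans (∣ᵤ⇒∣ {+ d} {+ abs y} (GCD.gcd∣n g)) ∣m∣∣m

-- Zero is excluded as well, since every prime divides it; only ±1 remain. Coprimality is stated
-- prime by prime throughout, and this turns it into a Bézout relation.
unit : ∀ g → (∀ p → Prime p → ¬ + p ∣ g) → ∃ λ s → s * g ≡ 1ℤ
unit (+ n) h with n ℕ.≟ 1
... | yes refl = 1ℤ , refl
... | no n≢1 = let p , pr , d = prime-divisor n n≢1 in ⊥-elim (h p pr d)
unit -[1+ 0 ] h = - 1ℤ , refl
unit -[1+ suc n ] h = let p , pr , d = prime-divisor (suc (suc n)) (λ ()) in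
  ⊥-elim (h p pr (∣m⇒∣-m d))

coprime : ∀ x y → (∀ p → Prime p → + p ∣ x → ¬ + p ∣ y) → ∃₂ λ u v → u * x + v * y ≡ 1ℤ
coprime x y h =
  let g , u , v , e , gx , gy = bezout x y
      s , e′ = unit g (λ p pr d → h p pr (∣-trans d gx) (∣-trans d gy))
  in s * u , s * v , trans (lem s u v x y) (trans (cong (s *_) e) e′)
  where lem : ∀ s u v x y → s * u * x + s * v * y ≡ s * (u * x + v * y)
        lem = solve-∀

inverse : ∀ {p x} → Prime p → ¬ + p ∣ x → ∃ λ u → + p ∣ u * x - 1ℤ
inverse {p} {x} pr h =
  let u , v , e = coprime (+ p) x (λ q pq d e → h (subst (λ q → + q ∣ x) (∣-prime pq pr d) e))
  in v , divides (- u) (mod1 1ℤ (lem u (+ p) v x) e)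
  where lem : ∀ u p v x → v * x - 1ℤ - (- u * p) ≡ 1ℤ * (u * p + v * x - 1ℤ)
        lem = solve-∀

-- Sums of two squares modulo a prime

<⇒∃ : ∀ {m n} → m ℕ.< n → ∃ λ d → m ℕ.+ suc d ≡ n
<⇒∃ {m} h = let d , e = ℕ.m≤n⇒∃[o]m+o≡n h in d , trans (ℕ.+-suc m d) e

residue-≡ : ∀ p .{{_ : ℕ.NonZero p}} x y → x %ℕ p ≡ y %ℕ p → + p ∣ x - y
residue-≡ p x y e = divides (x /ℕ p - y /ℕ p) (lem x y (+ (x %ℕ p)) (+ (y %ℕ p)) (x /ℕ p) (y /ℕ p) (+ p)
    (a≡a%ℕn+[a/ℕn]*n x p) (a≡a%ℕn+[a/ℕn]*n y p) (cong +_ e))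
  where
  difference : ∀ r q t p → r + q * p - (r + t * p) ≡ (q - t) * p
  difference = solve-∀
  lem : ∀ x y r s q t p → x ≡ r + q * p → y ≡ s + t * p → r ≡ s → x - y ≡ (q - t) * p
  lem _ _ r _ q t p refl refl refl = difference r q t p

-- With y = x + suc d one has y² - x² = (y - x)(y + x), and for x < y ≤ p/2 both factors lie
-- strictly between 0 and p.
squares-distinct : ∀ {p} → Prime p → ∀ x d → x ℕ.+ suc d ℕ.≤ ⌊ p /2⌋ →
  ¬ + p ∣ + (x ℕ.+ suc d) * + (x ℕ.+ suc d) - + x * + x
squares-distinct {p} pr x d h dv = absurd (euclidsLemma (suc d) (x ℕ.+ (x ℕ.+ suc d)) pr (subst (p ℕ∣.∣_) refl (∣⇒∣ᵤ (subst (+ p ∣_) cast dv))))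
  where
  y = x ℕ.+ suc d
  ring : ∀ x s → (x + s) * (x + s) - x * x ≡ s * (x + (x + s))
  ring = solve-∀
  cast : + y * + y - + x * + x ≡ + (suc d ℕ.* (x ℕ.+ y))
  cast = trans (cong (λ z → z * z - + x * + x) (ℤ.pos-+ x (suc d)))
    (trans (ring (+ x) (+ suc d))
    (trans (cong (λ z → + suc d * (+ x + z)) (sym (ℤ.pos-+ x (suc d))))
    (trans (cong (+ suc d *_) (sym (ℤ.pos-+ x y))) (sym (ℤ.pos-* (suc d) (x ℕ.+ y))))))
  half : ⌊ p /2⌋ ℕ.+ ⌊ p /2⌋ ℕ.≤ p
  half = ℕ.≤-trans (ℕ.+-monoʳ-≤ ⌊ p /2⌋ (ℕ.⌊n/2⌋≤⌈n/2⌉ p)) (ℕ.≤-reflexive (ℕ.⌊n/2⌋+⌈n/2⌉≡n p))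
  sum<p : x ℕ.+ y ℕ.< p
  sum<p = ℕ.<-≤-trans (ℕ.+-mono-<-≤ (ℕ.<-≤-trans (ℕ.m<m+n x ℕ.z<s) h) h) half
  absurd : p ℕ∣.∣ suc d ⊎ p ℕ∣.∣ (x ℕ.+ y) → ⊥
  absurd (inj₁ q) = ℕ.<⇒≱ sum<p (ℕ.≤-trans (ℕ∣.∣⇒≤ q) (ℕ.≤-trans (ℕ.m≤n+m (suc d) x) (ℕ.m≤n+m y x)))
  absurd (inj₂ q) = ℕ.<⇒≱ sum<p (ℕ∣.∣⇒≤ {{ℕ.>-nonZero (ℕ.<-≤-trans ℕ.z<s (ℕ.≤-trans (ℕ.m≤n+m (suc d) x) (ℕ.m≤n+m y x)))}} q)

squares-injective : ∀ {p} → Prime p → ∀ x y → x ℕ.≤ ⌊ p /2⌋ → y ℕ.≤ ⌊ p /2⌋ → x ≢ y → ¬ + p ∣ + x * + x - + y * + y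
squares-injective {p} pr x y hx hy x≢y dv with ℕ.<-cmp x y
... | tri≈ _ e _ = x≢y e
... | tri< x<y _ _ = let d , e = <⇒∃ x<y in squares-distinct pr x d (subst (ℕ._≤ ⌊ p /2⌋) (sym e) hy)
        (subst (λ z → + p ∣ + z * + z - + x * + x) (sym e) (by1 (- 1ℤ) (lem (+ x) (+ y)) dv))
  where lem : ∀ x y → y * y - x * x ≡ - 1ℤ * (x * x - y * y)
        lem = solve-∀
... | tri> _ _ y<x = let d , e = <⇒∃ y<x in squares-distinct pr y d (subst (ℕ._≤ ⌊ p /2⌋) (sym e) hx)
        (subst (λ z → + p ∣ + z * + z - + y * + y) (sym e) dv)

-- Pigeonhole: the ⌊p/2⌋ + 1 values x² and the ⌊p/2⌋ + 1 values c - y² are more than p together, and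
-- neither family repeats a residue. The bounds on x and y keep the quotient by p below p, which
-- drives the descents that follow.
two-squares-mod : ∀ {p} → Prime p → ∀ c → ∃₂ λ x y → x ℕ.≤ ⌊ p /2⌋ × y ℕ.≤ ⌊ p /2⌋ × + p ∣ + x * + x + + y * + y - c
two-squares-mod {p} pr c = result (pigeonhole p<2K f)
  where
  instance nz = prime⇒nonZero pr
  h = ⌊ p /2⌋
  K = suc h
  p<2K : p ℕ.< K ℕ.+ K
  p<2K = s≤s (ℕ.≤-trans (ℕ.≤-reflexive (sym (ℕ.⌊n/2⌋+⌈n/2⌉≡n p))) (ℕ.+-monoʳ-≤ h (ceil p)))
    where ceil : ∀ n → ⌊ suc n /2⌋ ℕ.≤ suc ⌊ n /2⌋
          ceil zero = z≤n
          ceil (suc zero) = ℕ.≤-refl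
          ceil (suc (suc n)) = s≤s (ceil n)
  val : ℕ → ℤ
  val i with i ℕ.<? K
  ... | yes _ = + i * + i
  ... | no _ = c - + (i ℕ.∸ K) * + (i ℕ.∸ K)
  f : Fin (K ℕ.+ K) → Fin p
  f i = fromℕ< (n%ℕd<d (val (toℕ i)) p)
  ringa : ∀ c x y → c - x * x - (c - y * y) ≡ y * y - x * x
  ringa = solve-∀
  ringb : ∀ c x y → x * x + y * y - c ≡ 1ℤ * (x * x - (c - y * y))
  ringb = solve-∀
  ringc : ∀ c x y → x * x + y * y - c ≡ - 1ℤ * (c - y * y - x * x)
  ringc = solve-∀
  low : ∀ i → i ℕ.< K ℕ.+ K → i ℕ.∸ K ℕ.≤ h
  low i q = ℕ.≤-pred (ℕ.m<n+o⇒m∸n<o i K q)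
  main : ∀ i j → i ℕ.< K ℕ.+ K → j ℕ.< K ℕ.+ K → i ≢ j → + p ∣ val i - val j →
    ∃₂ λ x y → x ℕ.≤ h × y ℕ.≤ h × + p ∣ + x * + x + + y * + y - c
  main i j hi hj i≢j d with i ℕ.<? K | j ℕ.<? K
  ... | yes a | yes b = ⊥-elim (squares-injective pr i j (ℕ.≤-pred a) (ℕ.≤-pred b) i≢j d)
  ... | yes a | no b = i , j ℕ.∸ K , ℕ.≤-pred a , low j hj , by1 1ℤ (ringb c (+ i) (+ (j ℕ.∸ K))) d
  ... | no a | yes b = j , i ℕ.∸ K , ℕ.≤-pred b , low i hi , by1 (- 1ℤ) (ringc c (+ j) (+ (i ℕ.∸ K))) d
  ... | no a | no b = ⊥-elim (squares-injective pr (j ℕ.∸ K) (i ℕ.∸ K) (low j hj) (low i hi)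
      (λ e → i≢j (ℕ.∸-cancelʳ-≡ (ℕ.≮⇒≥ a) (ℕ.≮⇒≥ b) (sym e)))
      (subst (+ p ∣_) (ringa c (+ (i ℕ.∸ K)) (+ (j ℕ.∸ K))) d))
  result : (∃₂ λ i j → toℕ i ℕ.< toℕ j × f i ≡ f j) → ∃₂ λ x y → x ℕ.≤ h × y ℕ.≤ h × + p ∣ + x * + x + + y * + y - c
  result (i , j , i<j , e) = main (toℕ i) (toℕ j) (toℕ<n i) (toℕ<n j) (ℕ.<⇒≢ i<j)
    (residue-≡ p (val (toℕ i)) (val (toℕ j)) (fromℕ<-injective _ _ (n%ℕd<d (val (toℕ i)) p) (n%ℕd<d (val (toℕ j)) p) e))

-- Legendre's theorem over the Gaussian integers

sq-abs : ∀ x → x * x ≡ + (abs x ℕ.* abs x)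
sq-abs (+ n) = sym (ℤ.pos-* n n)
sq-abs -[1+ n ] = refl

sum-sq-abs : ∀ x y → x * x + y * y ≡ + (abs x ℕ.* abs x ℕ.+ abs y ℕ.* abs y)
sum-sq-abs x y = trans (cong₂ _+_ (sq-abs x) (sq-abs y)) (sym (ℤ.pos-+ (abs x ℕ.* abs x) (abs y ℕ.* abs y)))

-- m is, up to a nonzero factor |n|², a value of the norm form |x|² − b |y|², where n, x, y are Gaussian integers.
record NormMultiple (b m : ℤ) : Set where
  constructor norm
  field
    n₁ n₂ x₁ x₂ y₁ y₂ : ℤ
    n≢0 : n₁ * n₁ + n₂ * n₂ ≢ 0ℤ
    value : m * (n₁ * n₁ + n₂ * n₂) ≡ x₁ * x₁ + x₂ * x₂ - b * (y₁ * y₁ + y₂ * y₂)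

norm-mul : ∀ n₁ n₂ m₁ m₂ → (n₁ * n₁ + n₂ * n₂) * (m₁ * m₁ + m₂ * m₂) ≡
  (n₁ * m₁ - n₂ * m₂) * (n₁ * m₁ - n₂ * m₂) + (n₁ * m₂ + n₂ * m₁) * (n₁ * m₂ + n₂ * m₁)
norm-mul = solve-∀

-- Multiplicativity of the norm |x|² - b|y|² of x + yj in the quaternion algebra with i² = -1 and j²
-- = b.
quaternion-norm-mul : ∀ b x₁ x₂ y₁ y₂ u₁ u₂ v₁ v₂ →
  (x₁ * x₁ + x₂ * x₂ - b * (y₁ * y₁ + y₂ * y₂)) * (u₁ * u₁ + u₂ * u₂ - b * (v₁ * v₁ + v₂ * v₂)) ≡
  (x₁ * u₁ - x₂ * u₂ + b * (y₁ * v₁ + y₂ * v₂)) * (x₁ * u₁ - x₂ * u₂ + b * (y₁ * v₁ + y₂ * v₂))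
  + (x₁ * u₂ + x₂ * u₁ + b * (y₂ * v₁ - y₁ * v₂)) * (x₁ * u₂ + x₂ * u₁ + b * (y₂ * v₁ - y₁ * v₂))
  - b * ((x₁ * v₁ - x₂ * v₂ + (y₁ * u₁ + y₂ * u₂)) * (x₁ * v₁ - x₂ * v₂ + (y₁ * u₁ + y₂ * u₂))
  + (x₁ * v₂ + x₂ * v₁ + (y₂ * u₁ - y₁ * u₂)) * (x₁ * v₂ + x₂ * v₁ + (y₂ * u₁ - y₁ * u₂)))
quaternion-norm-mul = solve-∀

NM-mul : ∀ {b m m′} → NormMultiple b m → NormMultiple b m′ → NormMultiple b (m * m′)
NM-mul {b} {m} {m′} (norm n₁ n₂ x₁ x₂ y₁ y₂ nz e) (norm k₁ k₂ u₁ u₂ v₁ v₂ nz′ e′) =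
  norm (n₁ * k₁ - n₂ * k₂) (n₁ * k₂ + n₂ * k₁)
    (x₁ * u₁ - x₂ * u₂ + b * (y₁ * v₁ + y₂ * v₂)) (x₁ * u₂ + x₂ * u₁ + b * (y₂ * v₁ - y₁ * v₂))
    (x₁ * v₁ - x₂ * v₂ + (y₁ * u₁ + y₂ * u₂)) (x₁ * v₂ + x₂ * v₁ + (y₂ * u₁ - y₁ * u₂))
    (λ z → *-≢0 nz nz′ (trans (norm-mul n₁ n₂ k₁ k₂) z))
    (trans (cong (m * m′ *_) (sym (norm-mul n₁ n₂ k₁ k₂)))
    (trans (swap m m′ (n₁ * n₁ + n₂ * n₂) (k₁ * k₁ + k₂ * k₂))
    (trans (cong₂ _*_ e e′) (quaternion-norm-mul b x₁ x₂ y₁ y₂ u₁ u₂ v₁ v₂))))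
  where swap : ∀ m m′ n k → m * m′ * (n * k) ≡ m * n * (m′ * k)
        swap = solve-∀

NM-square : ∀ {b m k} → k ≢ 0ℤ → NormMultiple b (k * k * m) → NormMultiple b m
NM-square {b} {m} {k} k≢0 (norm n₁ n₂ x₁ x₂ y₁ y₂ nz e) = norm (k * n₁) (k * n₂) x₁ x₂ y₁ y₂
  (λ z → *-≢0 (*-≢0 k≢0 k≢0) nz (trans (lem k n₁ n₂) z)) (trans (lem′ m k n₁ n₂) e)
  where lem : ∀ k n₁ n₂ → k * k * (n₁ * n₁ + n₂ * n₂) ≡ k * n₁ * (k * n₁) + k * n₂ * (k * n₂)
        lem = solve-∀
        lem′ : ∀ m k n₁ n₂ → m * (k * n₁ * (k * n₁) + k * n₂ * (k * n₂)) ≡ k * k * m * (n₁ * n₁ + n₂ * n₂)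
        lem′ = solve-∀

-- The product of m and m m′ is m² m′, and the square is absorbed by the free factor |n|².
NM-div : ∀ {b} m {m′} → m ≢ 0ℤ → NormMultiple b (m * m′) → NormMultiple b m → NormMultiple b m′
NM-div {b} m {m′} m≢0 p q = NM-square m≢0 (subst (NormMultiple b) (lem m m′) (NM-mul q p))
  where lem : ∀ m m′ → m * (m * m′) ≡ m * m * m′
        lem = solve-∀

-- If b |y|² = |x|², the form |x|² − b |y|² is hyperbolic and hence universal.
NM-isotropic : ∀ {b} m x₁ x₂ y₁ y₂ → x₁ * x₁ + x₂ * x₂ ≢ 0ℤ → x₁ * x₁ + x₂ * x₂ ≡ b * (y₁ * y₁ + y₂ * y₂) → NormMultiple b m
NM-isotropic {b} m x₁ x₂ y₁ y₂ nz e = norm (+ 2 * x₁) (+ 2 * x₂) ((m + 1ℤ) * x₁) ((m + 1ℤ) * x₂) ((m - 1ℤ) * y₁) ((m - 1ℤ) * y₂)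
  (λ z → *-≢0 {+ 4} (λ ()) nz (trans (lem x₁ x₂) z))
  (mod1 (- ((m - 1ℤ) * (m - 1ℤ))) (lem′ b m x₁ x₂ y₁ y₂) e)
  where lem : ∀ x₁ x₂ → + 4 * (x₁ * x₁ + x₂ * x₂) ≡ + 2 * x₁ * (+ 2 * x₁) + + 2 * x₂ * (+ 2 * x₂)
        lem = solve-∀
        lem′ : ∀ b m x₁ x₂ y₁ y₂ → m * (+ 2 * x₁ * (+ 2 * x₁) + + 2 * x₂ * (+ 2 * x₂)) -
           ((m + 1ℤ) * x₁ * ((m + 1ℤ) * x₁) + (m + 1ℤ) * x₂ * ((m + 1ℤ) * x₂) - b * ((m - 1ℤ) * y₁ * ((m - 1ℤ) * y₁) + (m - 1ℤ) * y₂ * ((m - 1ℤ) * y₂)))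
           ≡ - ((m - 1ℤ) * (m - 1ℤ)) * (x₁ * x₁ + x₂ * x₂ - b * (y₁ * y₁ + y₂ * y₂))
        lem′ = ring! 6 (λ b m x₁ x₂ y₁ y₂ → m :* (# 2 :* x₁ :* (# 2 :* x₁) :+ # 2 :* x₂ :* (# 2 :* x₂)) :-
           ((m :+ # 1) :* x₁ :* ((m :+ # 1) :* x₁) :+ (m :+ # 1) :* x₂ :* ((m :+ # 1) :* x₂) :- b :* ((m :- # 1) :* y₁ :* ((m :- # 1) :* y₁) :+ (m :- # 1) :* y₂ :* ((m :- # 1) :* y₂)))
           := :- ((m :- # 1) :* (m :- # 1)) :* (x₁ :* x₁ :+ x₂ :* x₂ :- b :* (y₁ :* y₁ :+ y₂ :* y₂))) refl

-- a|n|² = |x|² - b|y|² can be read as b|y|² = |x|² - a|n|². This has the required form unless y =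
-- 0; then |x|² = a|n|², and the form with coefficient a is isotropic.
NM-sym : ∀ {a b} → a ≢ 0ℤ → NormMultiple b a → NormMultiple a b
NM-sym {a} {b} a≢0 (norm n₁ n₂ x₁ x₂ y₁ y₂ nz e) with y₁ * y₁ + y₂ * y₂ ℤ.≟ 0ℤ
... | no y≢0 = norm y₁ y₂ x₁ x₂ n₁ n₂ y≢0 (mod1 1ℤ (lem a b (n₁ * n₁ + n₂ * n₂) (x₁ * x₁ + x₂ * x₂) (y₁ * y₁ + y₂ * y₂)) e)
  where lem : ∀ a b n x y → b * y - (x - a * n) ≡ 1ℤ * (a * n - (x - b * y))
        lem = solve-∀
... | yes y≡0 = NM-isotropic b x₁ x₂ n₁ n₂ (λ z → *-≢0 a≢0 nz (trans (sym x≡an) z)) x≡an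
  where lem : ∀ a b n x y → x - a * n ≡ - 1ℤ * (a * n - (x - b * y)) + b * (y - 0ℤ)
        lem = solve-∀
        x≡an : x₁ * x₁ + x₂ * x₂ ≡ a * (n₁ * n₁ + n₂ * n₂)
        x≡an = mod2 (- 1ℤ) b (lem a b (n₁ * n₁ + n₂ * n₂) (x₁ * x₁ + x₂ * x₂) (y₁ * y₁ + y₂ * y₂)) e y≡0

NM-1 : ∀ b → NormMultiple b 1ℤ
NM-1 b = norm 1ℤ 0ℤ 1ℤ 0ℤ 0ℤ 0ℤ (λ ()) (lem b)
  where lem : ∀ b → 1ℤ ≡ 1ℤ - b * 0ℤ
        lem = solve-∀

NM-below : ∀ {b} ℓ → (∀ r → Prime r → r ℕ.< ℓ → NormMultiple b (+ r)) → ∀ k → k ≢ 0 → k ℕ.< ℓ → NormMultiple b (+ k)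
NM-below {b} ℓ h = product-ind (λ k → k ℕ.< ℓ → NormMultiple b (+ k)) (λ _ → NM-1 b)
  (λ p n pr n≢0 ih lt → subst (NormMultiple b) (sym (ℤ.pos-* p n))
     (NM-mul (h p pr (ℕ.≤-<-trans (ℕ.m≤m*n p n {{ℕ.≢-nonZero n≢0}}) lt)) (ih (ℕ.≤-<-trans (ℕ.m≤n*m n p {{prime⇒nonZero pr}}) lt))))

NM-descend : ∀ {b} ℓ → (∀ r → Prime r → r ℕ.< ℓ → NormMultiple b (+ r)) → ∀ k → k ≢ 0 → k ℕ.< ℓ → NormMultiple b (+ k * + ℓ) → NormMultiple b (+ ℓ)
NM-descend ℓ h k k≢0 lt p = NM-div (+ k) (λ e → k≢0 (ℤ.+-injective e)) p (NM-below ℓ h k k≢0 lt)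

NM-product : ∀ {b} → (∀ r → Prime r → NormMultiple b (+ r)) → ∀ k → k ≢ 0 → NormMultiple b (+ k)
NM-product {b} h = product-ind (λ k → NormMultiple b (+ k)) (NM-1 b)
  (λ p n pr _ ih → subst (NormMultiple b) (sym (ℤ.pos-* p n)) (NM-mul (h p pr) ih))

half-square : ∀ n x → x ℕ.≤ ⌊ n /2⌋ → 4 ℕ.* (x ℕ.* x) ℕ.≤ n ℕ.* n
half-square n x h = ℕ.≤-trans (ℕ.≤-reflexive (lem x)) (ℕ.*-mono-≤ 2x≤n 2x≤n)
  where
  lem : ∀ x → 4 ℕ.* (x ℕ.* x) ≡ (x ℕ.+ x) ℕ.* (x ℕ.+ x)
  lem = NatRing.solve-∀
  2x≤n : x ℕ.+ x ℕ.≤ n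
  2x≤n = ℕ.≤-trans (ℕ.+-mono-≤ h h) (ℕ.≤-trans (ℕ.+-monoʳ-≤ ⌊ n /2⌋ (ℕ.⌊n/2⌋≤⌈n/2⌉ n)) (ℕ.≤-reflexive (ℕ.⌊n/2⌋+⌈n/2⌉≡n n)))

-- For x, y ≤ ℓ/2 the bound is at most 1 + ℓ²/2, which is less than ℓ². The summand 1 serves the
-- form x² + y² + 1.
quotient< : ∀ ℓ x y k → x ℕ.≤ ⌊ ℓ /2⌋ → y ℕ.≤ ⌊ ℓ /2⌋ → 2 ℕ.≤ ℓ → k ℕ.* ℓ ℕ.≤ 1 ℕ.+ (x ℕ.* x ℕ.+ y ℕ.* y) → k ℕ.< ℓ
quotient< ℓ x y k hx hy 2≤ℓ h with k ℕ.<? ℓ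
... | yes lt = lt
... | no nlt = ⊥-elim (ℕ.<⇒≱ 4<2ℓℓ (ℕ.+-cancelʳ-≤ (2 ℕ.* (ℓ ℕ.* ℓ)) _ _ big))
  where
  ℓℓ = ℓ ℕ.* ℓ
  4<2ℓℓ : 4 ℕ.< 2 ℕ.* ℓℓ
  4<2ℓℓ = ℕ.<-≤-trans {4} {8} (s≤s (s≤s (s≤s (s≤s (s≤s z≤n))))) (ℕ.*-monoʳ-≤ 2 (ℕ.*-mono-≤ 2≤ℓ 2≤ℓ))
  lem : ∀ ℓℓ → 2 ℕ.* ℓℓ ℕ.+ 2 ℕ.* ℓℓ ≡ 4 ℕ.* ℓℓ
  lem = NatRing.solve-∀
  lem′ : ∀ u v → 4 ℕ.* (1 ℕ.+ (u ℕ.+ v)) ≡ 4 ℕ.+ (4 ℕ.* u ℕ.+ 4 ℕ.* v)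
  lem′ = NatRing.solve-∀
  lem″ : ∀ u → u ℕ.+ u ≡ 2 ℕ.* u
  lem″ = NatRing.solve-∀
  big : 2 ℕ.* ℓℓ ℕ.+ 2 ℕ.* ℓℓ ℕ.≤ 4 ℕ.+ 2 ℕ.* ℓℓ
  big = begin
    2 ℕ.* ℓℓ ℕ.+ 2 ℕ.* ℓℓ                          ≡⟨ lem ℓℓ ⟩
    4 ℕ.* ℓℓ                                        ≤⟨ ℕ.*-monoʳ-≤ 4 (ℕ.*-monoˡ-≤ ℓ (ℕ.≮⇒≥ nlt)) ⟩
    4 ℕ.* (k ℕ.* ℓ)                                 ≤⟨ ℕ.*-monoʳ-≤ 4 h ⟩
    4 ℕ.* (1 ℕ.+ (x ℕ.* x ℕ.+ y ℕ.* y))             ≡⟨ lem′ (x ℕ.* x) (y ℕ.* y) ⟩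
    4 ℕ.+ (4 ℕ.* (x ℕ.* x) ℕ.+ 4 ℕ.* (y ℕ.* y))     ≤⟨ ℕ.+-monoʳ-≤ 4 (ℕ.+-mono-≤ (half-square ℓ x hx) (half-square ℓ y hy)) ⟩
    4 ℕ.+ (ℓℓ ℕ.+ ℓℓ)                               ≡⟨ cong (4 ℕ.+_) (lem″ ℓℓ) ⟩
    4 ℕ.+ 2 ℕ.* ℓℓ                                  ∎
    where open ℕ.≤-Reasoning

prime≥2 : ∀ {p} → Prime p → 2 ℕ.≤ p
prime≥2 {p} pr = ℕ.nonTrivial⇒n>1 p {{prime⇒nonTrivial pr}}

pos-sum : ∀ x y → + x * + x + + y * + y ≡ + (x ℕ.* x ℕ.+ y ℕ.* y)
pos-sum x y = trans (cong₂ _+_ (sym (ℤ.pos-* x x)) (sym (ℤ.pos-* y y))) (sym (ℤ.pos-+ (x ℕ.* x) (y ℕ.* y)))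

-- The descent of Lagrange's four-square theorem: some kℓ with 0 < k < ℓ equals x² + y² + 1, and k
-- is a product of smaller primes, which can be divided out.
NM-−1-step : ∀ ℓ → Prime ℓ → (∀ r → Prime r → r ℕ.< ℓ → NormMultiple (- 1ℤ) (+ r)) → NormMultiple (- 1ℤ) (+ ℓ)
NM-−1-step ℓ pr ih = go (two-squares-mod pr (- 1ℤ))
  where
  go : (∃₂ λ x y → x ℕ.≤ ⌊ ℓ /2⌋ × y ℕ.≤ ⌊ ℓ /2⌋ × + ℓ ∣ + x * + x + + y * + y - (- 1ℤ)) → NormMultiple (- 1ℤ) (+ ℓ)
  go (x , y , hx , hy , divides q e) = quo q e′
    where
    e′ : + (x ℕ.* x ℕ.+ y ℕ.* y ℕ.+ 1) ≡ q * + ℓ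
    e′ = trans (trans (ℤ.pos-+ (x ℕ.* x ℕ.+ y ℕ.* y) 1) (cong (_+ 1ℤ) (sym (pos-sum x y)))) e
    quo : ∀ q → + (x ℕ.* x ℕ.+ y ℕ.* y ℕ.+ 1) ≡ q * + ℓ → NormMultiple (- 1ℤ) (+ ℓ)
    quo -[1+ k ] eq = ⊥-elim (nonpos ℓ (prime≥2 pr) eq)
      where nonpos : ∀ ℓ → 2 ℕ.≤ ℓ → + (x ℕ.* x ℕ.+ y ℕ.* y ℕ.+ 1) ≡ -[1+ k ] * + ℓ → ⊥
            nonpos (suc ℓ) _ ()
    quo (+ k) eq = NM-descend ℓ ih k k≢0 (quotient< ℓ x y k hx hy (prime≥2 pr) (ℕ.≤-reflexive (trans (sym eqℕ) (ℕ.+-comm _ 1))))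
        (norm 1ℤ 0ℤ (+ x) (+ y) 1ℤ 0ℤ (λ ()) (trans (ℤ.*-identityʳ (+ k * + ℓ)) (trans (sym eq) (sym e″))))
      where
      eqℕ : x ℕ.* x ℕ.+ y ℕ.* y ℕ.+ 1 ≡ k ℕ.* ℓ
      eqℕ = ℤ.+-injective (trans eq (sym (ℤ.pos-* k ℓ)))
      k≢0 : k ≢ 0
      k≢0 refl = contra (trans (ℕ.+-comm 1 (x ℕ.* x ℕ.+ y ℕ.* y)) eqℕ)
        where contra : ∀ {n} → suc n ≡ 0 → ⊥
              contra ()
      e″ : + x * + x + + y * + y - - 1ℤ * (1ℤ * 1ℤ + 0ℤ * 0ℤ) ≡ + (x ℕ.* x ℕ.+ y ℕ.* y ℕ.+ 1)
      e″ = trans (cong (_+ 1ℤ) (pos-sum x y)) (sym (ℤ.pos-+ (x ℕ.* x ℕ.+ y ℕ.* y) 1))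

-- Legendre's descent with x² + y² - q = dℓ and d < ℓ; a negative d would give q ≥ ℓ. No residue
-- condition on q enters, because modulo ℓ everything is a sum of two squares. This is the gain from
-- Gaussian coordinates.
NM-step : ∀ ℓ q → Prime ℓ → q ≢ 0 → q ℕ.< ℓ → (∀ r → Prime r → r ℕ.< ℓ → NormMultiple (+ q) (+ r)) → NormMultiple (+ q) (+ ℓ)
NM-step ℓ q pr q≢0 q<ℓ ih = go (two-squares-mod pr (+ q))
  where
  go : (∃₂ λ x y → x ℕ.≤ ⌊ ℓ /2⌋ × y ℕ.≤ ⌊ ℓ /2⌋ × + ℓ ∣ + x * + x + + y * + y - + q) → NormMultiple (+ q) (+ ℓ)
  go (x , y , hx , hy , divides d e) = quo d e′
    where
    X = x ℕ.* x ℕ.+ y ℕ.* y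
    lem : ∀ X q w → X - (w + q) ≡ 1ℤ * (X - q - w)
    lem = solve-∀
    e′ : + X ≡ d * + ℓ + + q
    e′ = mod1 1ℤ (lem (+ X) (+ q) (d * + ℓ)) (trans (cong (_- + q) (sym (pos-sum x y))) e)
    quo : ∀ d → + X ≡ d * + ℓ + + q → NormMultiple (+ q) (+ ℓ)
    quo -[1+ k ] eq = ⊥-elim (ℕ.<⇒≱ q<ℓ (ℕ.≤-trans (ℕ.m≤n+m ℓ (k ℕ.* ℓ ℕ.+ X)) (ℕ.≤-reflexive (ℤ.+-injective (trans casts (mod1 1ℤ (lem′ (+ X) (+ k) (+ ℓ) (+ q)) (trans eq (cong (λ z → z * + ℓ + + q) negk))))))))
      where
      negk : -[1+ k ] ≡ - (1ℤ + + k)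
      negk = refl
      lem′ : ∀ X k ℓ q → k * ℓ + X + ℓ - q ≡ 1ℤ * (X - (- (1ℤ + k) * ℓ + q))
      lem′ = solve-∀
      casts : + (k ℕ.* ℓ ℕ.+ X ℕ.+ ℓ) ≡ + k * + ℓ + + X + + ℓ
      casts = trans (ℤ.pos-+ (k ℕ.* ℓ ℕ.+ X) ℓ) (cong (_+ + ℓ) (trans (ℤ.pos-+ (k ℕ.* ℓ) X) (cong (_+ + X) (ℤ.pos-* k ℓ))))
    -- Here q = x² + y² is itself a norm, so there is nothing to descend from, but the form is
    -- hyperbolic.
    quo (+ 0) eq = NM-isotropic (+ ℓ) (+ x) (+ y) 1ℤ 0ℤ (λ z → q≢0 (ℤ.+-injective (trans (sym Xq) (trans (sym (pos-sum x y)) z))))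
        (trans (pos-sum x y) (trans Xq (sym (ℤ.*-identityʳ (+ q)))))
      where
      Xq : + X ≡ + q
      Xq = trans eq (trans (cong (_+ + q) (ℤ.*-zeroˡ (+ ℓ))) (ℤ.+-identityˡ (+ q)))
    quo (+ k@(suc _)) eq = NM-descend ℓ ih k (λ ()) (quotient< ℓ x y k hx hy (prime≥2 pr) (ℕ.m≤n⇒m≤1+n kℓ≤X))
        (norm 1ℤ 0ℤ (+ x) (+ y) 1ℤ 0ℤ (λ ()) (mod1 (- 1ℤ) (lem′ (+ k * + ℓ) (+ q) (+ x) (+ y)) (trans (pos-sum x y) eq)))
      where
      eqℕ : X ≡ k ℕ.* ℓ ℕ.+ q
      eqℕ = ℤ.+-injective (trans eq (trans (cong (_+ + q) (sym (ℤ.pos-* k ℓ))) (sym (ℤ.pos-+ (k ℕ.* ℓ) q))))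
      kℓ≤X : k ℕ.* ℓ ℕ.≤ X
      kℓ≤X = ℕ.≤-trans (ℕ.m≤m+n (k ℕ.* ℓ) q) (ℕ.≤-reflexive (sym eqℕ))
      lem′ : ∀ w q x y → w * (1ℤ * 1ℤ + 0ℤ * 0ℤ) - (x * x + y * y - q * (1ℤ * 1ℤ + 0ℤ * 0ℤ)) ≡ - 1ℤ * (x * x + y * y - (w + q))
      lem′ = ring! 4 (λ w q x y → w :* (# 1 :* # 1 :+ # 0 :* # 0) :- (x :* x :+ y :* y :- q :* (# 1 :* # 1 :+ # 0 :* # 0)) := :- # 1 :* (x :* x :+ y :* y :- (w :+ q))) refl

NM-−1 : ∀ N ℓ → Prime ℓ → ℓ ℕ.< N → NormMultiple (- 1ℤ) (+ ℓ)
NM-−1 (suc N) ℓ pr ℓ<N = NM-−1-step ℓ pr (λ r pr′ r<ℓ → NM-−1 N r pr′ (ℕ.<-≤-trans r<ℓ (ℕ.≤-pred ℓ<N)))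

-- Equal primes leave no room for the descent. Multiplying q|n|² = |x|² + |y|² by q gives q|x|² =
-- |qn|² - q|y|²; if x = 0, the roles of x and y are exchanged.
NM-diagonal : ∀ q → Prime q → NormMultiple (+ q) (+ q)
NM-diagonal q pr = go (NM-−1 (suc q) q pr ℕ.≤-refl)
  where
  go : NormMultiple (- 1ℤ) (+ q) → NormMultiple (+ q) (+ q)
  go (norm n₁ n₂ x₁ x₂ y₁ y₂ nz e) with x₁ * x₁ + x₂ * x₂ ℤ.≟ 0ℤ
  ... | no x≢0 = norm x₁ x₂ (+ q * n₁) (+ q * n₂) y₁ y₂ x≢0 (mod1 (- (+ q)) (lem (+ q) n₁ n₂ x₁ x₂ y₁ y₂) e)
    where lem : ∀ q n₁ n₂ x₁ x₂ y₁ y₂ → q * (x₁ * x₁ + x₂ * x₂) - (q * n₁ * (q * n₁) + q * n₂ * (q * n₂) - q * (y₁ * y₁ + y₂ * y₂))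
            ≡ - q * (q * (n₁ * n₁ + n₂ * n₂) - (x₁ * x₁ + x₂ * x₂ - - 1ℤ * (y₁ * y₁ + y₂ * y₂)))
          lem = ring! 7 (λ q n₁ n₂ x₁ x₂ y₁ y₂ → q :* (x₁ :* x₁ :+ x₂ :* x₂) :- (q :* n₁ :* (q :* n₁) :+ q :* n₂ :* (q :* n₂) :- q :* (y₁ :* y₁ :+ y₂ :* y₂))
            := :- q :* (q :* (n₁ :* n₁ :+ n₂ :* n₂) :- (x₁ :* x₁ :+ x₂ :* x₂ :- :- # 1 :* (y₁ :* y₁ :+ y₂ :* y₂)))) refl
  ... | yes x≡0 = norm y₁ y₂ (+ q * n₁) (+ q * n₂) x₁ x₂ y≢0 (mod1 (- (+ q)) (lem (+ q) n₁ n₂ x₁ x₂ y₁ y₂) e)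
    where lem : ∀ q n₁ n₂ x₁ x₂ y₁ y₂ → q * (y₁ * y₁ + y₂ * y₂) - (q * n₁ * (q * n₁) + q * n₂ * (q * n₂) - q * (x₁ * x₁ + x₂ * x₂))
            ≡ - q * (q * (n₁ * n₁ + n₂ * n₂) - (x₁ * x₁ + x₂ * x₂ - - 1ℤ * (y₁ * y₁ + y₂ * y₂)))
          lem = ring! 7 (λ q n₁ n₂ x₁ x₂ y₁ y₂ → q :* (y₁ :* y₁ :+ y₂ :* y₂) :- (q :* n₁ :* (q :* n₁) :+ q :* n₂ :* (q :* n₂) :- q :* (x₁ :* x₁ :+ x₂ :* x₂))
            := :- q :* (q :* (n₁ :* n₁ :+ n₂ :* n₂) :- (x₁ :* x₁ :+ x₂ :* x₂ :- :- # 1 :* (y₁ :* y₁ :+ y₂ :* y₂)))) refl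
          y≢0 : y₁ * y₁ + y₂ * y₂ ≢ 0ℤ
          y≢0 y≡0 = *-≢0 (prime≢0 pr) nz (trans e (trans (cong₂ (λ x y → x - - 1ℤ * y) x≡0 y≡0) refl))

-- `N` bounds both primes. The larger one, brought into the right place by `NM-sym` if necessary, is
-- reduced to smaller primes by `NM-step`; both members of each new pair lie below it.
NM-primes : ∀ N ℓ q → Prime ℓ → Prime q → ℓ ℕ.< N → q ℕ.< N → NormMultiple (+ q) (+ ℓ)
NM-primes (suc N) ℓ q pℓ pq (s≤s ℓ≤N) (s≤s q≤N) with ℕ.<-cmp ℓ q
... | tri≈ _ refl _ = NM-diagonal ℓ pℓ
... | tri< ℓ<q _ _ = NM-sym (prime≢0 pq)
      (NM-step q ℓ pq (λ z → prime≢0 pℓ (cong +_ z)) ℓ<q (λ r pr r<q → NM-primes N r ℓ pr pℓ (ℕ.<-≤-trans r<q q≤N) (ℕ.<-≤-trans ℓ<q q≤N)))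
... | tri> _ _ q<ℓ =
      NM-step ℓ q pℓ (λ z → prime≢0 pq (cong +_ z)) q<ℓ (λ r pr r<ℓ → NM-primes N r q pr pq (ℕ.<-≤-trans r<ℓ ℓ≤N) (ℕ.<-≤-trans q<ℓ ℓ≤N))

NM-all : ∀ a b → a ≢ 0 → b ≢ 0 → NormMultiple (+ a) (+ b)
NM-all a b a≢0 b≢0 = NM-product (λ q pq → NM-sym (λ z → a≢0 (ℤ.+-injective z))
  (NM-product (λ ℓ pℓ → NM-primes (suc (ℓ ℕ.+ q)) ℓ q pℓ pq (s≤s (ℕ.m≤m+n ℓ q)) (s≤s (ℕ.m≤n+m q ℓ))) a a≢0)) b b≢0

-- A nonzero zero of P² − a |s|² − b |t|², with s, t Gaussian integers.
record Isotropic (a b : ℤ) : Set where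
  constructor iso
  field
    P s₁ s₂ t₁ t₂ : ℤ
    P≢0 : P ≢ 0ℤ
    zero-of : P * P ≡ a * (s₁ * s₁ + s₂ * s₂) + b * (t₁ * t₁ + t₂ * t₂)

-- Multiplying a|n|² + b|y|² = |x|² by |x|² makes the right side the square of the integer |x|² and
-- the Gaussian coordinates xn and xy. Positivity of a, b and n ≠ 0 give x ≠ 0.
isotropic : ∀ a b → a ≢ 0 → b ≢ 0 → Isotropic (+ a) (+ b)
isotropic a b a≢0 b≢0 = go (NM-all b a b≢0 a≢0)
  where
  go : NormMultiple (+ b) (+ a) → Isotropic (+ a) (+ b)
  go (norm n₁ n₂ x₁ x₂ y₁ y₂ nz e) = iso (x₁ * x₁ + x₂ * x₂) (x₁ * n₁ - x₂ * n₂) (x₁ * n₂ + x₂ * n₁) (x₁ * y₁ - x₂ * y₂) (x₁ * y₂ + x₂ * y₁) x≢0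
      (mod1 (- (x₁ * x₁ + x₂ * x₂)) (lem (+ a) (+ b) n₁ n₂ x₁ x₂ y₁ y₂) e)
    where
    lem : ∀ a b n₁ n₂ x₁ x₂ y₁ y₂ → (x₁ * x₁ + x₂ * x₂) * (x₁ * x₁ + x₂ * x₂) -
       (a * ((x₁ * n₁ - x₂ * n₂) * (x₁ * n₁ - x₂ * n₂) + (x₁ * n₂ + x₂ * n₁) * (x₁ * n₂ + x₂ * n₁)) +
        b * ((x₁ * y₁ - x₂ * y₂) * (x₁ * y₁ - x₂ * y₂) + (x₁ * y₂ + x₂ * y₁) * (x₁ * y₂ + x₂ * y₁)))
       ≡ - (x₁ * x₁ + x₂ * x₂) * (a * (n₁ * n₁ + n₂ * n₂) - (x₁ * x₁ + x₂ * x₂ - b * (y₁ * y₁ + y₂ * y₂)))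
    lem = ring! 8 (λ a b n₁ n₂ x₁ x₂ y₁ y₂ → (x₁ :* x₁ :+ x₂ :* x₂) :* (x₁ :* x₁ :+ x₂ :* x₂) :-
       (a :* ((x₁ :* n₁ :- x₂ :* n₂) :* (x₁ :* n₁ :- x₂ :* n₂) :+ (x₁ :* n₂ :+ x₂ :* n₁) :* (x₁ :* n₂ :+ x₂ :* n₁)) :+
        b :* ((x₁ :* y₁ :- x₂ :* y₂) :* (x₁ :* y₁ :- x₂ :* y₂) :+ (x₁ :* y₂ :+ x₂ :* y₁) :* (x₁ :* y₂ :+ x₂ :* y₁)))
       := :- (x₁ :* x₁ :+ x₂ :* x₂) :* (a :* (n₁ :* n₁ :+ n₂ :* n₂) :- (x₁ :* x₁ :+ x₂ :* x₂ :- b :* (y₁ :* y₁ :+ y₂ :* y₂)))) refl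
    lem′ : ∀ a b n x y → a * n + b * y - x ≡ 1ℤ * (a * n - (x - b * y))
    lem′ = solve-∀
    x≢0 : x₁ * x₁ + x₂ * x₂ ≢ 0ℤ
    x≢0 z = *-≢0 {+ a} (λ q → a≢0 (ℤ.+-injective q)) nz
      (trans an (cong +_ (ℕ.m+n≡0⇒m≡0 A {B} (ℤ.+-injective
        (trans (ℤ.pos-+ A B) (trans (cong₂ _+_ (sym an) (sym by))
          (trans (mod1 1ℤ (lem′ (+ a) (+ b) (n₁ * n₁ + n₂ * n₂) (x₁ * x₁ + x₂ * x₂) (y₁ * y₁ + y₂ * y₂)) e) z)))))))
      where
      A = a ℕ.* (abs n₁ ℕ.* abs n₁ ℕ.+ abs n₂ ℕ.* abs n₂)
      B = b ℕ.* (abs y₁ ℕ.* abs y₁ ℕ.+ abs y₂ ℕ.* abs y₂)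
      an : + a * (n₁ * n₁ + n₂ * n₂) ≡ + A
      an = trans (cong (+ a *_) (sum-sq-abs n₁ n₂)) (sym (ℤ.pos-* a _))
      by : + b * (y₁ * y₁ + y₂ * y₂) ≡ + B
      by = trans (cong (+ b *_) (sum-sq-abs y₁ y₂)) (sym (ℤ.pos-* b _))

-- Reflections of isotropic vectors

bezout₅ : ∀ x₀ x₁ x₂ x₃ x₄ → ∃ λ g → (∃ λ u₀ → ∃₂ λ u₁ u₂ → ∃₂ λ u₃ u₄ → u₀ * x₀ + u₁ * x₁ + u₂ * x₂ + u₃ * x₃ + u₄ * x₄ ≡ g)
  × g ∣ x₀ × g ∣ x₁ × g ∣ x₂ × g ∣ x₃ × g ∣ x₄
bezout₅ x₀ x₁ x₂ x₃ x₄ = step₁ (bezout x₀ x₁)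
  where
  lem : ∀ a b c d p q r s x₀ x₁ x₂ x₃ x₄ →
    r * p * c * a * x₀ + r * p * c * b * x₁ + r * p * d * x₂ + r * q * x₃ + s * x₄
    ≡ r * (p * (c * (a * x₀ + b * x₁) + d * x₂) + q * x₃) + s * x₄
  lem = ring! 13 (λ a b c d p q r s x₀ x₁ x₂ x₃ x₄ →
    r :* p :* c :* a :* x₀ :+ r :* p :* c :* b :* x₁ :+ r :* p :* d :* x₂ :+ r :* q :* x₃ :+ s :* x₄
    := r :* (p :* (c :* (a :* x₀ :+ b :* x₁) :+ d :* x₂) :+ q :* x₃) :+ s :* x₄) refl
  Gcd₅ = ∃ λ g → (∃ λ u₀ → ∃₂ λ u₁ u₂ → ∃₂ λ u₃ u₄ → u₀ * x₀ + u₁ * x₁ + u₂ * x₂ + u₃ * x₃ + u₄ * x₄ ≡ g) × g ∣ x₀ × g ∣ x₁ × g ∣ x₂ × g ∣ x₃ × g ∣ x₄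
  Gcd₂ : ℤ → ℤ → Set
  Gcd₂ x y = ∃ λ g → ∃₂ λ u v → u * x + v * y ≡ g × g ∣ x × g ∣ y
  step₁ : Gcd₂ x₀ x₁ → Gcd₅
  step₁ (g , a , b , e , d₀ , d₁) = step₂ (bezout g x₂)
    where
    step₂ : Gcd₂ g x₂ → Gcd₅
    step₂ (h , c , d , e′ , hg , d₂) = step₃ (bezout h x₃)
      where
      step₃ : Gcd₂ h x₃ → Gcd₅
      step₃ (k , p , q , e″ , kh , d₃) = step₄ (bezout k x₄)
        where
        step₄ : Gcd₂ k x₄ → Gcd₅
        step₄ (l , r , s , e‴ , lk , d₄) = l ,
          (r * p * c * a , r * p * c * b , r * p * d , r * q , s ,
            trans (lem a b c d p q r s x₀ x₁ x₂ x₃ x₄)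
              (trans (cong (λ z → r * (p * (c * z + d * x₂) + q * x₃) + s * x₄) e)
              (trans (cong (λ z → r * (p * z + q * x₃) + s * x₄) e′)
              (trans (cong (λ z → r * z + s * x₄) e″) e‴)))) ,
          ∣-trans lg d₀ , ∣-trans lg d₁ , ∣-trans lh d₂ , ∣-trans lk d₃ , d₄
          where
          lh = ∣-trans lk kh
          lg = ∣-trans lh hg

coprime₅ : ∀ x₀ x₁ x₂ x₃ x₄ → (∀ p → Prime p → + p ∣ x₀ → + p ∣ x₁ → + p ∣ x₂ → + p ∣ x₃ → ¬ + p ∣ x₄) →
  ∃ λ u₀ → ∃₂ λ u₁ u₂ → ∃₂ λ u₃ u₄ → u₀ * x₀ + u₁ * x₁ + u₂ * x₂ + u₃ * x₃ + u₄ * x₄ ≡ 1ℤ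
coprime₅ x₀ x₁ x₂ x₃ x₄ h = go (bezout₅ x₀ x₁ x₂ x₃ x₄)
  where
  lem : ∀ s u₀ u₁ u₂ u₃ u₄ x₀ x₁ x₂ x₃ x₄ → s * u₀ * x₀ + s * u₁ * x₁ + s * u₂ * x₂ + s * u₃ * x₃ + s * u₄ * x₄
    ≡ s * (u₀ * x₀ + u₁ * x₁ + u₂ * x₂ + u₃ * x₃ + u₄ * x₄)
  lem = ring! 11 (λ s u₀ u₁ u₂ u₃ u₄ x₀ x₁ x₂ x₃ x₄ → s :* u₀ :* x₀ :+ s :* u₁ :* x₁ :+ s :* u₂ :* x₂ :+ s :* u₃ :* x₃ :+ s :* u₄ :* x₄
    := s :* (u₀ :* x₀ :+ u₁ :* x₁ :+ u₂ :* x₂ :+ u₃ :* x₃ :+ u₄ :* x₄)) refl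
  go : (∃ λ g → (∃ λ u₀ → ∃₂ λ u₁ u₂ → ∃₂ λ u₃ u₄ → u₀ * x₀ + u₁ * x₁ + u₂ * x₂ + u₃ * x₃ + u₄ * x₄ ≡ g) × g ∣ x₀ × g ∣ x₁ × g ∣ x₂ × g ∣ x₃ × g ∣ x₄) →
    ∃ λ u₀ → ∃₂ λ u₁ u₂ → ∃₂ λ u₃ u₄ → u₀ * x₀ + u₁ * x₁ + u₂ * x₂ + u₃ * x₃ + u₄ * x₄ ≡ 1ℤ
  go (g , (u₀ , u₁ , u₂ , u₃ , u₄ , e) , d₀ , d₁ , d₂ , d₃ , d₄) =
      scaled (unit g (λ p pr d → h p pr (∣-trans d d₀) (∣-trans d d₁) (∣-trans d d₂) (∣-trans d d₃) (∣-trans d d₄)))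
    where
    scaled : (∃ λ s → s * g ≡ 1ℤ) → ∃ λ u₀ → ∃₂ λ u₁ u₂ → ∃₂ λ u₃ u₄ → u₀ * x₀ + u₁ * x₁ + u₂ * x₂ + u₃ * x₃ + u₄ * x₄ ≡ 1ℤ
    scaled (s , e′) = s * u₀ , s * u₁ , s * u₂ , s * u₃ , s * u₄ ,
      trans (lem s u₀ u₁ u₂ u₃ u₄ x₀ x₁ x₂ x₃ x₄) (trans (cong (s *_) e) e′)

Primitive : ∀ {a b} → Isotropic a b → Set
Primitive (iso P s₁ s₂ t₁ t₂ _ _) = ∀ p → Prime p → + p ∣ P → + p ∣ s₁ → + p ∣ s₂ → + p ∣ t₁ → ¬ + p ∣ t₂

-- The new `P` divides the old one, so primes already kept out of `P` stay out.
primitive-part : ∀ {a b} (i : Isotropic a b) → ∃ λ (j : Isotropic a b) → Primitive j × Isotropic.P j ∣ Isotropic.P i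
primitive-part {a} {b} (iso P s₁ s₂ t₁ t₂ P≢0 e) = go (bezout₅ P s₁ s₂ t₁ t₂)
  where
  go : (∃ λ g → (∃ λ u₀ → ∃₂ λ u₁ u₂ → ∃₂ λ u₃ u₄ → u₀ * P + u₁ * s₁ + u₂ * s₂ + u₃ * t₁ + u₄ * t₂ ≡ g)
      × g ∣ P × g ∣ s₁ × g ∣ s₂ × g ∣ t₁ × g ∣ t₂) → _
  go (g , (u₀ , u₁ , u₂ , u₃ , u₄ , c) , divides P′ refl , divides a₁ refl , divides a₂ refl , divides b₁ refl , divides b₂ refl) =
    iso P′ a₁ a₂ b₁ b₂ (λ z → P≢0 (cong (_* g) z)) (cancelˡ (*-≢0 g≢0 g≢0) (trans (lem g P′) (trans e (lem′ a b g a₁ a₂ b₁ b₂)))) ,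
    (λ p pr d₀ d₁ d₂ d₃ d₄ → prime∤1 pr (subst (+ p ∣_) one
       (∣m∣n⇒∣m+n (by4 u₀ u₁ u₂ u₃ refl d₀ d₁ d₂ d₃) (∣n⇒∣m*n u₄ d₄)))) ,
    divides g (ℤ.*-comm P′ g)
    where
    g≢0 : g ≢ 0ℤ
    g≢0 z = P≢0 (trans (cong (P′ *_) z) (ℤ.*-zeroʳ P′))
    lem : ∀ g P → g * g * (P * P) ≡ P * g * (P * g)
    lem = solve-∀
    lem′ : ∀ a b g s₁ s₂ t₁ t₂ → a * (s₁ * g * (s₁ * g) + s₂ * g * (s₂ * g)) + b * (t₁ * g * (t₁ * g) + t₂ * g * (t₂ * g))
      ≡ g * g * (a * (s₁ * s₁ + s₂ * s₂) + b * (t₁ * t₁ + t₂ * t₂))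
    lem′ = ring! 7 (λ a b g s₁ s₂ t₁ t₂ → a :* (s₁ :* g :* (s₁ :* g) :+ s₂ :* g :* (s₂ :* g)) :+ b :* (t₁ :* g :* (t₁ :* g) :+ t₂ :* g :* (t₂ :* g))
      := g :* g :* (a :* (s₁ :* s₁ :+ s₂ :* s₂) :+ b :* (t₁ :* t₁ :+ t₂ :* t₂))) refl
    lem″ : ∀ g u₀ u₁ u₂ u₃ u₄ x₀ x₁ x₂ x₃ x₄ → g * (u₀ * x₀ + u₁ * x₁ + u₂ * x₂ + u₃ * x₃ + u₄ * x₄) - g * 1ℤ
      ≡ 1ℤ * (u₀ * (x₀ * g) + u₁ * (x₁ * g) + u₂ * (x₂ * g) + u₃ * (x₃ * g) + u₄ * (x₄ * g) - g)
    lem″ = ring! 11 (λ g u₀ u₁ u₂ u₃ u₄ x₀ x₁ x₂ x₃ x₄ → g :* (u₀ :* x₀ :+ u₁ :* x₁ :+ u₂ :* x₂ :+ u₃ :* x₃ :+ u₄ :* x₄) :- g :* # 1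
      := # 1 :* (u₀ :* (x₀ :* g) :+ u₁ :* (x₁ :* g) :+ u₂ :* (x₂ :* g) :+ u₃ :* (x₃ :* g) :+ u₄ :* (x₄ :* g) :- g)) refl
    one : u₀ * P′ + u₁ * a₁ + u₂ * a₂ + u₃ * b₁ + u₄ * b₂ ≡ 1ℤ
    one = cancelˡ g≢0 (mod1 1ℤ (lem″ g u₀ u₁ u₂ u₃ u₄ P′ a₁ a₂ b₁ b₂) c)

-- The image of an isotropic vector under the reflection in (1; m r), divided by d.
reflect : ∀ {a b} (i : Isotropic a b) → let open Isotropic i in ∀ m r₁ r₂ r₃ r₄ d C G → d ≢ 0ℤ → C - G * P ≢ 0ℤ →
  + 2 * (P - m * (a * (r₁ * s₁ + r₂ * s₂) + b * (r₃ * t₁ + r₄ * t₂))) ≡ d * C →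
  1ℤ - m * m * (a * (r₁ * r₁ + r₂ * r₂) + b * (r₃ * r₃ + r₄ * r₄)) ≡ d * G → Isotropic a b
reflect {a} {b} (iso P s₁ s₂ t₁ t₂ _ e) m r₁ r₂ r₃ r₄ d C G d≢0 P≢0 eC eG =
  iso (C - G * P) (C * (m * r₁) - G * s₁) (C * (m * r₂) - G * s₂) (C * (m * r₃) - G * t₁) (C * (m * r₄) - G * t₂) P≢0
    (cancelˡ (*-≢0 d≢0 d≢0) (trans (lhs d C G P) (trans (cong₂ (λ x y → (x - y * P) * (x - y * P)) (sym eC) (sym eG))
      (trans main (trans (cong₂ (λ x y → x * x * n - + 2 * (x * y * q) + y * y * ns) eC eG) (sym (rhs a b d C G m r₁ r₂ r₃ r₄ s₁ s₂ t₁ t₂)))))))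
  where
  q = m * (a * (r₁ * s₁ + r₂ * s₂) + b * (r₃ * t₁ + r₄ * t₂))
  n = m * m * (a * (r₁ * r₁ + r₂ * r₂) + b * (r₃ * r₃ + r₄ * r₄))
  ns = a * (s₁ * s₁ + s₂ * s₂) + b * (t₁ * t₁ + t₂ * t₂)
  lhs : ∀ d C G P → d * d * ((C - G * P) * (C - G * P)) ≡ (d * C - d * G * P) * (d * C - d * G * P)
  lhs = solve-∀
  rhs : ∀ a b d C G m r₁ r₂ r₃ r₄ s₁ s₂ t₁ t₂ →
    d * d * (a * ((C * (m * r₁) - G * s₁) * (C * (m * r₁) - G * s₁) + (C * (m * r₂) - G * s₂) * (C * (m * r₂) - G * s₂))
      + b * ((C * (m * r₃) - G * t₁) * (C * (m * r₃) - G * t₁) + (C * (m * r₄) - G * t₂) * (C * (m * r₄) - G * t₂)))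
    ≡ d * C * (d * C) * (m * m * (a * (r₁ * r₁ + r₂ * r₂) + b * (r₃ * r₃ + r₄ * r₄)))
      - + 2 * (d * C * (d * G) * (m * (a * (r₁ * s₁ + r₂ * s₂) + b * (r₃ * t₁ + r₄ * t₂))))
      + d * G * (d * G) * (a * (s₁ * s₁ + s₂ * s₂) + b * (t₁ * t₁ + t₂ * t₂))
  rhs = ring! 14 (λ a b d C G m r₁ r₂ r₃ r₄ s₁ s₂ t₁ t₂ →
    d :* d :* (a :* ((C :* (m :* r₁) :- G :* s₁) :* (C :* (m :* r₁) :- G :* s₁) :+ (C :* (m :* r₂) :- G :* s₂) :* (C :* (m :* r₂) :- G :* s₂))
      :+ b :* ((C :* (m :* r₃) :- G :* t₁) :* (C :* (m :* r₃) :- G :* t₁) :+ (C :* (m :* r₄) :- G :* t₂) :* (C :* (m :* r₄) :- G :* t₂)))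
    := d :* C :* (d :* C) :* (m :* m :* (a :* (r₁ :* r₁ :+ r₂ :* r₂) :+ b :* (r₃ :* r₃ :+ r₄ :* r₄)))
      :- # 2 :* (d :* C :* (d :* G) :* (m :* (a :* (r₁ :* s₁ :+ r₂ :* s₂) :+ b :* (r₃ :* t₁ :+ r₄ :* t₂))))
      :+ d :* G :* (d :* G) :* (a :* (s₁ :* s₁ :+ s₂ :* s₂) :+ b :* (t₁ :* t₁ :+ t₂ :* t₂))) refl
  -- Reflections are isometries: with v = (1; m r), the norm of 2⟨x,v⟩v - ⟨v,v⟩x is ⟨v,v⟩²⟨x,x⟩.
  -- Here q and n are the contributions of m r to ⟨x,v⟩ and ⟨v,v⟩.
  key : ∀ P q n ns → (+ 2 * (P - q) - (1ℤ - n) * P) * (+ 2 * (P - q) - (1ℤ - n) * P)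
      - (+ 2 * (P - q) * (+ 2 * (P - q)) * n - + 2 * (+ 2 * (P - q) * (1ℤ - n) * q) + (1ℤ - n) * (1ℤ - n) * ns)
      ≡ (1ℤ - n) * (1ℤ - n) * (P * P - ns)
  key = ring! 4 (λ P q n ns → (# 2 :* (P :- q) :- (# 1 :- n) :* P) :* (# 2 :* (P :- q) :- (# 1 :- n) :* P)
      :- (# 2 :* (P :- q) :* (# 2 :* (P :- q)) :* n :- # 2 :* (# 2 :* (P :- q) :* (# 1 :- n) :* q) :+ (# 1 :- n) :* (# 1 :- n) :* ns)
      := (# 1 :- n) :* (# 1 :- n) :* (P :* P :- ns)) refl
  main = mod1 ((1ℤ - n) * (1ℤ - n)) (key P q n ns) e

-- Reflections in vectors congruent to (1; 0) modulo m change P only by a factor prime to m.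
reflect-∤ : ∀ {a b q} (i : Isotropic a b) → let open Isotropic i in ∀ m r₁ r₂ r₃ r₄ d C G → + q ∣ m →
  + 2 * (P - m * (a * (r₁ * s₁ + r₂ * s₂) + b * (r₃ * t₁ + r₄ * t₂))) ≡ d * C →
  1ℤ - m * m * (a * (r₁ * r₁ + r₂ * r₂) + b * (r₃ * r₃ + r₄ * r₄)) ≡ d * G →
  + q ∣ C - G * P → + q ∣ P
reflect-∤ {a} {b} {q} (iso P s₁ s₂ t₁ t₂ _ _) m r₁ r₂ r₃ r₄ d C G q∣m eC eG h = by2 d (+ 2 * x - m * y * P) eq h q∣m
  where
  x = a * (r₁ * s₁ + r₂ * s₂) + b * (r₃ * t₁ + r₄ * t₂)
  y = a * (r₁ * r₁ + r₂ * r₂) + b * (r₃ * r₃ + r₄ * r₄)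
  lem : ∀ P m d C G x y → P - (d * (C - G * P) + (+ 2 * x - m * y * P) * m) ≡ 1ℤ * (+ 2 * (P - m * x) - d * C) + - P * (1ℤ - m * m * y - d * G)
  lem = ring! 7 (λ P m d C G x y → P :- (d :* (C :- G :* P) :+ (# 2 :* x :- m :* y :* P) :* m) := # 1 :* (# 2 :* (P :- m :* x) :- d :* C) :+ :- P :* (# 1 :- m :* m :* y :- d :* G)) refl
  eq = mod2 1ℤ (- P) (lem P m d C G x y) eC eG

-- These are the conditions on the odd parts of the two coefficients. A factor 2 is put back later,
-- through forms with coefficients `2a` and `2b`.
record Admissible (a b : ℤ) : Set where
  field
    odd-a : ¬ + 2 ∣ a
    odd-b : ¬ + 2 ∣ b
    disjoint : ∀ p → Prime p → + p ∣ a → ¬ + p ∣ b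
    sqf-a : ∀ p → Prime p → ¬ + p * + p ∣ a
    sqf-b : ∀ p → Prime p → ¬ + p * + p ∣ b

swap-admissible : ∀ {a b} → Admissible a b → Admissible b a
swap-admissible h = record { odd-a = odd-b ; odd-b = odd-a ; disjoint = λ p pr x y → disjoint p pr y x ; sqf-a = sqf-b ; sqf-b = sqf-a }
  where open Admissible h

swap-iso : ∀ {a b} → Isotropic a b → Isotropic b a
swap-iso {a} {b} (iso P s₁ s₂ t₁ t₂ nz e) = iso P t₁ t₂ s₁ s₂ nz (trans e (ℤ.+-comm (a * (s₁ * s₁ + s₂ * s₂)) (b * (t₁ * t₁ + t₂ * t₂))))

-- In use `m` is the product of the primes treated before ℓ; the last component says that the repair
-- at ℓ does not undo their treatment.
Repaired : ∀ {a b} → ℕ → ℤ → Isotropic a b → Set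
Repaired {a} {b} ℓ m i = ∃ λ (j : Isotropic a b) → ¬ + ℓ ∣ Isotropic.P j ×
  (∀ q → Prime q → + q ∣ m → + q ∣ Isotropic.P j → + q ∣ Isotropic.P i)

repaired-by : ∀ {a b} ℓ (i : Isotropic a b) → let open Isotropic i in ∀ m r₁ r₂ r₃ r₄ d C G → d ≢ 0ℤ → ¬ + ℓ ∣ C - G * P →
  + 2 * (P - m * (a * (r₁ * s₁ + r₂ * s₂) + b * (r₃ * t₁ + r₄ * t₂))) ≡ d * C →
  1ℤ - m * m * (a * (r₁ * r₁ + r₂ * r₂) + b * (r₃ * r₃ + r₄ * r₄)) ≡ d * G → Repaired ℓ m i
repaired-by ℓ i m r₁ r₂ r₃ r₄ d C G d≢0 h eC eG =
  reflect i m r₁ r₂ r₃ r₄ d C G d≢0 (∤⇒≢0 h) eC eG , h ,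
  λ q _ q∣m → reflect-∤ i m r₁ r₂ r₃ r₄ d C G q∣m eC eG

module _ {a b : ℤ} {ℓ : ℕ} (pr : Prime ℓ) (i : Isotropic a b) (m : ℤ) where
  open Isotropic i

  -- When ℓ divides P, the reflected first coordinate is -2 times the pairing of m r with (s, t),
  -- modulo ℓ.
  repair-odd : ∀ r₁ r₂ r₃ r₄ → + ℓ ∣ P → ¬ + ℓ ∣ + 2 * (m * (a * (r₁ * s₁ + r₂ * s₂) + b * (r₃ * t₁ + r₄ * t₂))) → Repaired ℓ m i
  repair-odd r₁ r₂ r₃ r₄ ℓ∣P h = repaired-by ℓ i m r₁ r₂ r₃ r₄ 1ℤ (+ 2 * (P - x)) (1ℤ - y) (λ ())
      (λ d → h (by2 (- 1ℤ) (1ℤ + y) (lem P x y) d ℓ∣P)) (sym (ℤ.*-identityˡ (+ 2 * (P - x)))) (sym (ℤ.*-identityˡ (1ℤ - y)))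
    where
    x = m * (a * (r₁ * s₁ + r₂ * s₂) + b * (r₃ * t₁ + r₄ * t₂))
    y = m * m * (a * (r₁ * r₁ + r₂ * r₂) + b * (r₃ * r₃ + r₄ * r₄))
    lem : ∀ P x y → + 2 * x ≡ - 1ℤ * (+ 2 * (P - x) - (1ℤ - y) * P) + (1ℤ + y) * P
    lem = solve-∀

  -- P, t divisible by ℓ and a = ℓ a′: the reflected vector is divisible by ℓ, and P/ℓ is twice the residue of B′.
  repair-radical : ∀ P′ a′ t₁′ t₂′ r₁ r₂ r₃ r₄ → P ≡ P′ * + ℓ → a ≡ a′ * + ℓ → t₁ ≡ t₁′ * + ℓ → t₂ ≡ t₂′ * + ℓ →
    + ℓ ∣ b * (m * m) * (r₃ * r₃ + r₄ * r₄) - 1ℤ →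
    ¬ + ℓ ∣ + 2 * (P′ - m * (a′ * (r₁ * s₁ + r₂ * s₂) + b * (r₃ * t₁′ + r₄ * t₂′))) → Repaired ℓ m i
  repair-radical P′ a′ t₁′ t₂′ r₁ r₂ r₃ r₄ eP ea et₁ et₂ (divides k ek) h =
    repaired-by ℓ i m r₁ r₂ r₃ r₄ (+ ℓ) C G (prime≢0 pr) (λ d → h (by2 1ℤ (G * P′) (trans (lem C G P P′ (+ ℓ)) (cong (λ z → 1ℤ * (C - G * P) + z) (trans (cong (G *_) eP) (sym (ℤ.*-assoc G P′ (+ ℓ)))))) d ∣-refl))
      (trans (cong₂ (λ p w → + 2 * (p - m * w)) eP (cong₂ _+_ (cong (_* (r₁ * s₁ + r₂ * s₂)) ea) (cong₂ (λ p w → b * (r₃ * p + r₄ * w)) et₁ et₂)))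
             (lemC P′ a′ b m r₁ r₂ r₃ r₄ s₁ s₂ t₁′ t₂′ (+ ℓ)))
      (trans (cong (λ w → 1ℤ - m * m * (w * (r₁ * r₁ + r₂ * r₂) + b * (r₃ * r₃ + r₄ * r₄))) ea)
             (mod1 (- 1ℤ) (lemG a′ b m r₁ r₂ r₃ r₄ k (+ ℓ)) ek))
    where
    C = + 2 * (P′ - m * (a′ * (r₁ * s₁ + r₂ * s₂) + b * (r₃ * t₁′ + r₄ * t₂′)))
    G = - (k + m * m * a′ * (r₁ * r₁ + r₂ * r₂))
    lem : ∀ C G P P′ ℓ → C ≡ 1ℤ * (C - G * P) + G * P
    lem = solve-∀
    lemC : ∀ P′ a′ b m r₁ r₂ r₃ r₄ s₁ s₂ t₁′ t₂′ ℓ →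
      + 2 * (P′ * ℓ - m * (a′ * ℓ * (r₁ * s₁ + r₂ * s₂) + b * (r₃ * (t₁′ * ℓ) + r₄ * (t₂′ * ℓ))))
      ≡ ℓ * (+ 2 * (P′ - m * (a′ * (r₁ * s₁ + r₂ * s₂) + b * (r₃ * t₁′ + r₄ * t₂′))))
    lemC = ring! 13 (λ P′ a′ b m r₁ r₂ r₃ r₄ s₁ s₂ t₁′ t₂′ ℓ →
      # 2 :* (P′ :* ℓ :- m :* (a′ :* ℓ :* (r₁ :* s₁ :+ r₂ :* s₂) :+ b :* (r₃ :* (t₁′ :* ℓ) :+ r₄ :* (t₂′ :* ℓ))))
      := ℓ :* (# 2 :* (P′ :- m :* (a′ :* (r₁ :* s₁ :+ r₂ :* s₂) :+ b :* (r₃ :* t₁′ :+ r₄ :* t₂′))))) refl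
    lemG : ∀ a′ b m r₁ r₂ r₃ r₄ k ℓ → 1ℤ - m * m * (a′ * ℓ * (r₁ * r₁ + r₂ * r₂) + b * (r₃ * r₃ + r₄ * r₄)) -
      ℓ * (- (k + m * m * a′ * (r₁ * r₁ + r₂ * r₂))) ≡ - 1ℤ * (b * (m * m) * (r₃ * r₃ + r₄ * r₄) - 1ℤ - k * ℓ)
    lemG = ring! 9 (λ a′ b m r₁ r₂ r₃ r₄ k ℓ → # 1 :- m :* m :* (a′ :* ℓ :* (r₁ :* r₁ :+ r₂ :* r₂) :+ b :* (r₃ :* r₃ :+ r₄ :* r₄)) :-
      ℓ :* (:- (k :+ m :* m :* a′ :* (r₁ :* r₁ :+ r₂ :* r₂))) := :- # 1 :* (b :* (m :* m) :* (r₃ :* r₃ :+ r₄ :* r₄) :- # 1 :- k :* ℓ)) refl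

-- As ℓ divides P and a, it divides b|t|². If t is nonzero modulo ℓ in some coordinate, a reflection
-- along that coordinate suffices. Otherwise the vector lies in the radical of the form modulo ℓ,
-- where a reflection in a vector of norm prime to ℓ does not move it. The remedy is a reflection
-- vector of norm divisible by ℓ, with the image divided by ℓ.
repair-a : ∀ {a b ℓ} → Admissible a b → Prime ℓ → ℓ ≢ 2 → (i : Isotropic a b) → Primitive i → + ℓ ∣ a → + ℓ ∣ Isotropic.P i →
  ∀ m → ¬ + ℓ ∣ m → Repaired ℓ m i
repair-a {a} {b} {ℓ} adm pr ℓ≢2 i prim ℓ∣a ℓ∣P m ℓ∤m = go (+ ℓ ∣? t₁) (+ ℓ ∣? t₂)
  where
  open Isotropic i
  open Admissible adm
  ℓ∤b = disjoint ℓ pr ℓ∣a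
  ℓ∤2 = odd-prime∤2 pr ℓ≢2
  go : _ → _ → Repaired ℓ m i
  go (no ℓ∤t₁) _ = repair-odd pr i m 0ℤ 0ℤ 1ℤ 0ℤ ℓ∣P (λ d → ∤-* pr ℓ∤2 (∤-* pr ℓ∤m (∤-* pr ℓ∤b ℓ∤t₁)) (subst (+ ℓ ∣_) (lem a b m s₁ s₂ t₁ t₂) d))
    where lem : ∀ a b m s₁ s₂ t₁ t₂ → + 2 * (m * (a * (0ℤ * s₁ + 0ℤ * s₂) + b * (1ℤ * t₁ + 0ℤ * t₂))) ≡ + 2 * (m * (b * t₁))
          lem = solve-∀
  go (yes _) (no ℓ∤t₂) = repair-odd pr i m 0ℤ 0ℤ 0ℤ 1ℤ ℓ∣P (λ d → ∤-* pr ℓ∤2 (∤-* pr ℓ∤m (∤-* pr ℓ∤b ℓ∤t₂)) (subst (+ ℓ ∣_) (lem a b m s₁ s₂ t₁ t₂) d))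
    where lem : ∀ a b m s₁ s₂ t₁ t₂ → + 2 * (m * (a * (0ℤ * s₁ + 0ℤ * s₂) + b * (0ℤ * t₁ + 1ℤ * t₂))) ≡ + 2 * (m * (b * t₂))
          lem = solve-∀
  go (yes d₁@(divides t₁′ e₁)) (yes d₂@(divides t₂′ e₂)) = go′ ℓ∣P ℓ∣a
    where
    -- This makes the norm of (1; m r) divisible by ℓ, whatever r₁ and r₂ are, because ℓ divides a.
    unit-form : ∃₂ λ r₃ r₄ → + ℓ ∣ b * (m * m) * (r₃ * r₃ + r₄ * r₄) - 1ℤ
    unit-form =
      let u , du = inverse pr (∤-* pr ℓ∤b (∤-* pr ℓ∤m ℓ∤m))
          x , y , _ , _ , d = two-squares-mod pr u
      in + x , + y , by2 (b * (m * m)) 1ℤ (lem (b * (m * m)) u (+ x) (+ y)) d du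
      where lem : ∀ c u x y → c * (x * x + y * y) - 1ℤ ≡ c * (x * x + y * y - u) + 1ℤ * (u * c - 1ℤ)
            lem = solve-∀
    r₃ = proj₁ unit-form
    r₄ = proj₁ (proj₂ unit-form)
    dr = proj₂ (proj₂ unit-form)
    go′ : + ℓ ∣ P → + ℓ ∣ a → Repaired ℓ m i
    go′ (divides P′ eP) (divides a′ ea) = choose (+ ℓ ∣? B 0ℤ 0ℤ) (+ ℓ ∣? B 1ℤ 0ℤ) (+ ℓ ∣? B 0ℤ 1ℤ)
      where
      -- The new first coordinate modulo ℓ, affine in (r₁, r₂) with slopes -2m a′s₁ and -2m a′s₂. If
      -- it vanished at (0, 0), (1, 0) and (0, 1), then ℓ would divide s₁ and s₂, as ℓ ∤ a′ for
      -- squarefree a, and the vector would not be primitive.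
      B : ℤ → ℤ → ℤ
      B r₁ r₂ = + 2 * (P′ - m * (a′ * (r₁ * s₁ + r₂ * s₂) + b * (r₃ * t₁′ + r₄ * t₂′)))
      ℓ∤a′ : ¬ + ℓ ∣ a′
      ℓ∤a′ (divides k e) = sqf-a ℓ pr (divides k (trans ea (trans (cong (_* + ℓ) e) (ℤ.*-assoc k (+ ℓ) (+ ℓ)))))
      from : ∀ s → + ℓ ∣ + 2 * (m * (a′ * s)) → + ℓ ∣ s
      from s d with + ℓ ∣? s
      ... | yes q = q
      ... | no q = ⊥-elim (∤-* pr ℓ∤2 (∤-* pr ℓ∤m (∤-* pr ℓ∤a′ q)) d)
      lem₁ : ∀ P′ m a′ b s₁ s₂ r₃ r₄ t₁ t₂ → + 2 * (m * (a′ * s₁)) ≡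
         1ℤ * (+ 2 * (P′ - m * (a′ * (0ℤ * s₁ + 0ℤ * s₂) + b * (r₃ * t₁ + r₄ * t₂)))) + - 1ℤ * (+ 2 * (P′ - m * (a′ * (1ℤ * s₁ + 0ℤ * s₂) + b * (r₃ * t₁ + r₄ * t₂))))
      lem₁ = ring! 10 (λ P′ m a′ b s₁ s₂ r₃ r₄ t₁ t₂ → # 2 :* (m :* (a′ :* s₁)) :=
         # 1 :* (# 2 :* (P′ :- m :* (a′ :* (# 0 :* s₁ :+ # 0 :* s₂) :+ b :* (r₃ :* t₁ :+ r₄ :* t₂)))) :+ :- # 1 :* (# 2 :* (P′ :- m :* (a′ :* (# 1 :* s₁ :+ # 0 :* s₂) :+ b :* (r₃ :* t₁ :+ r₄ :* t₂))))) refl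
      lem₂ : ∀ P′ m a′ b s₁ s₂ r₃ r₄ t₁ t₂ → + 2 * (m * (a′ * s₂)) ≡
         1ℤ * (+ 2 * (P′ - m * (a′ * (0ℤ * s₁ + 0ℤ * s₂) + b * (r₃ * t₁ + r₄ * t₂)))) + - 1ℤ * (+ 2 * (P′ - m * (a′ * (0ℤ * s₁ + 1ℤ * s₂) + b * (r₃ * t₁ + r₄ * t₂))))
      lem₂ = ring! 10 (λ P′ m a′ b s₁ s₂ r₃ r₄ t₁ t₂ → # 2 :* (m :* (a′ :* s₂)) :=
         # 1 :* (# 2 :* (P′ :- m :* (a′ :* (# 0 :* s₁ :+ # 0 :* s₂) :+ b :* (r₃ :* t₁ :+ r₄ :* t₂)))) :+ :- # 1 :* (# 2 :* (P′ :- m :* (a′ :* (# 0 :* s₁ :+ # 1 :* s₂) :+ b :* (r₃ :* t₁ :+ r₄ :* t₂))))) refl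
      use : ∀ r₁ r₂ → ¬ + ℓ ∣ B r₁ r₂ → Repaired ℓ m i
      use r₁ r₂ = repair-radical pr i m P′ a′ t₁′ t₂′ r₁ r₂ r₃ r₄ eP ea e₁ e₂ dr
      choose : _ → _ → _ → Repaired ℓ m i
      choose (no n) _ _ = use 0ℤ 0ℤ n
      choose (yes _) (no n) _ = use 1ℤ 0ℤ n
      choose (yes _) (yes _) (no n) = use 0ℤ 1ℤ n
      choose (yes p) (yes q) (yes r) = ⊥-elim (prim ℓ pr ℓ∣P
         (from s₁ (by2 1ℤ (- 1ℤ) (lem₁ P′ m a′ b s₁ s₂ r₃ r₄ t₁′ t₂′) p q))
         (from s₂ (by2 1ℤ (- 1ℤ) (lem₂ P′ m a′ b s₁ s₂ r₃ r₄ t₁′ t₂′) p r)) d₁ d₂)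

repair-b : ∀ {a b ℓ} → Admissible a b → Prime ℓ → ℓ ≢ 2 → (i : Isotropic a b) → Primitive i → + ℓ ∣ b → + ℓ ∣ Isotropic.P i →
  ∀ m → ¬ + ℓ ∣ m → Repaired ℓ m i
repair-b adm pr ℓ≢2 i prim ℓ∣b ℓ∣P m ℓ∤m =
  let j , h , k = repair-a (swap-admissible adm) pr ℓ≢2 (swap-iso i) (λ p pp d₀ d₁ d₂ d₃ d₄ → prim p pp d₀ d₃ d₄ d₁ d₂) ℓ∣b ℓ∣P m ℓ∤m
  in swap-iso j , h , k

odd-half : ∀ {x} → ¬ + 2 ∣ x → ∃ λ k → x ≡ 1ℤ + k * + 2
odd-half {x} h with x %ℕ 2 | a≡a%ℕn+[a/ℕn]*n x 2 | n%ℕd<d x 2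
... | 0 | e | _ = ⊥-elim (h (divides (x /ℕ 2) (trans e (ℤ.+-identityˡ _))))
... | 1 | e | _ = x /ℕ 2 , e
... | suc (suc _) | _ | s≤s (s≤s ())

2∤1 : ¬ + 2 ∣ 1ℤ
2∤1 = prime∤1 prime[2]

-- An undivided reflection would leave the first coordinate even. For odd c the norm 1 - m²c is even
-- as well, so the image can be halved; its first coordinate is then congruent to m times an odd
-- pairing.
repair-2 : ∀ {a b} → Admissible a b → (i : Isotropic a b) → Primitive i → + 2 ∣ Isotropic.P i → ∀ m → ¬ + 2 ∣ m → Repaired 2 m i
repair-2 {a} {b} adm i prim 2∣P m 2∤m = go (+ 2 ∣? s₁) (+ 2 ∣? s₂) (+ 2 ∣? t₁) (+ 2 ∣? t₂)
  where
  open Isotropic i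
  open Admissible adm
  core : ∀ r₁ r₂ r₃ r₄ c s → ¬ + 2 ∣ c → ¬ + 2 ∣ s → a * (r₁ * s₁ + r₂ * s₂) + b * (r₃ * t₁ + r₄ * t₂) ≡ c * s →
    a * (r₁ * r₁ + r₂ * r₂) + b * (r₃ * r₃ + r₄ * r₄) ≡ c → Repaired 2 m i
  core r₁ r₂ r₃ r₄ c s hc hs e₁ e₂ = repaired-by 2 i m r₁ r₂ r₃ r₄ (+ 2) (P - m * x) (- k) (λ ())
      (λ d → ∤-* prime[2] 2∤m (∤-* prime[2] hc hs) (by2 (1ℤ + k) (- 1ℤ) (trans (cong (m *_) (sym e₁)) (lem P m x k)) 2∣P d))
      refl (trans (cong (λ z → 1ℤ - m * m * z) e₂) (mod1 (- 1ℤ) (lem′ m c k) ek))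
    where
    x = a * (r₁ * s₁ + r₂ * s₂) + b * (r₃ * t₁ + r₄ * t₂)
    h = odd-half (∤-* prime[2] (∤-* prime[2] 2∤m 2∤m) hc)
    k = proj₁ h
    ek = proj₂ h
    lem : ∀ P m x k → m * x ≡ (1ℤ + k) * P + - 1ℤ * (P - m * x - - k * P)
    lem = solve-∀
    lem′ : ∀ m c k → 1ℤ - m * m * c - + 2 * - k ≡ - 1ℤ * (m * m * c - (1ℤ + k * + 2))
    lem′ = solve-∀
  go : _ → _ → _ → _ → Repaired 2 m i
  go (no n) _ _ _ = core 1ℤ 0ℤ 0ℤ 0ℤ a s₁ odd-a n (l a b s₁ s₂ t₁ t₂) (l′ a b)
    where l : ∀ a b s₁ s₂ t₁ t₂ → a * (1ℤ * s₁ + 0ℤ * s₂) + b * (0ℤ * t₁ + 0ℤ * t₂) ≡ a * s₁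
          l = solve-∀
          l′ : ∀ a b → a * (1ℤ * 1ℤ + 0ℤ * 0ℤ) + b * (0ℤ * 0ℤ + 0ℤ * 0ℤ) ≡ a
          l′ = solve-∀
  go (yes _) (no n) _ _ = core 0ℤ 1ℤ 0ℤ 0ℤ a s₂ odd-a n (l a b s₁ s₂ t₁ t₂) (l′ a b)
    where l : ∀ a b s₁ s₂ t₁ t₂ → a * (0ℤ * s₁ + 1ℤ * s₂) + b * (0ℤ * t₁ + 0ℤ * t₂) ≡ a * s₂
          l = solve-∀
          l′ : ∀ a b → a * (0ℤ * 0ℤ + 1ℤ * 1ℤ) + b * (0ℤ * 0ℤ + 0ℤ * 0ℤ) ≡ a
          l′ = solve-∀
  go (yes _) (yes _) (no n) _ = core 0ℤ 0ℤ 1ℤ 0ℤ b t₁ odd-b n (l a b s₁ s₂ t₁ t₂) (l′ a b)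
    where l : ∀ a b s₁ s₂ t₁ t₂ → a * (0ℤ * s₁ + 0ℤ * s₂) + b * (1ℤ * t₁ + 0ℤ * t₂) ≡ b * t₁
          l = solve-∀
          l′ : ∀ a b → a * (0ℤ * 0ℤ + 0ℤ * 0ℤ) + b * (1ℤ * 1ℤ + 0ℤ * 0ℤ) ≡ b
          l′ = solve-∀
  go (yes _) (yes _) (yes _) (no n) = core 0ℤ 0ℤ 0ℤ 1ℤ b t₂ odd-b n (l a b s₁ s₂ t₁ t₂) (l′ a b)
    where l : ∀ a b s₁ s₂ t₁ t₂ → a * (0ℤ * s₁ + 0ℤ * s₂) + b * (0ℤ * t₁ + 1ℤ * t₂) ≡ b * t₂
          l = solve-∀
          l′ : ∀ a b → a * (0ℤ * 0ℤ + 0ℤ * 0ℤ) + b * (0ℤ * 0ℤ + 1ℤ * 1ℤ) ≡ b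
          l′ = solve-∀
  go (yes p) (yes q) (yes r) (yes s) = ⊥-elim (prim 2 prime[2] 2∣P p q r s)

repair : ∀ {a b ℓ} → Admissible a b → Prime ℓ → + ℓ ∣ + 2 * (a * b) → (i : Isotropic a b) → Primitive i → + ℓ ∣ Isotropic.P i →
  ∀ m → ¬ + ℓ ∣ m → Repaired ℓ m i
repair {a} {b} {ℓ} adm pr h i prim ℓ∣P m ℓ∤m with ℓ ℕ.≟ 2
... | yes refl = repair-2 adm i prim ℓ∣P m ℓ∤m
... | no ℓ≢2 with euclid pr h
...   | inj₁ d = ⊥-elim (odd-prime∤2 pr ℓ≢2 d)
...   | inj₂ d with euclid pr d
...     | inj₁ ℓ∣a = repair-a adm pr ℓ≢2 i prim ℓ∣a ℓ∣P m ℓ∤m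
...     | inj₂ ℓ∣b = repair-b adm pr ℓ≢2 i prim ℓ∣b ℓ∣P m ℓ∤m

Good : ℤ → ℤ → ℤ → Set
Good a b m = ∃ λ (i : Isotropic a b) → Primitive i × (∀ q → Prime q → + q ∣ m → ¬ + q ∣ Isotropic.P i)

-- The primes of n are treated one at a time. A repair at p is needed only if p divides P, and then
-- p is prime to the product of the primes treated so far, as `repair` requires.
good-upto : ∀ {a b} → Admissible a b → Isotropic a b → ∀ n → n ≢ 0 → (∀ q → Prime q → + q ∣ + n → + q ∣ + 2 * (a * b)) → Good a b (+ n)
good-upto {a} {b} adm i₀ = product-ind (λ n → (∀ q → Prime q → + q ∣ + n → + q ∣ + 2 * (a * b)) → Good a b (+ n)) base step
  where
  base : _ → Good a b 1ℤ
  base _ = let j , pj , _ = primitive-part i₀ in j , pj , λ q pq d → ⊥-elim (prime∤1 pq d)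
  split : ∀ {q p n} → Prime q → Prime p → + q ∣ + (p ℕ.* n) → q ≡ p ⊎ + q ∣ + n
  split {q} {p} {n} pq pp d with euclid pq (subst (+ q ∣_) (ℤ.pos-* p n) d)
  ... | inj₁ e = inj₁ (∣-prime pq pp e)
  ... | inj₂ e = inj₂ e
  step : ∀ p n → Prime p → n ≢ 0 → ((∀ q → Prime q → + q ∣ + n → + q ∣ + 2 * (a * b)) → Good a b (+ n)) →
    (∀ q → Prime q → + q ∣ + (p ℕ.* n) → + q ∣ + 2 * (a * b)) → Good a b (+ (p ℕ.* n))
  step p n pp _ ih h = go (ih (λ q pq d → h q pq (∣-trans d n∣pn)))
    where
    n∣pn : + n ∣ + (p ℕ.* n)
    n∣pn = divides (+ p) (ℤ.pos-* p n)
    go : Good a b (+ n) → Good a b (+ (p ℕ.* n))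
    go (i , prim , av) with + p ∣? Isotropic.P i
    ... | no p∤P = i , prim , av′
      where av′ : ∀ q → Prime q → + q ∣ + (p ℕ.* n) → ¬ + q ∣ Isotropic.P i
            av′ q pq d with split pq pp d
            ... | inj₁ refl = p∤P
            ... | inj₂ e = av q pq e
    ... | yes p∣P = fix (repair adm pp (h p pp (divides (+ n) (trans (ℤ.pos-* p n) (ℤ.*-comm (+ p) (+ n))))) i prim p∣P (+ n) (λ d → av p pp d p∣P))
      where
      fix : Repaired p (+ n) i → Good a b (+ (p ℕ.* n))
      fix (j , p∤ , tr) = let k , pk , d = primitive-part j in k , pk , av′ k d
        where av′ : ∀ k → Isotropic.P k ∣ Isotropic.P j → ∀ q → Prime q → + q ∣ + (p ℕ.* n) → ¬ + q ∣ Isotropic.P k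
              av′ k d q pq dq dk with split pq pp dq
              ... | inj₁ refl = p∤ (∣-trans dk d)
              ... | inj₂ e = av q pq e (tr q pq e (∣-trans dk d))

good : ∀ a b → Admissible (+ a) (+ b) → Good (+ a) (+ b) (+ 2 * (+ a * + b))
good a b adm = let i , p , h = good-upto adm (isotropic a b a≢0 b≢0) (2 ℕ.* (a ℕ.* b)) nz (λ q pq → subst (+ q ∣_) cast)
  in i , p , λ q pq d → h q pq (subst (+ q ∣_) (sym cast) d)
  where
  open Admissible adm
  a≢0 : a ≢ 0
  a≢0 refl = odd-a (divides 0ℤ refl)
  b≢0 : b ≢ 0
  b≢0 refl = odd-b (divides 0ℤ refl)
  nz : 2 ℕ.* (a ℕ.* b) ≢ 0
  nz e with ℕ.m*n≡0⇒m≡0∨n≡0 2 {a ℕ.* b} e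
  ... | inj₂ z with ℕ.m*n≡0⇒m≡0∨n≡0 a z
  ...   | inj₁ z′ = a≢0 z′
  ...   | inj₂ z′ = b≢0 z′
  cast : + (2 ℕ.* (a ℕ.* b)) ≡ + 2 * (+ a * + b)
  cast = trans (ℤ.pos-* 2 (a ℕ.* b)) (cong (+ 2 *_) (ℤ.pos-* a b))

-- Sums of two squares of the form A₁|α|² + A₂|β|² + A₃

-- g² + Y² = A₁|α|² + A₂|β|² + A₃ with g, Y coprime and α = r₁ + m₁ i, β = r₂ + m₂ i.
record NormSum (A₁ A₂ A₃ : ℤ) : Set where
  field
    g Y r₁ m₁ r₂ m₂ : ℤ
    value : g * g + Y * Y ≡ A₁ * (r₁ * r₁ + m₁ * m₁) + A₂ * (r₂ * r₂ + m₂ * m₂) + A₃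
    g∥Y : ∀ q → Prime q → + q ∣ g → ¬ + q ∣ Y
    p-odd : ¬ + 2 ∣ g * g + Y * Y
    p∥A₃ : ∀ q → Prime q → q ≢ 2 → + q ∣ A₃ → ¬ + q ∣ g * g + Y * Y

-- Moving by j along the isotropic vector (S; τ) changes h² − N(ρ) linearly in j.
isotropic-line : ∀ A₁ A₂ K S τ₁ τ₂ τ₃ τ₄ h ρ₁ ρ₂ ρ₃ ρ₄ Y j → S * S ≡ A₁ * (τ₁ * τ₁ + τ₂ * τ₂) + A₂ * (τ₃ * τ₃ + τ₄ * τ₄) →
  + 2 * j * (S * h - A₁ * (ρ₁ * τ₁ + ρ₂ * τ₂) - A₂ * (ρ₃ * τ₃ + ρ₄ * τ₄))
    ≡ A₁ * (ρ₁ * ρ₁ + ρ₂ * ρ₂) + A₂ * (ρ₃ * ρ₃ + ρ₄ * ρ₄) + K - h * h - Y * Y →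
  (h + j * S) * (h + j * S) + Y * Y ≡ A₁ * ((ρ₁ + j * τ₁) * (ρ₁ + j * τ₁) + (ρ₂ + j * τ₂) * (ρ₂ + j * τ₂))
    + A₂ * ((ρ₃ + j * τ₃) * (ρ₃ + j * τ₃) + (ρ₄ + j * τ₄) * (ρ₄ + j * τ₄)) + K
isotropic-line A₁ A₂ K S τ₁ τ₂ τ₃ τ₄ h ρ₁ ρ₂ ρ₃ ρ₄ Y j = mod2 (j * j) 1ℤ (lem A₁ A₂ K S τ₁ τ₂ τ₃ τ₄ h ρ₁ ρ₂ ρ₃ ρ₄ Y j)
  where
  lem : ∀ A₁ A₂ K S τ₁ τ₂ τ₃ τ₄ h ρ₁ ρ₂ ρ₃ ρ₄ Y j → (h + j * S) * (h + j * S) + Y * Y - (A₁ * ((ρ₁ + j * τ₁) * (ρ₁ + j * τ₁) + (ρ₂ + j * τ₂) * (ρ₂ + j * τ₂))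
    + A₂ * ((ρ₃ + j * τ₃) * (ρ₃ + j * τ₃) + (ρ₄ + j * τ₄) * (ρ₄ + j * τ₄)) + K)
    ≡ j * j * (S * S - (A₁ * (τ₁ * τ₁ + τ₂ * τ₂) + A₂ * (τ₃ * τ₃ + τ₄ * τ₄)))
    + 1ℤ * (+ 2 * j * (S * h - A₁ * (ρ₁ * τ₁ + ρ₂ * τ₂) - A₂ * (ρ₃ * τ₃ + ρ₄ * τ₄)) -
       (A₁ * (ρ₁ * ρ₁ + ρ₂ * ρ₂) + A₂ * (ρ₃ * ρ₃ + ρ₄ * ρ₄) + K - h * h - Y * Y))
  lem = ring! 15 (λ A₁ A₂ K S τ₁ τ₂ τ₃ τ₄ h ρ₁ ρ₂ ρ₃ ρ₄ Y j → (h :+ j :* S) :* (h :+ j :* S) :+ Y :* Y :- (A₁ :* ((ρ₁ :+ j :* τ₁) :* (ρ₁ :+ j :* τ₁) :+ (ρ₂ :+ j :* τ₂) :* (ρ₂ :+ j :* τ₂))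
    :+ A₂ :* ((ρ₃ :+ j :* τ₃) :* (ρ₃ :+ j :* τ₃) :+ (ρ₄ :+ j :* τ₄) :* (ρ₄ :+ j :* τ₄)) :+ K)
    := j :* j :* (S :* S :- (A₁ :* (τ₁ :* τ₁ :+ τ₂ :* τ₂) :+ A₂ :* (τ₃ :* τ₃ :+ τ₄ :* τ₄)))
    :+ # 1 :* (# 2 :* j :* (S :* h :- A₁ :* (ρ₁ :* τ₁ :+ ρ₂ :* τ₂) :- A₂ :* (ρ₃ :* τ₃ :+ ρ₄ :* τ₄)) :-
       (A₁ :* (ρ₁ :* ρ₁ :+ ρ₂ :* ρ₂) :+ A₂ :* (ρ₃ :* ρ₃ :+ ρ₄ :* ρ₄) :+ K :- h :* h :- Y :* Y))) refl

-- P is prime to 2ab and shares no prime with all the lᵢ, so P and the coefficients 2ab·a·lᵢ,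
-- 2ab·b·lᵢ are coprime and the linear form takes every value. The numbers ε₁, ε₃ only shift the
-- target; they prescribe the parities of two coordinates of ρ.
solve-linear : ∀ a b P l₁ l₂ l₃ l₄ ε₁ ε₃ → (∀ q → Prime q → + q ∣ + 2 * (a * b) → ¬ + q ∣ P) →
  (∀ q → Prime q → + q ∣ P → + q ∣ l₁ → + q ∣ l₂ → + q ∣ l₃ → ¬ + q ∣ l₄) →
  ∃ λ h → ∃₂ λ x₁ x₂ → ∃₂ λ x₃ x₄ →
    P * h - a * (a * b * (ε₁ + + 2 * x₁) * l₁ + a * b * (+ 2 * x₂) * l₂) - b * (a * b * (ε₃ + + 2 * x₃) * l₃ + a * b * (+ 2 * x₄) * l₄) ≡ 1ℤ
solve-linear a b P l₁ l₂ l₃ l₄ ε₁ ε₃ avoid prim =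
  go (coprime₅ P (w * (a * l₁)) (w * (a * l₂)) (w * (b * l₃)) (w * (b * l₄)) no-prime)
  where
  w = + 2 * (a * b)
  lem : ∀ a b P l₁ l₂ l₃ l₄ ε₁ ε₃ u₀ u₁ u₂ u₃ u₄ → let n = 1ℤ + a * (a * b * ε₁ * l₁) + b * (a * b * ε₃ * l₃); w = + 2 * (a * b) in
    P * (n * u₀) - a * (a * b * (ε₁ + + 2 * - (n * u₁)) * l₁ + a * b * (+ 2 * - (n * u₂)) * l₂) - b * (a * b * (ε₃ + + 2 * - (n * u₃)) * l₃ + a * b * (+ 2 * - (n * u₄)) * l₄) - 1ℤ
    ≡ n * (u₀ * P + u₁ * (w * (a * l₁)) + u₂ * (w * (a * l₂)) + u₃ * (w * (b * l₃)) + u₄ * (w * (b * l₄)) - 1ℤ)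
  lem = ring! 14 (λ a b P l₁ l₂ l₃ l₄ ε₁ ε₃ u₀ u₁ u₂ u₃ u₄ → let n = # 1 :+ a :* (a :* b :* ε₁ :* l₁) :+ b :* (a :* b :* ε₃ :* l₃); w = # 2 :* (a :* b) in
    P :* (n :* u₀) :- a :* (a :* b :* (ε₁ :+ # 2 :* :- (n :* u₁)) :* l₁ :+ a :* b :* (# 2 :* :- (n :* u₂)) :* l₂) :- b :* (a :* b :* (ε₃ :+ # 2 :* :- (n :* u₃)) :* l₃ :+ a :* b :* (# 2 :* :- (n :* u₄)) :* l₄) :- # 1
    := n :* (u₀ :* P :+ u₁ :* (w :* (a :* l₁)) :+ u₂ :* (w :* (a :* l₂)) :+ u₃ :* (w :* (b :* l₃)) :+ u₄ :* (w :* (b :* l₄)) :- # 1)) refl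
  no-prime : ∀ p → Prime p → + p ∣ P → + p ∣ w * (a * l₁) → + p ∣ w * (a * l₂) → + p ∣ w * (b * l₃) → ¬ + p ∣ w * (b * l₄)
  no-prime p pr p∣P d₁ d₂ d₃ d₄ = prim p pr p∣P (strip a p∤a l₁ d₁) (strip a p∤a l₂ d₂) (strip b p∤b l₃ d₃) (strip b p∤b l₄ d₄)
    where
    p∤w : ¬ + p ∣ w
    p∤w d = avoid p pr d p∣P
    p∤a : ¬ + p ∣ a
    p∤a d = p∤w (∣n⇒∣m*n (+ 2) (∣m⇒∣m*n b d))
    p∤b : ¬ + p ∣ b
    p∤b d = p∤w (∣n⇒∣m*n (+ 2) (∣n⇒∣m*n a d))
    strip : ∀ c → ¬ + p ∣ c → ∀ l → + p ∣ w * (c * l) → + p ∣ l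
    strip c p∤c l d with + p ∣? l
    ... | yes r = r
    ... | no r = ⊥-elim (∤-* pr p∤w (∤-* pr p∤c r) d)
  go : (∃ λ u₀ → ∃₂ λ u₁ u₂ → ∃₂ λ u₃ u₄ → u₀ * P + u₁ * (w * (a * l₁)) + u₂ * (w * (a * l₂)) + u₃ * (w * (b * l₃)) + u₄ * (w * (b * l₄)) ≡ 1ℤ) →
    ∃ λ h → ∃₂ λ x₁ x₂ → ∃₂ λ x₃ x₄ →
      P * h - a * (a * b * (ε₁ + + 2 * x₁) * l₁ + a * b * (+ 2 * x₂) * l₂) - b * (a * b * (ε₃ + + 2 * x₃) * l₃ + a * b * (+ 2 * x₄) * l₄) ≡ 1ℤ
  go (u₀ , u₁ , u₂ , u₃ , u₄ , e) = n * u₀ , - (n * u₁) , - (n * u₂) , - (n * u₃) , - (n * u₄) , mod1 n (lem a b P l₁ l₂ l₃ l₄ ε₁ ε₃ u₀ u₁ u₂ u₃ u₄) e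
    where n = 1ℤ + a * (a * b * ε₁ * l₁) + b * (a * b * ε₃ * l₃)

-- Modulo q | o one has 2fj ≡ −h² and P h ≡ 1, so 2g ≡ h is a unit.
g-unit : ∀ {q} → Prime q → ∀ P h f j X Z o → + q ∣ o → P * h - o * X ≡ 1ℤ → + 2 * (f * j) + h * h ≡ o * Z → ¬ + q ∣ h + j * (f * P)
g-unit {q} pr P h f j X Z o q∣o e₁ e₂ d = prime∤1 pr (by2 P (- X) (mod1 (- 1ℤ) (lem′ P h o X) e₁) q∣h q∣o)
  where
  lem′ : ∀ P h o X → 1ℤ - (P * h + - X * o) ≡ - 1ℤ * (P * h - o * X - 1ℤ)
  lem′ = solve-∀
  lem : ∀ P h f j X Z o → h - (+ 2 * (h + j * (f * P)) + (h * X - P * Z) * o) ≡ h * (P * h - o * X - 1ℤ) + - P * (+ 2 * (f * j) + h * h - o * Z)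
  lem = ring! 7 (λ P h f j X Z o → h :- (# 2 :* (h :+ j :* (f :* P)) :+ (h :* X :- P :* Z) :* o) := h :* (P :* h :- o :* X :- # 1) :+ :- P :* (# 2 :* (f :* j) :+ h :* h :- o :* Z)) refl
  q∣h : + q ∣ h
  q∣h = by2 (+ 2) (h * X - P * Z) (mod2 h (- P) (lem P h f j X Z o) e₁ e₂) d q∣o

odd-square : ∀ {x} → ¬ + 2 ∣ x → + 4 ∣ x * x - 1ℤ
odd-square {x} h = let k , e = odd-half h in divides (k + k * k) (trans (cong (λ z → z * z - 1ℤ) e) (lem k))
  where lem : ∀ k → (1ℤ + k * + 2) * (1ℤ + k * + 2) - 1ℤ ≡ (k + k * k) * + 4
        lem = solve-∀

module _ {a b : ℤ} (adm : Admissible a b) (i : Isotropic a b) (prim : Primitive i)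
         (avoid : ∀ q → Prime q → + q ∣ + 2 * (a * b) → ¬ + q ∣ Isotropic.P i) where
  open Isotropic i
  open Admissible adm

  P-odd : ¬ + 2 ∣ P
  P-odd = avoid 2 prime[2] (∣m⇒∣m*n (a * b) ∣-refl)

  o-odd : ¬ + 2 ∣ a * b
  o-odd = ∤-* prime[2] odd-a odd-b

  -- All coordinates of ρ are multiples of ab, and Y = ab. Modulo a prime of ab the equation 2j =
  -- N(ρ) + 4ab - h² - Y² therefore keeps only -h² on the right, as `g-unit` needs.
  norm-sum-odd : NormSum a b (+ 4 * (a * b))
  norm-sum-odd = go (solve-linear a b P s₁ s₂ t₁ t₂ 0ℤ 0ℤ avoid prim)
    where
    o = a * b
    go : (∃ λ h → ∃₂ λ x₁ x₂ → ∃₂ λ x₃ x₄ →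
      P * h - a * (o * (0ℤ + + 2 * x₁) * s₁ + o * (+ 2 * x₂) * s₂) - b * (o * (0ℤ + + 2 * x₃) * t₁ + o * (+ 2 * x₄) * t₂) ≡ 1ℤ) → NormSum a b (+ 4 * o)
    go (h , x₁ , x₂ , x₃ , x₄ , e) = record
      { g = h + j * P ; Y = o ; r₁ = o * (0ℤ + + 2 * x₁) + j * s₁ ; m₁ = o * (+ 2 * x₂) + j * s₂ ; r₂ = o * (0ℤ + + 2 * x₃) + j * t₁ ; m₂ = o * (+ 2 * x₄) + j * t₂
      ; value = isotropic-line a b (+ 4 * o) P s₁ s₂ t₁ t₂ h (o * (0ℤ + + 2 * x₁)) (o * (+ 2 * x₂)) (o * (0ℤ + + 2 * x₃)) (o * (+ 2 * x₄)) o j zero-of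
          (trans (cong (λ z → + 2 * j * z) e) num)
      ; g∥Y = λ q pq dg dY → unit-at q pq dY dg
      ; p-odd = λ d → 2∤1 (by3 1ℤ (- (h + j * P)) (- 1ℤ) (lem₂ (h + j * P) o) d 2∣g (∣-trans (divides (+ 2) refl) (odd-square o-odd)))
      ; p∥A₃ = λ q pq q≢2 d dp → let dY = at-o q pq q≢2 d in unit-at q pq dY (∣-square pq (by2 1ℤ (- o) (lem₃ (h + j * P) o) dp dY))
      }
      where
      N = a * (x₁ * x₁ + x₂ * x₂) + b * (x₃ * x₃ + x₄ * x₄)
      h-odd : ¬ + 2 ∣ h
      h-odd d = 2∤1 (by2 P (- (o * (a * (x₁ * s₁ + x₂ * s₂) + b * (x₃ * t₁ + x₄ * t₂)))) (mod1 (- 1ℤ) (lem a b P h o x₁ x₂ x₃ x₄ s₁ s₂ t₁ t₂) e) d ∣-refl)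
        where lem : ∀ a b P h o x₁ x₂ x₃ x₄ s₁ s₂ t₁ t₂ → 1ℤ - (P * h + - (o * (a * (x₁ * s₁ + x₂ * s₂) + b * (x₃ * t₁ + x₄ * t₂))) * + 2)
                 ≡ - 1ℤ * (P * h - a * (o * (0ℤ + + 2 * x₁) * s₁ + o * (+ 2 * x₂) * s₂) - b * (o * (0ℤ + + 2 * x₃) * t₁ + o * (+ 2 * x₄) * t₂) - 1ℤ)
              lem = ring! 13 (λ a b P h o x₁ x₂ x₃ x₄ s₁ s₂ t₁ t₂ → # 1 :- (P :* h :+ :- (o :* (a :* (x₁ :* s₁ :+ x₂ :* s₂) :+ b :* (x₃ :* t₁ :+ x₄ :* t₂))) :* # 2)
                 := :- # 1 :* (P :* h :- a :* (o :* (# 0 :+ # 2 :* x₁) :* s₁ :+ o :* (# 2 :* x₂) :* s₂) :- b :* (o :* (# 0 :+ # 2 :* x₃) :* t₁ :+ o :* (# 2 :* x₄) :* t₂) :- # 1)) refl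
      η = proj₁ (odd-half h-odd)
      ω = proj₁ (odd-half o-odd)
      π = proj₁ (odd-half P-odd)
      -- With h = 1 + 2η and o = 1 + 2ω the numerator 4o²N + 4o - h² - o² is 2 modulo 4. Hence j =
      -- 2J₀ - 1 is odd, and g = h + jP is even while Y = o is odd.
      J₀ = o * o * N + o - (η + η * η) - (ω + ω * ω)
      j = + 2 * (o * o * N) + + 2 * o - + 2 * (η + η * η) - + 2 * (ω + ω * ω) - 1ℤ
      num : + 2 * j * 1ℤ ≡ a * (o * (0ℤ + + 2 * x₁) * (o * (0ℤ + + 2 * x₁)) + o * (+ 2 * x₂) * (o * (+ 2 * x₂))) +
        b * (o * (0ℤ + + 2 * x₃) * (o * (0ℤ + + 2 * x₃)) + o * (+ 2 * x₄) * (o * (+ 2 * x₄))) + + 4 * o - h * h - o * o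
      num = mod2 (h + (1ℤ + η * + 2)) (o + (1ℤ + ω * + 2)) (lem a b o η ω h x₁ x₂ x₃ x₄) (proj₂ (odd-half h-odd)) (proj₂ (odd-half o-odd))
        where lem : ∀ a b o η ω h x₁ x₂ x₃ x₄ → let N = a * (x₁ * x₁ + x₂ * x₂) + b * (x₃ * x₃ + x₄ * x₄) in
                + 2 * (+ 2 * (o * o * N) + + 2 * o - + 2 * (η + η * η) - + 2 * (ω + ω * ω) - 1ℤ) * 1ℤ -
                (a * (o * (0ℤ + + 2 * x₁) * (o * (0ℤ + + 2 * x₁)) + o * (+ 2 * x₂) * (o * (+ 2 * x₂))) +
                 b * (o * (0ℤ + + 2 * x₃) * (o * (0ℤ + + 2 * x₃)) + o * (+ 2 * x₄) * (o * (+ 2 * x₄))) + + 4 * o - h * h - o * o)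
                ≡ (h + (1ℤ + η * + 2)) * (h - (1ℤ + η * + 2)) + (o + (1ℤ + ω * + 2)) * (o - (1ℤ + ω * + 2))
              lem = ring! 10 (λ a b o η ω h x₁ x₂ x₃ x₄ → let N = a :* (x₁ :* x₁ :+ x₂ :* x₂) :+ b :* (x₃ :* x₃ :+ x₄ :* x₄) in
                # 2 :* (# 2 :* (o :* o :* N) :+ # 2 :* o :- # 2 :* (η :+ η :* η) :- # 2 :* (ω :+ ω :* ω) :- # 1) :* # 1 :-
                (a :* (o :* (# 0 :+ # 2 :* x₁) :* (o :* (# 0 :+ # 2 :* x₁)) :+ o :* (# 2 :* x₂) :* (o :* (# 2 :* x₂))) :+
                 b :* (o :* (# 0 :+ # 2 :* x₃) :* (o :* (# 0 :+ # 2 :* x₃)) :+ o :* (# 2 :* x₄) :* (o :* (# 2 :* x₄))) :+ # 4 :* o :- h :* h :- o :* o)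
                := (h :+ (# 1 :+ η :* # 2)) :* (h :- (# 1 :+ η :* # 2)) :+ (o :+ (# 1 :+ ω :* # 2)) :* (o :- (# 1 :+ ω :* # 2))) refl
      2∣g : + 2 ∣ h + j * P
      2∣g = divides (η + J₀ * P - π) (mod2 1ℤ (- 1ℤ) (lem h P η π o N ω) (proj₂ (odd-half h-odd)) (proj₂ (odd-half P-odd)))
        where lem : ∀ h P η π o N ω → h + (+ 2 * (o * o * N) + + 2 * o - + 2 * (η + η * η) - + 2 * (ω + ω * ω) - 1ℤ) * P
                  - (η + (o * o * N + o - (η + η * η) - (ω + ω * ω)) * P - π) * + 2 ≡ 1ℤ * (h - (1ℤ + η * + 2)) + - 1ℤ * (P - (1ℤ + π * + 2))
              lem = ring! 7 (λ h P η π o N ω → h :+ (# 2 :* (o :* o :* N) :+ # 2 :* o :- # 2 :* (η :+ η :* η) :- # 2 :* (ω :+ ω :* ω) :- # 1) :* P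
                  :- (η :+ (o :* o :* N :+ o :- (η :+ η :* η) :- (ω :+ ω :* ω)) :* P :- π) :* # 2 := # 1 :* (h :- (# 1 :+ η :* # 2)) :+ :- # 1 :* (P :- (# 1 :+ π :* # 2))) refl
      lem₂ : ∀ g o → 1ℤ ≡ 1ℤ * (g * g + o * o) + - g * g + - 1ℤ * (o * o - 1ℤ)
      lem₂ = solve-∀
      lem₃ : ∀ g o → g * g ≡ 1ℤ * (g * g + o * o) + - o * o
      lem₃ = solve-∀
      at-o : ∀ q → Prime q → q ≢ 2 → + q ∣ + 4 * o → + q ∣ o
      at-o q pq q≢2 d with euclid pq d
      ... | inj₂ r = r
      ... | inj₁ r = ⊥-elim (∤-* pq (odd-prime∤2 pq q≢2) (odd-prime∤2 pq q≢2) r)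
      unit-at : ∀ q → Prime q → + q ∣ o → ¬ + q ∣ h + j * P
      unit-at q pq d dg = g-unit pq P h 1ℤ j (a * ((0ℤ + + 2 * x₁) * s₁ + + 2 * x₂ * s₂) + b * ((0ℤ + + 2 * x₃) * t₁ + + 2 * x₄ * t₂))
          (+ 4 * (o * N) + + 4 - o) o d (trans (lem a b P h o x₁ x₂ x₃ x₄ s₁ s₂ t₁ t₂) e) (mod1 1ℤ (lem′ a b o h x₁ x₂ x₃ x₄ j) num) (subst (+ q ∣_) (cong (λ z → h + j * z) (sym (ℤ.*-identityˡ P))) dg)
        where lem : ∀ a b P h o x₁ x₂ x₃ x₄ s₁ s₂ t₁ t₂ → P * h - o * (a * ((0ℤ + + 2 * x₁) * s₁ + + 2 * x₂ * s₂) + b * ((0ℤ + + 2 * x₃) * t₁ + + 2 * x₄ * t₂)) ≡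
                 P * h - a * (o * (0ℤ + + 2 * x₁) * s₁ + o * (+ 2 * x₂) * s₂) - b * (o * (0ℤ + + 2 * x₃) * t₁ + o * (+ 2 * x₄) * t₂)
              lem = ring! 13 (λ a b P h o x₁ x₂ x₃ x₄ s₁ s₂ t₁ t₂ → P :* h :- o :* (a :* ((# 0 :+ # 2 :* x₁) :* s₁ :+ # 2 :* x₂ :* s₂) :+ b :* ((# 0 :+ # 2 :* x₃) :* t₁ :+ # 2 :* x₄ :* t₂)) :=
                 P :* h :- a :* (o :* (# 0 :+ # 2 :* x₁) :* s₁ :+ o :* (# 2 :* x₂) :* s₂) :- b :* (o :* (# 0 :+ # 2 :* x₃) :* t₁ :+ o :* (# 2 :* x₄) :* t₂)) refl
              lem′ : ∀ a b o h x₁ x₂ x₃ x₄ j → let N = a * (x₁ * x₁ + x₂ * x₂) + b * (x₃ * x₃ + x₄ * x₄) in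
                + 2 * (1ℤ * j) + h * h - o * (+ 4 * (o * N) + + 4 - o) ≡
                1ℤ * (+ 2 * j * 1ℤ - (a * (o * (0ℤ + + 2 * x₁) * (o * (0ℤ + + 2 * x₁)) + o * (+ 2 * x₂) * (o * (+ 2 * x₂))) +
                 b * (o * (0ℤ + + 2 * x₃) * (o * (0ℤ + + 2 * x₃)) + o * (+ 2 * x₄) * (o * (+ 2 * x₄))) + + 4 * o - h * h - o * o))
              lem′ = ring! 9 (λ a b o h x₁ x₂ x₃ x₄ j → let N = a :* (x₁ :* x₁ :+ x₂ :* x₂) :+ b :* (x₃ :* x₃ :+ x₄ :* x₄) in
                # 2 :* (# 1 :* j) :+ h :* h :- o :* (# 4 :* (o :* N) :+ # 4 :- o) :=
                # 1 :* (# 2 :* j :* # 1 :- (a :* (o :* (# 0 :+ # 2 :* x₁) :* (o :* (# 0 :+ # 2 :* x₁)) :+ o :* (# 2 :* x₂) :* (o :* (# 2 :* x₂))) :+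
                 b :* (o :* (# 0 :+ # 2 :* x₃) :* (o :* (# 0 :+ # 2 :* x₃)) :+ o :* (# 2 :* x₄) :* (o :* (# 2 :* x₄))) :+ # 4 :* o :- h :* h :- o :* o))) refl

-- The isotropic vector will be doubled and the bracket become 2, so the numerator has to be
-- divisible by 4; h² + Y² ≡ 1 modulo 4 is arranged for that. Y receives a factor 2 only if h is
-- odd; then g ≡ h is odd, and g and Y have no common factor 2.
choose-Y : ∀ h o → ¬ + 2 ∣ o → ∃ λ y → + 4 ∣ h * h + o * y * (o * y) - 1ℤ × (∀ q → Prime q → + q ∣ o * y → + q ∣ o ⊎ (q ≡ 2 × ¬ + 2 ∣ h))
choose-Y h o o-odd with + 2 ∣? h
... | yes (divides k refl) = 1ℤ , by2 (k * k) 1ℤ (lem k o) ∣-refl (odd-square o-odd) , λ q _ d → inj₁ (subst (+ q ∣_) (ℤ.*-identityʳ o) d)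
  where lem : ∀ k o → k * + 2 * (k * + 2) + o * 1ℤ * (o * 1ℤ) - 1ℤ ≡ k * k * + 4 + 1ℤ * (o * o - 1ℤ)
        lem = solve-∀
... | no h-odd = + 2 , by2 (o * o) 1ℤ (lem h o) ∣-refl (odd-square h-odd) , at
  where lem : ∀ h o → h * h + o * + 2 * (o * + 2) - 1ℤ ≡ o * o * + 4 + 1ℤ * (h * h - 1ℤ)
        lem = solve-∀
        at : ∀ q → Prime q → + q ∣ o * + 2 → + q ∣ o ⊎ (q ≡ 2 × ¬ + 2 ∣ h)
        at q pq d with euclid pq d
        ... | inj₁ r = inj₁ r
        ... | inj₂ r = inj₂ (∣-prime pq prime[2] r , h-odd)

-- The parametrisation of r₁, m₁ and r₂ is recorded so that their parities can be read off from ε₁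
-- and ε₃.
EvenSum : (o A₁ A₂ K′ τ₁ τ₂ τ₃ ε₁ ε₃ : ℤ) → Set
EvenSum o A₁ A₂ K′ τ₁ τ₂ τ₃ ε₁ ε₃ = ∃ λ (n : NormSum A₁ A₂ (o * K′)) → ∃ λ j → ∃₂ λ x₁ x₂ → ∃ λ x₃ → let open NormSum n in
  r₁ ≡ o * (ε₁ + + 2 * x₁) + j * τ₁ × m₁ ≡ o * (+ 2 * x₂) + j * τ₂ × r₂ ≡ o * (ε₃ + + 2 * x₃) + j * τ₃

module _ {a b : ℤ} (o-odd : ¬ + 2 ∣ a * b) (P : ℤ) (avoid : ∀ q → Prime q → + q ∣ + 2 * (a * b) → ¬ + q ∣ P)
  (A₁ A₂ K′ τ₁ τ₂ τ₃ τ₄ l₁ l₂ l₃ l₄ ε₁ ε₃ : ℤ)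
  (prim : ∀ q → Prime q → + q ∣ P → + q ∣ l₁ → + q ∣ l₂ → + q ∣ l₃ → ¬ + q ∣ l₄)
  (isot : + 2 * P * (+ 2 * P) ≡ A₁ * (τ₁ * τ₁ + τ₂ * τ₂) + A₂ * (τ₃ * τ₃ + τ₄ * τ₄))
  (e₁ : A₁ * τ₁ ≡ + 2 * (a * l₁)) (e₂ : A₁ * τ₂ ≡ + 2 * (a * l₂)) (e₃ : A₂ * τ₃ ≡ + 2 * (b * l₃)) (e₄ : A₂ * τ₄ ≡ + 2 * (b * l₄))
  (cong4 : + 4 ∣ A₁ * (ε₁ * ε₁) + A₂ * (ε₃ * ε₃) + a * b * K′ - 1ℤ)
  (K-primes : ∀ q → Prime q → q ≢ 2 → + q ∣ a * b * K′ → + q ∣ a * b) where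

  private o = a * b

  -- For the isotropic vector (2P; τ) the relations A τ = 2al, A τ = 2bl make the bracket twice the
  -- linear form that `solve-linear` sets to 1. By `cong4` and the choice of Y the numerator is
  -- divisible by 4 whatever h and the xᵢ turn out to be.
  norm-sum-even : EvenSum o A₁ A₂ K′ τ₁ τ₂ τ₃ ε₁ ε₃
  norm-sum-even = go (solve-linear a b P l₁ l₂ l₃ l₄ ε₁ ε₃ avoid prim)
    where
    go : (∃ λ h → ∃₂ λ x₁ x₂ → ∃₂ λ x₃ x₄ →
      P * h - a * (o * (ε₁ + + 2 * x₁) * l₁ + o * (+ 2 * x₂) * l₂) - b * (o * (ε₃ + + 2 * x₃) * l₃ + o * (+ 2 * x₄) * l₄) ≡ 1ℤ) → EvenSum o A₁ A₂ K′ τ₁ τ₂ τ₃ ε₁ ε₃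
    go (h , x₁ , x₂ , x₃ , x₄ , e) = with-Y (choose-Y h o o-odd)
      where
      ρ₁ = o * (ε₁ + + 2 * x₁)
      ρ₂ = o * (+ 2 * x₂)
      ρ₃ = o * (ε₃ + + 2 * x₃)
      ρ₄ = o * (+ 2 * x₄)
      U = A₁ * ((ε₁ + + 2 * x₁) * (ε₁ + + 2 * x₁) + + 2 * x₂ * (+ 2 * x₂)) + A₂ * ((ε₃ + + 2 * x₃) * (ε₃ + + 2 * x₃) + + 2 * x₄ * (+ 2 * x₄))
      Z = A₁ * (ε₁ * x₁ + x₁ * x₁ + x₂ * x₂) + A₂ * (ε₃ * x₃ + x₃ * x₃ + x₄ * x₄)
      with-Y : (∃ λ y → + 4 ∣ h * h + o * y * (o * y) - 1ℤ × (∀ q → Prime q → + q ∣ o * y → + q ∣ o ⊎ (q ≡ 2 × ¬ + 2 ∣ h))) → EvenSum o A₁ A₂ K′ τ₁ τ₂ τ₃ ε₁ ε₃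
      with-Y (y , d4 , primes-Y) = finish 4∣num
        where
        Y = o * y
        4∣num : + 4 ∣ A₁ * (ρ₁ * ρ₁ + ρ₂ * ρ₂) + A₂ * (ρ₃ * ρ₃ + ρ₄ * ρ₄) + o * K′ - h * h - Y * Y
        4∣num = by4 U (- 1ℤ) 1ℤ Z (lem A₁ A₂ (o * K′) h o y ε₁ ε₃ x₁ x₂ x₃ x₄) (odd-square o-odd) d4 cong4 ∣-refl
          where lem : ∀ A₁ A₂ K h o y ε₁ ε₃ x₁ x₂ x₃ x₄ → let
                        ρ₁ = o * (ε₁ + + 2 * x₁); ρ₂ = o * (+ 2 * x₂); ρ₃ = o * (ε₃ + + 2 * x₃); ρ₄ = o * (+ 2 * x₄)
                        U = A₁ * ((ε₁ + + 2 * x₁) * (ε₁ + + 2 * x₁) + + 2 * x₂ * (+ 2 * x₂)) + A₂ * ((ε₃ + + 2 * x₃) * (ε₃ + + 2 * x₃) + + 2 * x₄ * (+ 2 * x₄))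
                        Z = A₁ * (ε₁ * x₁ + x₁ * x₁ + x₂ * x₂) + A₂ * (ε₃ * x₃ + x₃ * x₃ + x₄ * x₄) in
                      A₁ * (ρ₁ * ρ₁ + ρ₂ * ρ₂) + A₂ * (ρ₃ * ρ₃ + ρ₄ * ρ₄) + K - h * h - o * y * (o * y)
                      ≡ U * (o * o - 1ℤ) + - 1ℤ * (h * h + o * y * (o * y) - 1ℤ) + 1ℤ * (A₁ * (ε₁ * ε₁) + A₂ * (ε₃ * ε₃) + K - 1ℤ) + Z * + 4
                lem = ring! 12 (λ A₁ A₂ K h o y ε₁ ε₃ x₁ x₂ x₃ x₄ → let
                        ρ₁ = o :* (ε₁ :+ # 2 :* x₁); ρ₂ = o :* (# 2 :* x₂); ρ₃ = o :* (ε₃ :+ # 2 :* x₃); ρ₄ = o :* (# 2 :* x₄)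
                        U = A₁ :* ((ε₁ :+ # 2 :* x₁) :* (ε₁ :+ # 2 :* x₁) :+ # 2 :* x₂ :* (# 2 :* x₂)) :+ A₂ :* ((ε₃ :+ # 2 :* x₃) :* (ε₃ :+ # 2 :* x₃) :+ # 2 :* x₄ :* (# 2 :* x₄))
                        Z = A₁ :* (ε₁ :* x₁ :+ x₁ :* x₁ :+ x₂ :* x₂) :+ A₂ :* (ε₃ :* x₃ :+ x₃ :* x₃ :+ x₄ :* x₄) in
                      A₁ :* (ρ₁ :* ρ₁ :+ ρ₂ :* ρ₂) :+ A₂ :* (ρ₃ :* ρ₃ :+ ρ₄ :* ρ₄) :+ K :- h :* h :- o :* y :* (o :* y)
                      := U :* (o :* o :- # 1) :+ :- # 1 :* (h :* h :+ o :* y :* (o :* y) :- # 1) :+ # 1 :* (A₁ :* (ε₁ :* ε₁) :+ A₂ :* (ε₃ :* ε₃) :+ K :- # 1) :+ Z :* # 4) refl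
        finish : + 4 ∣ A₁ * (ρ₁ * ρ₁ + ρ₂ * ρ₂) + A₂ * (ρ₃ * ρ₃ + ρ₄ * ρ₄) + o * K′ - h * h - Y * Y → EvenSum o A₁ A₂ K′ τ₁ τ₂ τ₃ ε₁ ε₃
        finish (divides j ej) = record
            { g = h + j * (+ 2 * P) ; Y = Y ; r₁ = ρ₁ + j * τ₁ ; m₁ = ρ₂ + j * τ₂ ; r₂ = ρ₃ + j * τ₃ ; m₂ = ρ₄ + j * τ₄
            ; value = isotropic-line A₁ A₂ (o * K′) (+ 2 * P) τ₁ τ₂ τ₃ τ₄ h ρ₁ ρ₂ ρ₃ ρ₄ Y j isot
                (trans (cong (λ z → + 2 * j * z) bracket) (trans (lem₄ j) (sym ej)))
            ; g∥Y = λ q pq dg dY → coprime-gY q pq dg dY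
            ; p-odd = λ d → 2∤1 (by3 1ℤ (- 1ℤ) (- (+ 2 * (h * j * P) + + 2 * (j * j * P * P))) (lem₂ h j P Y) d (∣-trans (divides (+ 2) refl) d4) ∣-refl)
            ; p∥A₃ = λ q pq q≢2 d dp → let dₒ = K-primes q pq q≢2 d; dY = ∣m⇒∣m*n y dₒ
                in unit-at q pq dₒ (∣-square pq (by2 1ℤ (- Y) (lem₃ (h + j * (+ 2 * P)) Y) dp dY))
            } , j , x₁ , x₂ , x₃ , refl , refl , refl
          where
          lem₂ : ∀ h j P Y → 1ℤ ≡ 1ℤ * ((h + j * (+ 2 * P)) * (h + j * (+ 2 * P)) + Y * Y) + - 1ℤ * (h * h + Y * Y - 1ℤ) + - (+ 2 * (h * j * P) + + 2 * (j * j * P * P)) * + 2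
          lem₂ = ring! 4 (λ h j P Y → # 1 := # 1 :* ((h :+ j :* (# 2 :* P)) :* (h :+ j :* (# 2 :* P)) :+ Y :* Y) :+ :- # 1 :* (h :* h :+ Y :* Y :- # 1) :+ :- (# 2 :* (h :* j :* P) :+ # 2 :* (j :* j :* P :* P)) :* # 2) refl
          lem₃ : ∀ g o → g * g ≡ 1ℤ * (g * g + o * o) + - o * o
          lem₃ = solve-∀
          lem₄ : ∀ j → + 2 * j * + 2 ≡ j * + 4
          lem₄ = solve-∀
          swap : ∀ A ρ σ τ υ → A * (ρ * τ + σ * υ) ≡ ρ * (A * τ) + σ * (A * υ)
          swap = solve-∀
          bracket : + 2 * P * h - A₁ * (ρ₁ * τ₁ + ρ₂ * τ₂) - A₂ * (ρ₃ * τ₃ + ρ₄ * τ₄) ≡ + 2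
          bracket = trans (cong₂ (λ u v → + 2 * P * h - u - v)
              (trans (swap A₁ ρ₁ ρ₂ τ₁ τ₂) (cong₂ (λ u v → ρ₁ * u + ρ₂ * v) e₁ e₂))
              (trans (swap A₂ ρ₃ ρ₄ τ₃ τ₄) (cong₂ (λ u v → ρ₃ * u + ρ₄ * v) e₃ e₄)))
            (mod1 (+ 2) (lem a b P h ρ₁ ρ₂ ρ₃ ρ₄ l₁ l₂ l₃ l₄) e)
            where lem : ∀ a b P h ρ₁ ρ₂ ρ₃ ρ₄ l₁ l₂ l₃ l₄ → + 2 * P * h - (ρ₁ * (+ 2 * (a * l₁)) + ρ₂ * (+ 2 * (a * l₂))) - (ρ₃ * (+ 2 * (b * l₃)) + ρ₄ * (+ 2 * (b * l₄))) - + 2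
                        ≡ + 2 * (P * h - a * (ρ₁ * l₁ + ρ₂ * l₂) - b * (ρ₃ * l₃ + ρ₄ * l₄) - 1ℤ)
                  lem = ring! 12 (λ a b P h ρ₁ ρ₂ ρ₃ ρ₄ l₁ l₂ l₃ l₄ → # 2 :* P :* h :- (ρ₁ :* (# 2 :* (a :* l₁)) :+ ρ₂ :* (# 2 :* (a :* l₂))) :- (ρ₃ :* (# 2 :* (b :* l₃)) :+ ρ₄ :* (# 2 :* (b :* l₄))) :- # 2
                        := # 2 :* (P :* h :- a :* (ρ₁ :* l₁ :+ ρ₂ :* l₂) :- b :* (ρ₃ :* l₃ :+ ρ₄ :* l₄) :- # 1)) refl
          unit-at : ∀ q → Prime q → + q ∣ o → ¬ + q ∣ h + j * (+ 2 * P)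
          unit-at q pq d = g-unit pq P h (+ 2) j (a * ((ε₁ + + 2 * x₁) * l₁ + + 2 * x₂ * l₂) + b * ((ε₃ + + 2 * x₃) * l₃ + + 2 * x₄ * l₄))
              (o * U + K′ - y * Y) o d (trans (lem a b P h o ε₁ ε₃ x₁ x₂ x₃ x₄ l₁ l₂ l₃ l₄) e) (mod1 (- 1ℤ) (lem′ A₁ A₂ K′ o h y ε₁ ε₃ x₁ x₂ x₃ x₄ j) ej)
            where lem : ∀ a b P h o ε₁ ε₃ x₁ x₂ x₃ x₄ s₁ s₂ t₁ t₂ → P * h - o * (a * ((ε₁ + + 2 * x₁) * s₁ + + 2 * x₂ * s₂) + b * ((ε₃ + + 2 * x₃) * t₁ + + 2 * x₄ * t₂)) ≡
                     P * h - a * (o * (ε₁ + + 2 * x₁) * s₁ + o * (+ 2 * x₂) * s₂) - b * (o * (ε₃ + + 2 * x₃) * t₁ + o * (+ 2 * x₄) * t₂)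
                  lem = ring! 15 (λ a b P h o ε₁ ε₃ x₁ x₂ x₃ x₄ s₁ s₂ t₁ t₂ → P :* h :- o :* (a :* ((ε₁ :+ # 2 :* x₁) :* s₁ :+ # 2 :* x₂ :* s₂) :+ b :* ((ε₃ :+ # 2 :* x₃) :* t₁ :+ # 2 :* x₄ :* t₂)) :=
                     P :* h :- a :* (o :* (ε₁ :+ # 2 :* x₁) :* s₁ :+ o :* (# 2 :* x₂) :* s₂) :- b :* (o :* (ε₃ :+ # 2 :* x₃) :* t₁ :+ o :* (# 2 :* x₄) :* t₂)) refl
                  lem′ : ∀ A₁ A₂ K′ o h y ε₁ ε₃ x₁ x₂ x₃ x₄ j → let
                        ρ₁ = o * (ε₁ + + 2 * x₁); ρ₂ = o * (+ 2 * x₂); ρ₃ = o * (ε₃ + + 2 * x₃); ρ₄ = o * (+ 2 * x₄)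
                        U = A₁ * ((ε₁ + + 2 * x₁) * (ε₁ + + 2 * x₁) + + 2 * x₂ * (+ 2 * x₂)) + A₂ * ((ε₃ + + 2 * x₃) * (ε₃ + + 2 * x₃) + + 2 * x₄ * (+ 2 * x₄)) in
                      + 2 * (+ 2 * j) + h * h - o * (o * U + K′ - y * (o * y)) ≡
                      - 1ℤ * (A₁ * (ρ₁ * ρ₁ + ρ₂ * ρ₂) + A₂ * (ρ₃ * ρ₃ + ρ₄ * ρ₄) + o * K′ - h * h - o * y * (o * y) - j * + 4)
                  lem′ = ring! 13 (λ A₁ A₂ K′ o h y ε₁ ε₃ x₁ x₂ x₃ x₄ j → let
                        ρ₁ = o :* (ε₁ :+ # 2 :* x₁); ρ₂ = o :* (# 2 :* x₂); ρ₃ = o :* (ε₃ :+ # 2 :* x₃); ρ₄ = o :* (# 2 :* x₄)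
                        U = A₁ :* ((ε₁ :+ # 2 :* x₁) :* (ε₁ :+ # 2 :* x₁) :+ # 2 :* x₂ :* (# 2 :* x₂)) :+ A₂ :* ((ε₃ :+ # 2 :* x₃) :* (ε₃ :+ # 2 :* x₃) :+ # 2 :* x₄ :* (# 2 :* x₄)) in
                      # 2 :* (# 2 :* j) :+ h :* h :- o :* (o :* U :+ K′ :- y :* (o :* y)) :=
                      :- # 1 :* (A₁ :* (ρ₁ :* ρ₁ :+ ρ₂ :* ρ₂) :+ A₂ :* (ρ₃ :* ρ₃ :+ ρ₄ :* ρ₄) :+ o :* K′ :- h :* h :- o :* y :* (o :* y) :- j :* # 4)) refl
          coprime-gY : ∀ q → Prime q → + q ∣ h + j * (+ 2 * P) → ¬ + q ∣ Y
          coprime-gY q pq dg dY with primes-Y q pq dY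
          ... | inj₁ d = unit-at q pq d dg
          ... | inj₂ (refl , h-odd) = h-odd (by2 1ℤ (- (j * P)) (lem h j P) dg ∣-refl)
            where lem : ∀ h j P → h ≡ 1ℤ * (h + j * (+ 2 * P)) + - (j * P) * + 2
                  lem = solve-∀

module _ {a b : ℤ} (adm : Admissible a b) (i : Isotropic a b) (prim : Primitive i)
         (avoid : ∀ q → Prime q → + q ∣ + 2 * (a * b) → ¬ + q ∣ Isotropic.P i) where
  open Isotropic i
  open Admissible adm
  private
    half : ∀ q → Prime q → + q ∣ P → ∀ x → + q ∣ + 2 * x → + q ∣ x
    half q pq d x d2 with euclid {q} {+ 2} {x} pq d2
    ... | inj₂ r = r
    ... | inj₁ r = ⊥-elim (avoid q pq (∣m⇒∣m*n (a * b) r) d)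
    from₁ : ∀ q → Prime q → + q ∣ P → ∀ x y → + q ∣ x + y → + q ∣ y - x → + q ∣ x
    from₁ q pq d x y d₁ d₂ = half q pq d x (by2 1ℤ (- 1ℤ) (lem x y) d₁ d₂)
      where lem : ∀ x y → + 2 * x ≡ 1ℤ * (x + y) + - 1ℤ * (y - x)
            lem = solve-∀
    from₂ : ∀ q → Prime q → + q ∣ P → ∀ x y → + q ∣ x + y → + q ∣ y - x → + q ∣ y
    from₂ q pq d x y d₁ d₂ = half q pq d y (by2 1ℤ 1ℤ (lem x y) d₁ d₂)
      where lem : ∀ x y → + 2 * y ≡ 1ℤ * (x + y) + 1ℤ * (y - x)
            lem = solve-∀
    o-odd′ : ¬ + 2 ∣ a * b
    o-odd′ = ∤-* prime[2] odd-a odd-b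

  odd-mod4 : ∀ {x} → ¬ + 2 ∣ x → + 4 ∣ x - 1ℤ ⊎ + 4 ∣ x - + 3
  odd-mod4 {x} h with odd-half h
  ... | k , e with + 2 ∣? k
  ...   | yes (divides q refl) = inj₁ (divides q (trans (cong (_- 1ℤ) e) (lem q)))
    where lem : ∀ q → 1ℤ + q * + 2 * + 2 - 1ℤ ≡ q * + 4
          lem = solve-∀
  ...   | no k-odd = let q , e′ = odd-half k-odd in inj₂ (divides q (trans (cong (_- + 3) (trans e (cong (λ z → 1ℤ + z * + 2) e′))) (lem q)))
    where lem : ∀ q → 1ℤ + (1ℤ + q * + 2) * + 2 - + 3 ≡ q * + 4
          lem = solve-∀

  -- Since |1 - i|² = 2, the vector (2P; (1 - i)s, 2t) is isotropic for the coefficients 2a, b.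
  -- Since 2a ≡ 2 modulo 4, the choice of ε corrects b ≡ 3. The coordinate r₂ ≡ ab is odd because τ₃
  -- = 2t₁ is even.
  norm-sum-one-even : ∃ λ (n : NormSum (+ 2 * a) b (a * b * + 8)) → ¬ + 2 ∣ NormSum.r₂ n
  norm-sum-one-even = go (odd-mod4 odd-b)
    where
    run : ∀ ε → + 4 ∣ + 2 * a * (ε * ε) + b * (1ℤ * 1ℤ) + a * b * + 8 - 1ℤ → ∃ λ (n : NormSum (+ 2 * a) b (a * b * + 8)) → ¬ + 2 ∣ NormSum.r₂ n
    run ε d = fin (norm-sum-even {a} {b} o-odd′ P avoid (+ 2 * a) b (+ 8) (s₁ + s₂) (s₂ - s₁) (+ 2 * t₁) (+ 2 * t₂)
                        (s₁ + s₂) (s₂ - s₁) t₁ t₂ ε 1ℤ (λ q pq dP d₁ d₂ d₃ d₄ → prim q pq dP (from₁ q pq dP s₁ s₂ d₁ d₂) (from₂ q pq dP s₁ s₂ d₁ d₂) d₃ d₄)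
                        (mod1 (+ 4) (iso-eq a b P s₁ s₂ t₁ t₂) zero-of) (l₁ a (s₁ + s₂)) (l₁ a (s₂ - s₁)) (l₂ b t₁) (l₂ b t₂) d
                        strip)
      where
      iso-eq : ∀ a b P s₁ s₂ t₁ t₂ → + 2 * P * (+ 2 * P) - (+ 2 * a * ((s₁ + s₂) * (s₁ + s₂) + (s₂ - s₁) * (s₂ - s₁)) + b * (+ 2 * t₁ * (+ 2 * t₁) + + 2 * t₂ * (+ 2 * t₂)))
        ≡ + 4 * (P * P - (a * (s₁ * s₁ + s₂ * s₂) + b * (t₁ * t₁ + t₂ * t₂)))
      iso-eq = ring! 7 (λ a b P s₁ s₂ t₁ t₂ → # 2 :* P :* (# 2 :* P) :- (# 2 :* a :* ((s₁ :+ s₂) :* (s₁ :+ s₂) :+ (s₂ :- s₁) :* (s₂ :- s₁)) :+ b :* (# 2 :* t₁ :* (# 2 :* t₁) :+ # 2 :* t₂ :* (# 2 :* t₂)))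
        := # 4 :* (P :* P :- (a :* (s₁ :* s₁ :+ s₂ :* s₂) :+ b :* (t₁ :* t₁ :+ t₂ :* t₂)))) refl
      l₁ : ∀ a w → + 2 * a * w ≡ + 2 * (a * w)
      l₁ = solve-∀
      l₂ : ∀ b t → b * (+ 2 * t) ≡ + 2 * (b * t)
      l₂ = solve-∀
      l₃ : ∀ o x j t → o ≡ 1ℤ * (o * (1ℤ + + 2 * x) + j * (+ 2 * t)) + - (o * x + j * t) * + 2
      l₃ = solve-∀
      strip : ∀ q → Prime q → q ≢ 2 → + q ∣ a * b * + 8 → + q ∣ a * b
      strip q pq q≢2 d with euclid pq d
      ... | inj₁ r = r
      ... | inj₂ r = ⊥-elim (∤-* pq (odd-prime∤2 pq q≢2) (∤-* pq (odd-prime∤2 pq q≢2) (odd-prime∤2 pq q≢2)) r)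
      fin : EvenSum (a * b) (+ 2 * a) b (+ 8) (s₁ + s₂) (s₂ - s₁) (+ 2 * t₁) ε 1ℤ → ∃ λ (n : NormSum (+ 2 * a) b (a * b * + 8)) → ¬ + 2 ∣ NormSum.r₂ n
      fin (n , j , x₁ , x₂ , x₃ , _ , _ , er) = n , λ dr → o-odd′ (by2 1ℤ (- (a * b * x₃ + j * t₁)) (l₃ (a * b) x₃ j t₁) (subst (+ 2 ∣_) er dr) ∣-refl)
    go : + 4 ∣ b - 1ℤ ⊎ + 4 ∣ b - + 3 → ∃ λ (n : NormSum (+ 2 * a) b (a * b * + 8)) → ¬ + 2 ∣ NormSum.r₂ n
    go (inj₁ d) = run 0ℤ (by2 1ℤ (+ 2 * (a * b)) (lem a b) d ∣-refl)
      where lem : ∀ a b → + 2 * a * (0ℤ * 0ℤ) + b * (1ℤ * 1ℤ) + a * b * + 8 - 1ℤ ≡ 1ℤ * (b - 1ℤ) + + 2 * (a * b) * + 4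
            lem = ring! 2 (λ a b → # 2 :* a :* (# 0 :* # 0) :+ b :* (# 1 :* # 1) :+ a :* b :* # 8 :- # 1 := # 1 :* (b :- # 1) :+ # 2 :* (a :* b) :* # 4) refl
    go (inj₂ d) = let k , e = odd-half odd-a in run 1ℤ (by2 1ℤ (+ 2 * (a * b) + k + 1ℤ) (mod1 (+ 2) (lem a b k) e) d ∣-refl)
      where lem : ∀ a b k → + 2 * a * (1ℤ * 1ℤ) + b * (1ℤ * 1ℤ) + a * b * + 8 - 1ℤ - (1ℤ * (b - + 3) + (+ 2 * (a * b) + k + 1ℤ) * + 4) ≡ + 2 * (a - (1ℤ + k * + 2))
            lem = ring! 3 (λ a b k → # 2 :* a :* (# 1 :* # 1) :+ b :* (# 1 :* # 1) :+ a :* b :* # 8 :- # 1 :- (# 1 :* (b :- # 3) :+ (# 2 :* (a :* b) :+ k :+ # 1) :* # 4) := # 2 :* (a :- (# 1 :+ k :* # 2))) refl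

  -- Both Gaussian coordinates are multiplied by 1 - i. Then τ₁ + τ₂ = 2s₂, hence r₁ + m₁ ≡ ab is
  -- odd: α and iα have real parts of different parity, which later leaves the parity of M₁ free.
  norm-sum-both-even : ∃ λ (n : NormSum (+ 2 * a) (+ 2 * b) (a * b * 1ℤ)) → let open NormSum n in ¬ + 2 ∣ r₁ + m₁
  norm-sum-both-even = go (odd-mod4 o-odd′)
    where
    run : ∀ ε → + 4 ∣ + 2 * a * (1ℤ * 1ℤ) + + 2 * b * (ε * ε) + a * b * 1ℤ - 1ℤ → ∃ λ (n : NormSum (+ 2 * a) (+ 2 * b) (a * b * 1ℤ)) → let open NormSum n in ¬ + 2 ∣ r₁ + m₁
    run ε d = fin (norm-sum-even {a} {b} o-odd′ P avoid (+ 2 * a) (+ 2 * b) 1ℤ (s₁ + s₂) (s₂ - s₁) (t₁ + t₂) (t₂ - t₁)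
                        (s₁ + s₂) (s₂ - s₁) (t₁ + t₂) (t₂ - t₁) 1ℤ ε
                        (λ q pq dP d₁ d₂ d₃ d₄ → prim q pq dP (from₁ q pq dP s₁ s₂ d₁ d₂) (from₂ q pq dP s₁ s₂ d₁ d₂) (from₁ q pq dP t₁ t₂ d₃ d₄) (from₂ q pq dP t₁ t₂ d₃ d₄))
                        (mod1 (+ 4) (iso-eq a b P s₁ s₂ t₁ t₂) zero-of) (l₁ a (s₁ + s₂)) (l₁ a (s₂ - s₁)) (l₁ b (t₁ + t₂)) (l₁ b (t₂ - t₁)) d
                        (λ q pq q≢2 dK → subst (+ q ∣_) (ℤ.*-identityʳ (a * b)) dK))
      where
      iso-eq : ∀ a b P s₁ s₂ t₁ t₂ → + 2 * P * (+ 2 * P) - (+ 2 * a * ((s₁ + s₂) * (s₁ + s₂) + (s₂ - s₁) * (s₂ - s₁)) + + 2 * b * ((t₁ + t₂) * (t₁ + t₂) + (t₂ - t₁) * (t₂ - t₁)))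
        ≡ + 4 * (P * P - (a * (s₁ * s₁ + s₂ * s₂) + b * (t₁ * t₁ + t₂ * t₂)))
      iso-eq = ring! 7 (λ a b P s₁ s₂ t₁ t₂ → # 2 :* P :* (# 2 :* P) :- (# 2 :* a :* ((s₁ :+ s₂) :* (s₁ :+ s₂) :+ (s₂ :- s₁) :* (s₂ :- s₁)) :+ # 2 :* b :* ((t₁ :+ t₂) :* (t₁ :+ t₂) :+ (t₂ :- t₁) :* (t₂ :- t₁)))
        := # 4 :* (P :* P :- (a :* (s₁ :* s₁ :+ s₂ :* s₂) :+ b :* (t₁ :* t₁ :+ t₂ :* t₂)))) refl
      l₁ : ∀ a w → + 2 * a * w ≡ + 2 * (a * w)
      l₁ = solve-∀
      l₃ : ∀ o x x′ j s₁ s₂ → o ≡ 1ℤ * (o * (1ℤ + + 2 * x) + j * (s₁ + s₂) + (o * (+ 2 * x′) + j * (s₂ - s₁))) + - (o * x + o * x′ + j * s₂) * + 2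
      l₃ = ring! 6 (λ o x x′ j s₁ s₂ → o := # 1 :* (o :* (# 1 :+ # 2 :* x) :+ j :* (s₁ :+ s₂) :+ (o :* (# 2 :* x′) :+ j :* (s₂ :- s₁))) :+ :- (o :* x :+ o :* x′ :+ j :* s₂) :* # 2) refl
      fin : EvenSum (a * b) (+ 2 * a) (+ 2 * b) 1ℤ (s₁ + s₂) (s₂ - s₁) (t₁ + t₂) 1ℤ ε → ∃ λ (n : NormSum (+ 2 * a) (+ 2 * b) (a * b * 1ℤ)) → let open NormSum n in ¬ + 2 ∣ r₁ + m₁
      fin (n , j , x₁ , x₂ , x₃ , er , em , _) = n , λ dr → o-odd′ (by2 1ℤ (- (a * b * x₁ + a * b * x₂ + j * s₂)) (l₃ (a * b) x₁ x₂ j s₁ s₂) (subst (+ 2 ∣_) (cong₂ _+_ er em) dr) ∣-refl)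
    go : + 4 ∣ a * b - 1ℤ ⊎ + 4 ∣ a * b - + 3 → ∃ λ (n : NormSum (+ 2 * a) (+ 2 * b) (a * b * 1ℤ)) → let open NormSum n in ¬ + 2 ∣ r₁ + m₁
    go (inj₁ d) = let k , e = odd-half odd-a; l , e′ = odd-half odd-b in run 1ℤ (by2 1ℤ (k + l + 1ℤ) (mod2 (+ 2) (+ 2) (lem a b k l) e e′) d ∣-refl)
      where lem : ∀ a b k l → + 2 * a * (1ℤ * 1ℤ) + + 2 * b * (1ℤ * 1ℤ) + a * b * 1ℤ - 1ℤ - (1ℤ * (a * b - 1ℤ) + (k + l + 1ℤ) * + 4) ≡ + 2 * (a - (1ℤ + k * + 2)) + + 2 * (b - (1ℤ + l * + 2))
            lem = ring! 4 (λ a b k l → # 2 :* a :* (# 1 :* # 1) :+ # 2 :* b :* (# 1 :* # 1) :+ a :* b :* # 1 :- # 1 :- (# 1 :* (a :* b :- # 1) :+ (k :+ l :+ # 1) :* # 4) := # 2 :* (a :- (# 1 :+ k :* # 2)) :+ # 2 :* (b :- (# 1 :+ l :* # 2))) refl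
    go (inj₂ d) = let k , e = odd-half odd-a in run 0ℤ (by2 1ℤ (k + 1ℤ) (mod1 (+ 2) (lem a b k) e) d ∣-refl)
      where lem : ∀ a b k → + 2 * a * (1ℤ * 1ℤ) + + 2 * b * (0ℤ * 0ℤ) + a * b * 1ℤ - 1ℤ - (1ℤ * (a * b - + 3) + (k + 1ℤ) * + 4) ≡ + 2 * (a - (1ℤ + k * + 2))
            lem = ring! 3 (λ a b k → # 2 :* a :* (# 1 :* # 1) :+ # 2 :* b :* (# 0 :* # 0) :+ a :* b :* # 1 :- # 1 :- (# 1 :* (a :* b :- # 3) :+ (k :+ # 1) :* # 4) := # 2 :* (a :- (# 1 :+ k :* # 2))) refl

-- Making the coefficients of L coprime

-- Chinese remainders, one odd prime at a time: κ is changed by multiples of E, and 16E is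
-- invertible modulo a new odd prime. The residue 1 is taken where `G` holds and 0 elsewhere, while
-- 16κ stays 0 modulo 16.
select-residues : (G : ℕ → Set) → (∀ ℓ → Dec (G ℓ)) → ∀ E → E ≢ 0 →
  ∃ λ κ → ∀ ℓ → Prime ℓ → ℓ ≢ 2 → + ℓ ∣ + E → (+ ℓ ∣ + 16 * κ × ¬ G ℓ) ⊎ (+ ℓ ∣ + 16 * κ - 1ℤ × G ℓ)
select-residues G G? = product-ind (λ E → ∃ (Solves E)) (0ℤ , λ ℓ pℓ _ d → ⊥-elim (prime∤1 pℓ d)) step
  where
  Fits : ℤ → ℕ → Set
  Fits κ ℓ = (+ ℓ ∣ + 16 * κ × ¬ G ℓ) ⊎ (+ ℓ ∣ + 16 * κ - 1ℤ × G ℓ)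
  Solves : ℕ → ℤ → Set
  Solves E κ = ∀ ℓ → Prime ℓ → ℓ ≢ 2 → + ℓ ∣ + E → Fits κ ℓ
  fit : ∀ κ E′ f q → Prime q → q ≢ 2 → ¬ + q ∣ E′ → ∃ λ u → + q ∣ + 16 * (κ + u * E′) - f
  fit κ E′ f q pq q≢2 q∤E = let v , d = inverse {q} {+ 16 * E′} pq (∤-* pq (∤-* pq (∤-* pq 2∤ 2∤) (∤-* pq 2∤ 2∤)) q∤E)
    in v * (f - + 16 * κ) , by1 (f - + 16 * κ) (lem κ E′ f v) d
    where
    2∤ = odd-prime∤2 pq q≢2
    lem : ∀ κ E f v → + 16 * (κ + v * (f - + 16 * κ) * E) - f ≡ (f - + 16 * κ) * (v * (+ 16 * E) - 1ℤ)
    lem = solve-∀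
  keep : ∀ κ u E′ ℓ → + ℓ ∣ E′ → Fits κ ℓ → Fits (κ + u * E′) ℓ
  keep κ u E′ ℓ dE (inj₁ (d , g)) = inj₁ (by2 1ℤ (+ 16 * u) (lem κ u E′) d dE , g)
    where lem : ∀ κ u E → + 16 * (κ + u * E) ≡ 1ℤ * (+ 16 * κ) + + 16 * u * E
          lem = solve-∀
  keep κ u E′ ℓ dE (inj₂ (d , g)) = inj₂ (by2 1ℤ (+ 16 * u) (lem κ u E′) d dE , g)
    where lem : ∀ κ u E → + 16 * (κ + u * E) - 1ℤ ≡ 1ℤ * (+ 16 * κ - 1ℤ) + + 16 * u * E
          lem = solve-∀
  factor : ∀ q E ℓ → Prime ℓ → Prime q → + ℓ ∣ + (q ℕ.* E) → ℓ ≡ q ⊎ + ℓ ∣ + E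
  factor q E ℓ pℓ pq d with euclid {ℓ} {+ q} {+ E} pℓ (subst (+ ℓ ∣_) (ℤ.pos-* q E) d)
  ... | inj₁ e = inj₁ (∣-prime pℓ pq e)
  ... | inj₂ e = inj₂ e
  step : ∀ q E → Prime q → E ≢ 0 → ∃ (Solves E) → ∃ (Solves (q ℕ.* E))
  step q E pq _ (κ , h) with q ℕ.≟ 2 | + q ∣? + E
  ... | yes refl | _ = κ , λ ℓ pℓ ℓ≢2 d → go ℓ pℓ ℓ≢2 (factor 2 E ℓ pℓ pq d)
    where go : ∀ ℓ → Prime ℓ → ℓ ≢ 2 → ℓ ≡ 2 ⊎ + ℓ ∣ + E → Fits κ ℓ
          go ℓ pℓ ℓ≢2 (inj₁ e) = ⊥-elim (ℓ≢2 e)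
          go ℓ pℓ ℓ≢2 (inj₂ e) = h ℓ pℓ ℓ≢2 e
  ... | no _ | yes q∣E = κ , λ ℓ pℓ ℓ≢2 d → go ℓ pℓ ℓ≢2 (factor q E ℓ pℓ pq d)
    where go : ∀ ℓ → Prime ℓ → ℓ ≢ 2 → ℓ ≡ q ⊎ + ℓ ∣ + E → Fits κ ℓ
          go ℓ pℓ ℓ≢2 (inj₁ refl) = h ℓ pℓ ℓ≢2 q∣E
          go ℓ pℓ ℓ≢2 (inj₂ e) = h ℓ pℓ ℓ≢2 e
  ... | no q≢2 | no q∤E = at-q (G? q)
    where
    extend : ∀ u → Fits (κ + u * + E) q → ∃ (Solves (q ℕ.* E))
    extend u fq = κ + u * + E , λ ℓ pℓ ℓ≢2 d → go ℓ pℓ ℓ≢2 (factor q E ℓ pℓ pq d)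
      where go : ∀ ℓ → Prime ℓ → ℓ ≢ 2 → ℓ ≡ q ⊎ + ℓ ∣ + E → Fits (κ + u * + E) ℓ
            go ℓ pℓ ℓ≢2 (inj₁ refl) = fq
            go ℓ pℓ ℓ≢2 (inj₂ e) = keep κ u (+ E) ℓ e (h ℓ pℓ ℓ≢2 e)
    at-q : Dec (G q) → ∃ (Solves (q ℕ.* E))
    at-q (no ¬g) = let u , d = fit κ (+ E) 0ℤ q pq q≢2 q∤E in extend u (inj₁ (subst (+ q ∣_) (ℤ.+-identityʳ (+ 16 * (κ + u * + E))) d , ¬g))
    at-q (yes g) = let u , d = fit κ (+ E) 1ℤ q pq q≢2 q∤E in extend u (inj₂ (d , g))

-- Vectors R = (R₁, R₂, 16κ) and M = (M₁, M₂, −1) in the lattice with norm form A₁X₁² + A₂X₂² + A₃X₃².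
record Slice (A₁ A₂ A₃ : ℤ) : Set where
  field
    κ R₁ M₁ R₂ M₂ x y X Z : ℤ
    unimodular : x * X + y * Z ≡ 1ℤ
    norm-eq : x * x + y * y ≡ A₁ * (R₁ * R₁ + M₁ * M₁) + A₂ * (R₂ * R₂ + M₂ * M₂) + A₃ * (+ 16 * κ * (+ 16 * κ) + 1ℤ)
    pp-odd : ¬ + 2 ∣ x * x + y * y
    c-odd : ¬ + 2 ∣ x * Z - y * X
    coprime-D : ∀ ℓ → Prime ℓ → ℓ ≢ 2 →
      + ℓ ∣ A₁ * (M₁ * M₁) + A₂ * (M₂ * M₂) + A₃ - (x * Z - y * X) * (A₁ * (R₁ * M₁) + A₂ * (R₂ * M₂) - A₃ * (+ 16 * κ)) →
      + ℓ ∣ (x * x + y * y) * (A₁ * M₁) → + ℓ ∣ (x * x + y * y) * (A₂ * M₂) → ¬ + ℓ ∣ (x * x + y * y) * A₃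

module _ {A₁ A₂ A₃ : ℤ} (n : NormSum A₁ A₂ A₃) (A₃≢0 : A₃ ≢ 0ℤ)
  (primes : ∀ q → Prime q → q ≢ 2 → + q ∣ A₃ → (+ q ∣ A₁ × ¬ + q ∣ A₂) ⊎ (+ q ∣ A₂ × ¬ + q ∣ A₁)) where
  open NormSum n

  SliceOf : Set
  SliceOf = ∃ λ (s : Slice A₁ A₂ A₃) → let open Slice s in
    (+ 2 ∣ M₁ - r₁ × + 2 ∣ M₂ - r₂) × (+ 2 ∣ R₁ + m₁ × + 2 ∣ R₂ + m₂)

  private
    p = g * g + Y * Y
    T₀ = A₁ * ((g * m₁ + Y * r₁) * (g * m₁ + Y * r₁)) + A₂ * ((g * m₂ + Y * r₂) * (g * m₂ + Y * r₂))

    -- The condition under which k ≡ 0 is bad at ℓ and k ≡ 1 is taken instead. For ℓ ∣ p the norm of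
    -- yR + xM is T₀ + A₃Y² at k ≡ 0, and at k ≡ 1 it is 4(T₀ + A₃g²) ≡ 4(T₀ - A₃Y²); both cannot
    -- vanish, as ℓ ∤ 2A₃Y. For ℓ ∤ p the case of interest is ℓ ∣ A₃: some M = km + r has to be a
    -- unit, which is r at k ≡ 0, and m at k ≡ 1 if r ≡ 0; r ≡ m ≡ 0 would give ℓ ∣ p.
    G : ℕ → Set
    G ℓ = (+ ℓ ∣ p × + ℓ ∣ T₀ + A₃ * (Y * Y)) ⊎ (¬ + ℓ ∣ p × ((+ ℓ ∣ A₁ × + ℓ ∣ r₂) ⊎ (¬ + ℓ ∣ A₁ × + ℓ ∣ r₁)))

    G? : ∀ ℓ → Dec (G ℓ)
    G? ℓ = (+ ℓ ∣? p ×-dec + ℓ ∣? T₀ + A₃ * (Y * Y)) ⊎-dec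
      (¬? (+ ℓ ∣? p) ×-dec ((+ ℓ ∣? A₁ ×-dec + ℓ ∣? r₂) ⊎-dec (¬? (+ ℓ ∣? A₁) ×-dec + ℓ ∣? r₁)))

    p≢0 : p ≢ 0ℤ
    p≢0 = ∤⇒≢0 p-odd

    Choice : ℤ → ℕ → Set
    Choice k ℓ = (+ ℓ ∣ k × ¬ G ℓ) ⊎ (+ ℓ ∣ k - 1ℤ × G ℓ)

    k²+1-unit : ∀ {ℓ} → Prime ℓ → ℓ ≢ 2 → ∀ k → Choice k ℓ → ¬ + ℓ ∣ k * k + 1ℤ
    k²+1-unit pℓ ℓ≢2 k (inj₁ (d , _)) e = prime∤1 pℓ (by2 1ℤ (- k) (lem k) e d)
      where lem : ∀ k → 1ℤ ≡ 1ℤ * (k * k + 1ℤ) + - k * k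
            lem = solve-∀
    k²+1-unit pℓ ℓ≢2 k (inj₂ (d , _)) e = odd-prime∤2 pℓ ℓ≢2 (by2 1ℤ (- (k + 1ℤ)) (lem k) e d)
      where lem : ∀ k → + 2 ≡ 1ℤ * (k * k + 1ℤ) + - (k + 1ℤ) * (k - 1ℤ)
            lem = solve-∀

    not-G-p : ∀ {ℓ} → + ℓ ∣ p → ¬ G ℓ → ¬ + ℓ ∣ T₀ + A₃ * (Y * Y)
    not-G-p d h e = h (inj₁ (d , e))
    G-p : ∀ {ℓ} → + ℓ ∣ p → G ℓ → + ℓ ∣ T₀ + A₃ * (Y * Y)
    G-p d (inj₁ (_ , e)) = e
    G-p d (inj₂ (h , _)) = ⊥-elim (h d)
    G-1 : ∀ {ℓ} → ¬ + ℓ ∣ p → + ℓ ∣ A₁ → G ℓ → + ℓ ∣ r₂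
    G-1 d a (inj₁ (e , _)) = ⊥-elim (d e)
    G-1 d a (inj₂ (_ , inj₁ (_ , e))) = e
    G-1 d a (inj₂ (_ , inj₂ (h , _))) = ⊥-elim (h a)
    G-2 : ∀ {ℓ} → ¬ + ℓ ∣ p → ¬ + ℓ ∣ A₁ → G ℓ → + ℓ ∣ r₁
    G-2 d a (inj₁ (e , _)) = ⊥-elim (d e)
    G-2 d a (inj₂ (_ , inj₁ (h , _))) = ⊥-elim (a h)
    G-2 d a (inj₂ (_ , inj₂ (_ , e))) = e

    both-divide : ∀ {ℓ} k r m → (¬ G ℓ → ¬ + ℓ ∣ r) → (G ℓ → + ℓ ∣ r) → Choice k ℓ → + ℓ ∣ k * m + r → + ℓ ∣ r × + ℓ ∣ m
    both-divide k r m ¬G⇒ _ (inj₁ (d , ¬g)) e = ⊥-elim (¬G⇒ ¬g (by2 1ℤ (- m) (lem k r m) e d))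
      where lem : ∀ k r m → r ≡ 1ℤ * (k * m + r) + - m * k
            lem = solve-∀
    both-divide k r m _ G⇒ (inj₂ (d , gg)) e = G⇒ gg , by3 1ℤ (- m) (- 1ℤ) (lem k r m) e d (G⇒ gg)
      where lem : ∀ k r m → m ≡ 1ℤ * (k * m + r) + - m * (k - 1ℤ) + - 1ℤ * r
            lem = solve-∀

    value-divisible : ∀ {ℓ} → + ℓ ∣ A₃ → (+ ℓ ∣ A₁ × + ℓ ∣ r₂ × + ℓ ∣ m₂) ⊎ (+ ℓ ∣ A₂ × + ℓ ∣ r₁ × + ℓ ∣ m₁) → + ℓ ∣ p
    value-divisible d (inj₁ (e , f , h)) = subst (_ ∣_) (sym value) (by4 (r₁ * r₁ + m₁ * m₁) (A₂ * r₂) (A₂ * m₂) 1ℤ (lem A₁ A₂ A₃ r₁ m₁ r₂ m₂) e f h d)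
      where lem : ∀ A₁ A₂ A₃ r₁ m₁ r₂ m₂ → A₁ * (r₁ * r₁ + m₁ * m₁) + A₂ * (r₂ * r₂ + m₂ * m₂) + A₃ ≡ (r₁ * r₁ + m₁ * m₁) * A₁ + A₂ * r₂ * r₂ + A₂ * m₂ * m₂ + 1ℤ * A₃
            lem = ring! 7 (λ A₁ A₂ A₃ r₁ m₁ r₂ m₂ → A₁ :* (r₁ :* r₁ :+ m₁ :* m₁) :+ A₂ :* (r₂ :* r₂ :+ m₂ :* m₂) :+ A₃ := (r₁ :* r₁ :+ m₁ :* m₁) :* A₁ :+ A₂ :* r₂ :* r₂ :+ A₂ :* m₂ :* m₂ :+ # 1 :* A₃) refl
    value-divisible d (inj₂ (e , f , h)) = subst (_ ∣_) (sym value) (by4 (r₂ * r₂ + m₂ * m₂) (A₁ * r₁) (A₁ * m₁) 1ℤ (lem A₁ A₂ A₃ r₁ m₁ r₂ m₂) e f h d)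
      where lem : ∀ A₁ A₂ A₃ r₁ m₁ r₂ m₂ → A₁ * (r₁ * r₁ + m₁ * m₁) + A₂ * (r₂ * r₂ + m₂ * m₂) + A₃ ≡ (r₂ * r₂ + m₂ * m₂) * A₂ + A₁ * r₁ * r₁ + A₁ * m₁ * m₁ + 1ℤ * A₃
            lem = ring! 7 (λ A₁ A₂ A₃ r₁ m₁ r₂ m₂ → A₁ :* (r₁ :* r₁ :+ m₁ :* m₁) :+ A₂ :* (r₂ :* r₂ :+ m₂ :* m₂) :+ A₃ := (r₂ :* r₂ :+ m₂ :* m₂) :* A₂ :+ A₁ :* r₁ :* r₁ :+ A₁ :* m₁ :* m₁ :+ # 1 :* A₃) refl

    g∧Y : ∀ {ℓ} → Prime ℓ → + ℓ ∣ Y → ¬ + ℓ ∣ p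
    g∧Y {ℓ} pℓ dY dp = g∥Y ℓ pℓ (∣-square pℓ (by2 1ℤ (- Y) (lem g Y) dp dY)) dY
      where lem : ∀ g Y → g * g ≡ 1ℤ * (g * g + Y * Y) + - Y * Y
            lem = solve-∀

  module _ (κ : ℤ) (choice : ∀ ℓ → Prime ℓ → ℓ ≢ 2 → + ℓ ∣ p * A₃ → Choice (+ 16 * κ) ℓ) where
    private
      k = + 16 * κ
      x = k * g + Y
      y = k * Y - g
      pp-eq : ∀ k g Y → (k * g + Y) * (k * g + Y) + (k * Y - g) * (k * Y - g) ≡ (k * k + 1ℤ) * (g * g + Y * Y)
      pp-eq = solve-∀

      -- A common prime of x and y divides p, where k² + 1 is a unit by the choice of k. It also
      -- divides (k² + 1)g and (k² + 1)Y, hence g and Y.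
      x∥y : ∀ ℓ → Prime ℓ → + ℓ ∣ x → ¬ + ℓ ∣ y
      x∥y ℓ pℓ dx dy = g∥Y ℓ pℓ (strip g (by2 k (- 1ℤ) (lem k g Y) dx dy)) (strip Y (by2 1ℤ k (lem′ k g Y) dx dy))
        where
        lem₀ : ∀ k g Y → g * g + Y * Y ≡ Y * (k * g + Y) + - g * (k * Y - g)
        lem₀ = solve-∀
        ∣p : + ℓ ∣ p
        ∣p = by2 Y (- g) (lem₀ k g Y) dx dy
        ℓ≢2 : ℓ ≢ 2
        ℓ≢2 refl = p-odd ∣p
        lem : ∀ k g Y → (k * k + 1ℤ) * g ≡ k * (k * g + Y) + - 1ℤ * (k * Y - g)
        lem = solve-∀
        lem′ : ∀ k g Y → (k * k + 1ℤ) * Y ≡ 1ℤ * (k * g + Y) + k * (k * Y - g)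
        lem′ = solve-∀
        strip : ∀ z → + ℓ ∣ (k * k + 1ℤ) * z → + ℓ ∣ z
        strip z d with euclid {ℓ} {k * k + 1ℤ} {z} pℓ d
        ... | inj₁ e = ⊥-elim (k²+1-unit pℓ ℓ≢2 k (choice ℓ pℓ ℓ≢2 (∣m⇒∣m*n A₃ ∣p)) e)
        ... | inj₂ e = e

      pp-odd′ : ¬ + 2 ∣ x * x + y * y
      pp-odd′ d = p-odd (by2 1ℤ (- (+ 128 * κ * κ * p)) (trans (lem κ p) (cong (λ z → 1ℤ * z + - (+ 128 * κ * κ * p) * + 2) (sym (pp-eq k g Y)))) d ∣-refl)
        where lem : ∀ κ p → p ≡ 1ℤ * ((+ 16 * κ * (+ 16 * κ) + 1ℤ) * p) + - (+ 128 * κ * κ * p) * + 2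
              lem = solve-∀

      -- Passing from (X, Z) to (X + y, Z - x) keeps the Bézout relation and lowers xZ - yX by the
      -- odd number x² + y².
      odd-c : ∀ X Z → x * X + y * Z ≡ 1ℤ → ∃₂ λ X Z → x * X + y * Z ≡ 1ℤ × ¬ + 2 ∣ x * Z - y * X
      odd-c X Z e with + 2 ∣? x * Z - y * X
      ... | no h = X , Z , e , h
      ... | yes d = X + y , Z - x , trans (lem x y X Z) e , λ d′ → pp-odd′ (by2 1ℤ (- 1ℤ) (lem′ x y X Z) d d′)
        where lem : ∀ x y X Z → x * (X + y) + y * (Z - x) ≡ x * X + y * Z
              lem = solve-∀
              lem′ : ∀ x y X Z → x * x + y * y ≡ 1ℤ * (x * Z - y * X) + - 1ℤ * (x * (Z - x) - y * (X + y))
              lem′ = solve-∀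

      -- α and β are multiplied by k + i, but g + Yi and the third coordinate 1 by k - i. With k + i
      -- in the third coordinate too, yR + xM would have norm (k² + 1)²(T₀ + A₃Y²), and at a prime
      -- of p no choice of k could help.
      R₁ = k * r₁ - m₁
      R₂ = k * r₂ - m₂
      M₁ = k * m₁ + r₁
      M₂ = k * m₂ + r₂

      norm′ : x * x + y * y ≡ A₁ * (R₁ * R₁ + M₁ * M₁) + A₂ * (R₂ * R₂ + M₂ * M₂) + A₃ * (k * k + 1ℤ)
      norm′ = mod1 (k * k + 1ℤ) (lem A₁ A₂ A₃ k g Y r₁ m₁ r₂ m₂) value
        where lem : ∀ A₁ A₂ A₃ k g Y r₁ m₁ r₂ m₂ → (k * g + Y) * (k * g + Y) + (k * Y - g) * (k * Y - g) -
                (A₁ * ((k * r₁ - m₁) * (k * r₁ - m₁) + (k * m₁ + r₁) * (k * m₁ + r₁)) + A₂ * ((k * r₂ - m₂) * (k * r₂ - m₂) + (k * m₂ + r₂) * (k * m₂ + r₂)) + A₃ * (k * k + 1ℤ))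
                ≡ (k * k + 1ℤ) * (g * g + Y * Y - (A₁ * (r₁ * r₁ + m₁ * m₁) + A₂ * (r₂ * r₂ + m₂ * m₂) + A₃))
              lem = ring! 10 (λ A₁ A₂ A₃ k g Y r₁ m₁ r₂ m₂ → (k :* g :+ Y) :* (k :* g :+ Y) :+ (k :* Y :- g) :* (k :* Y :- g) :-
                (A₁ :* ((k :* r₁ :- m₁) :* (k :* r₁ :- m₁) :+ (k :* m₁ :+ r₁) :* (k :* m₁ :+ r₁)) :+ A₂ :* ((k :* r₂ :- m₂) :* (k :* r₂ :- m₂) :+ (k :* m₂ :+ r₂) :* (k :* m₂ :+ r₂)) :+ A₃ :* (k :* k :+ # 1))
                := (k :* k :+ # 1) :* (g :* g :+ Y :* Y :- (A₁ :* (r₁ :* r₁ :+ m₁ :* m₁) :+ A₂ :* (r₂ :* r₂ :+ m₂ :* m₂) :+ A₃))) refl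

      -- This is the norm of yR + xM, which is congruent to −2y²D modulo x² + y².
      norm-W : ∀ ℓ X Z → x * X + y * Z ≡ 1ℤ → + ℓ ∣ x * x + y * y →
        + ℓ ∣ A₁ * (M₁ * M₁) + A₂ * (M₂ * M₂) + A₃ - (x * Z - y * X) * (A₁ * (R₁ * M₁) + A₂ * (R₂ * M₂) - A₃ * k) →
        + ℓ ∣ (k * k + 1ℤ) * (k * k + 1ℤ) * T₀ + A₃ * (((k * k - 1ℤ) * Y - + 2 * k * g) * ((k * k - 1ℤ) * Y - + 2 * k * g))
      norm-W ℓ X Z e dpp dD = subst (+ ℓ ∣_) (lem₁ A₁ A₂ A₃ k g Y r₁ m₁ r₂ m₂)
        (by2 (- (+ 2 * (y * y))) (y * y + m + + 2 * (y * X * ⟨⟩)) (mod2 (- (y * y)) (- (+ 2 * y * x * ⟨⟩)) (lem₂ A₁ A₂ A₃ k x y X Z R₁ M₁ R₂ M₂) norm′ e) dD dpp)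
        where
        m = A₁ * (M₁ * M₁) + A₂ * (M₂ * M₂) + A₃
        ⟨⟩ = A₁ * (R₁ * M₁) + A₂ * (R₂ * M₂) - A₃ * k
        lem₁ : ∀ A₁ A₂ A₃ k g Y r₁ m₁ r₂ m₂ → let x = k * g + Y; y = k * Y - g; R₁ = k * r₁ - m₁; R₂ = k * r₂ - m₂; M₁ = k * m₁ + r₁; M₂ = k * m₂ + r₂ in
          A₁ * ((y * R₁ + x * M₁) * (y * R₁ + x * M₁)) + A₂ * ((y * R₂ + x * M₂) * (y * R₂ + x * M₂)) + A₃ * ((y * k - x) * (y * k - x))
          ≡ (k * k + 1ℤ) * (k * k + 1ℤ) * (A₁ * ((g * m₁ + Y * r₁) * (g * m₁ + Y * r₁)) + A₂ * ((g * m₂ + Y * r₂) * (g * m₂ + Y * r₂)))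
             + A₃ * (((k * k - 1ℤ) * Y - + 2 * k * g) * ((k * k - 1ℤ) * Y - + 2 * k * g))
        lem₁ = ring! 10 (λ A₁ A₂ A₃ k g Y r₁ m₁ r₂ m₂ → let x = k :* g :+ Y; y = k :* Y :- g; R₁ = k :* r₁ :- m₁; R₂ = k :* r₂ :- m₂; M₁ = k :* m₁ :+ r₁; M₂ = k :* m₂ :+ r₂ in
          A₁ :* ((y :* R₁ :+ x :* M₁) :* (y :* R₁ :+ x :* M₁)) :+ A₂ :* ((y :* R₂ :+ x :* M₂) :* (y :* R₂ :+ x :* M₂)) :+ A₃ :* ((y :* k :- x) :* (y :* k :- x))
          := (k :* k :+ # 1) :* (k :* k :+ # 1) :* (A₁ :* ((g :* m₁ :+ Y :* r₁) :* (g :* m₁ :+ Y :* r₁)) :+ A₂ :* ((g :* m₂ :+ Y :* r₂) :* (g :* m₂ :+ Y :* r₂)))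
             :+ A₃ :* (((k :* k :- # 1) :* Y :- # 2 :* k :* g) :* ((k :* k :- # 1) :* Y :- # 2 :* k :* g))) refl
        lem₂ : ∀ A₁ A₂ A₃ k x y X Z R₁ M₁ R₂ M₂ → let m = A₁ * (M₁ * M₁) + A₂ * (M₂ * M₂) + A₃; ⟨⟩ = A₁ * (R₁ * M₁) + A₂ * (R₂ * M₂) - A₃ * k in
          A₁ * ((y * R₁ + x * M₁) * (y * R₁ + x * M₁)) + A₂ * ((y * R₂ + x * M₂) * (y * R₂ + x * M₂)) + A₃ * ((y * k - x) * (y * k - x))
            - (- (+ 2 * (y * y)) * (m - (x * Z - y * X) * ⟨⟩) + (y * y + m + + 2 * (y * X * ⟨⟩)) * (x * x + y * y))
          ≡ - (y * y) * (x * x + y * y - (A₁ * (R₁ * R₁ + M₁ * M₁) + A₂ * (R₂ * R₂ + M₂ * M₂) + A₃ * (k * k + 1ℤ)))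
            + - (+ 2 * y * x * ⟨⟩) * (x * X + y * Z - 1ℤ)
        lem₂ = ring! 12 (λ A₁ A₂ A₃ k x y X Z R₁ M₁ R₂ M₂ → let m = A₁ :* (M₁ :* M₁) :+ A₂ :* (M₂ :* M₂) :+ A₃; ⟨⟩ = A₁ :* (R₁ :* M₁) :+ A₂ :* (R₂ :* M₂) :- A₃ :* k in
          A₁ :* ((y :* R₁ :+ x :* M₁) :* (y :* R₁ :+ x :* M₁)) :+ A₂ :* ((y :* R₂ :+ x :* M₂) :* (y :* R₂ :+ x :* M₂)) :+ A₃ :* ((y :* k :- x) :* (y :* k :- x))
            :- (:- (# 2 :* (y :* y)) :* (m :- (x :* Z :- y :* X) :* ⟨⟩) :+ (y :* y :+ m :+ # 2 :* (y :* X :* ⟨⟩)) :* (x :* x :+ y :* y))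
          := :- (y :* y) :* (x :* x :+ y :* y :- (A₁ :* (R₁ :* R₁ :+ M₁ :* M₁) :+ A₂ :* (R₂ :* R₂ :+ M₂ :* M₂) :+ A₃ :* (k :* k :+ # 1)))
            :+ :- (# 2 :* y :* x :* ⟨⟩) :* (x :* X :+ y :* Z :- # 1)) refl

      x∧y : ∀ ℓ → Prime ℓ → + ℓ ∣ x → ¬ + ℓ ∣ x * x + y * y
      x∧y ℓ pℓ dx d = x∥y ℓ pℓ dx (∣-square pℓ (by2 1ℤ (- x) (lem x y) d dx))
        where lem : ∀ x y → y * y ≡ 1ℤ * (x * x + y * y) + - x * x
              lem = solve-∀

      -- An odd ℓ dividing (x² + y²)A₃ divides p, k² + 1 or A₃. At p the choice of k prevents ℓ from
      -- dividing D. At k² + 1 the norm of yR + xM is A₃(2x)² with ℓ ∤ x, and ℓ ∣ A₃ is impossible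
      -- because k² + 1 would then be 1 or 2 modulo ℓ. At A₃ alone the choice of k keeps the
      -- relevant one of M₁, M₂ prime to ℓ.
      coprime-D′ : ∀ X Z → x * X + y * Z ≡ 1ℤ → ∀ ℓ → Prime ℓ → ℓ ≢ 2 →
        + ℓ ∣ A₁ * (M₁ * M₁) + A₂ * (M₂ * M₂) + A₃ - (x * Z - y * X) * (A₁ * (R₁ * M₁) + A₂ * (R₂ * M₂) - A₃ * k) →
        + ℓ ∣ (x * x + y * y) * (A₁ * M₁) → + ℓ ∣ (x * x + y * y) * (A₂ * M₂) → ¬ + ℓ ∣ (x * x + y * y) * A₃
      coprime-D′ X Z e ℓ pℓ ℓ≢2 dD d₁ d₂ d₃ = by-pp (+ ℓ ∣? x * x + y * y)
        where
        2∤ = odd-prime∤2 pℓ ℓ≢2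
        at-p : + ℓ ∣ p → + ℓ ∣ (k * k + 1ℤ) * (k * k + 1ℤ) * T₀ + A₃ * (((k * k - 1ℤ) * Y - + 2 * k * g) * ((k * k - 1ℤ) * Y - + 2 * k * g)) → Choice k ℓ → ⊥
        at-p dp dW (inj₁ (dk , ¬g)) = not-G-p dp ¬g (by2 1ℤ u (lem A₃ k g Y T₀) dW dk)
          where
          u = - (k * (k * k + + 2) * T₀) - A₃ * ((k * Y - + 2 * g) * (k * k * Y - + 2 * Y - + 2 * k * g))
          lem : ∀ A₃ k g Y T → T + A₃ * (Y * Y) ≡ 1ℤ * ((k * k + 1ℤ) * (k * k + 1ℤ) * T + A₃ * (((k * k - 1ℤ) * Y - + 2 * k * g) * ((k * k - 1ℤ) * Y - + 2 * k * g)))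
             + (- (k * (k * k + + 2) * T) - A₃ * ((k * Y - + 2 * g) * (k * k * Y - + 2 * Y - + 2 * k * g))) * k
          lem = ring! 5 (λ A₃ k g Y T → T :+ A₃ :* (Y :* Y) := # 1 :* ((k :* k :+ # 1) :* (k :* k :+ # 1) :* T :+ A₃ :* (((k :* k :- # 1) :* Y :- # 2 :* k :* g) :* ((k :* k :- # 1) :* Y :- # 2 :* k :* g)))
             :+ (:- (k :* (k :* k :+ # 2) :* T) :- A₃ :* ((k :* Y :- # 2 :* g) :* (k :* k :* Y :- # 2 :* Y :- # 2 :* k :* g))) :* k) refl
        at-p dp dW (inj₂ (dk , gg)) = ∤-* {ℓ} {+ 2 * (+ 2 * + 2)} {A₃ * (Y * Y)} pℓ (∤-* pℓ 2∤ (∤-* pℓ 2∤ 2∤)) (∤-* {ℓ} {A₃} {Y * Y} pℓ (λ d → p∥A₃ ℓ pℓ ℓ≢2 d dp) (∤-* {ℓ} {Y} {Y} pℓ ℓ∤Y ℓ∤Y))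
            (by4 (- 1ℤ) (+ 4) u (+ 4 * A₃) (lem A₃ k g Y T₀) dW (G-p dp gg) dk dp)
          where
          ℓ∤Y : ¬ + ℓ ∣ Y
          ℓ∤Y d = g∧Y pℓ d dp
          u = (k + 1ℤ) * (k * k + + 3) * T₀ + A₃ * (((k + 1ℤ) * Y - + 2 * g) * ((k * k - 1ℤ) * Y - + 2 * (k + 1ℤ) * g))
          lem : ∀ A₃ k g Y T → + 2 * (+ 2 * + 2) * (A₃ * (Y * Y)) ≡ - 1ℤ * ((k * k + 1ℤ) * (k * k + 1ℤ) * T + A₃ * (((k * k - 1ℤ) * Y - + 2 * k * g) * ((k * k - 1ℤ) * Y - + 2 * k * g)))
            + + 4 * (T + A₃ * (Y * Y)) + ((k + 1ℤ) * (k * k + + 3) * T + A₃ * (((k + 1ℤ) * Y - + 2 * g) * ((k * k - 1ℤ) * Y - + 2 * (k + 1ℤ) * g))) * (k - 1ℤ) + + 4 * A₃ * (g * g + Y * Y)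
          lem = ring! 5 (λ A₃ k g Y T → # 2 :* (# 2 :* # 2) :* (A₃ :* (Y :* Y)) := :- # 1 :* ((k :* k :+ # 1) :* (k :* k :+ # 1) :* T :+ A₃ :* (((k :* k :- # 1) :* Y :- # 2 :* k :* g) :* ((k :* k :- # 1) :* Y :- # 2 :* k :* g)))
            :+ # 4 :* (T :+ A₃ :* (Y :* Y)) :+ ((k :+ # 1) :* (k :* k :+ # 3) :* T :+ A₃ :* (((k :+ # 1) :* Y :- # 2 :* g) :* ((k :* k :- # 1) :* Y :- # 2 :* (k :+ # 1) :* g))) :* (k :- # 1) :+ # 4 :* A₃ :* (g :* g :+ Y :* Y)) refl
        at-k : + ℓ ∣ x * x + y * y → + ℓ ∣ k * k + 1ℤ → + ℓ ∣ A₃ ⊎ + ℓ ∣ ((k * k - 1ℤ) * Y - + 2 * k * g) * ((k * k - 1ℤ) * Y - + 2 * k * g) → ⊥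
        at-k dpp dk (inj₁ d) = k²+1-unit pℓ ℓ≢2 k (choice ℓ pℓ ℓ≢2 (∣n⇒∣m*n p d)) dk
        at-k dpp dk (inj₂ d) = ∤-* {ℓ} {+ 2} {x} pℓ 2∤ (λ dx → x∧y ℓ pℓ dx dpp) (by2 (- 1ℤ) Y (lem k g Y) (∣-square {ℓ} {(k * k - 1ℤ) * Y - + 2 * k * g} pℓ d) dk)
          where lem : ∀ k g Y → + 2 * (k * g + Y) ≡ - 1ℤ * ((k * k - 1ℤ) * Y - + 2 * k * g) + Y * (k * k + 1ℤ)
                lem = solve-∀
        split : + ℓ ∣ x * x + y * y → + ℓ ∣ k * k + 1ℤ ⊎ + ℓ ∣ p → ⊥
        split dpp (inj₂ dp) = at-p dp (norm-W ℓ X Z e dpp dD) (choice ℓ pℓ ℓ≢2 (∣m⇒∣m*n A₃ dp))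
        split dpp (inj₁ dk) = at-k dpp dk (euclid {ℓ} {A₃} {w * w} pℓ
            (by2 1ℤ (- ((k * k + 1ℤ) * T₀)) (lem (k * k + 1ℤ) T₀ (A₃ * (w * w))) (norm-W ℓ X Z e dpp dD) dk))
          where
          w = (k * k - 1ℤ) * Y - + 2 * k * g
          lem : ∀ K T z → z ≡ 1ℤ * (K * K * T + z) + - (K * T) * K
          lem = solve-∀
        at-A₃ : ¬ + ℓ ∣ x * x + y * y → + ℓ ∣ A₃ → (+ ℓ ∣ A₁ × ¬ + ℓ ∣ A₂) ⊎ (+ ℓ ∣ A₂ × ¬ + ℓ ∣ A₁) → ⊥
        at-A₃ ∤pp dA₃ c = ∤p (value-divisible dA₃ (by-primes c))
          where
          ∤p : ¬ + ℓ ∣ p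
          ∤p d = p∥A₃ ℓ pℓ ℓ≢2 dA₃ d
          ch = choice ℓ pℓ ℓ≢2 (∣n⇒∣m*n p dA₃)
          strip : ∀ A z → ¬ + ℓ ∣ A → + ℓ ∣ (x * x + y * y) * (A * z) → + ℓ ∣ z
          strip A z ∤A d with + ℓ ∣? z
          ... | yes h = h
          ... | no h = ⊥-elim (∤-* {ℓ} {x * x + y * y} {A * z} pℓ ∤pp (∤-* {ℓ} {A} {z} pℓ ∤A h) d)
          by-primes : (+ ℓ ∣ A₁ × ¬ + ℓ ∣ A₂) ⊎ (+ ℓ ∣ A₂ × ¬ + ℓ ∣ A₁) → (+ ℓ ∣ A₁ × + ℓ ∣ r₂ × + ℓ ∣ m₂) ⊎ (+ ℓ ∣ A₂ × + ℓ ∣ r₁ × + ℓ ∣ m₁)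
          by-primes (inj₁ (dA , ∤A)) = inj₁ (dA , both-divide k r₂ m₂ (λ ¬g d → ¬g (inj₂ (∤p , inj₁ (dA , d)))) (G-1 ∤p dA) ch (strip A₂ M₂ ∤A d₂))
          by-primes (inj₂ (dA , ∤A)) = inj₂ (dA , both-divide k r₁ m₁ (λ ¬g d → ¬g (inj₂ (∤p , inj₂ (∤A , d)))) (G-2 ∤p ∤A) ch (strip A₁ M₁ ∤A d₁))
        off : ¬ + ℓ ∣ x * x + y * y → + ℓ ∣ x * x + y * y ⊎ + ℓ ∣ A₃ → ⊥
        off h (inj₁ d) = h d
        off h (inj₂ d) = at-A₃ h d (primes ℓ pℓ ℓ≢2 d)
        by-pp : Dec (+ ℓ ∣ x * x + y * y) → ⊥
        by-pp (yes d) = split d (euclid {ℓ} {k * k + 1ℤ} {p} pℓ (subst (+ ℓ ∣_) (pp-eq k g Y) d))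
        by-pp (no h) = off h (euclid {ℓ} {x * x + y * y} {A₃} pℓ d₃)

      assemble : (∃₂ λ X Z → x * X + y * Z ≡ 1ℤ × ¬ + 2 ∣ x * Z - y * X) → SliceOf
      assemble (X , Z , e , odd) = record
        { κ = κ ; R₁ = R₁ ; M₁ = M₁ ; R₂ = R₂ ; M₂ = M₂ ; x = x ; y = y ; X = X ; Z = Z
        ; unimodular = e ; norm-eq = norm′ ; pp-odd = pp-odd′ ; c-odd = odd ; coprime-D = coprime-D′ X Z e }
        , (divides (+ 8 * κ * m₁) (lem κ r₁ m₁) , divides (+ 8 * κ * m₂) (lem κ r₂ m₂))
        , (divides (+ 8 * κ * r₁) (lem′ κ r₁ m₁) , divides (+ 8 * κ * r₂) (lem′ κ r₂ m₂))
        where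
        lem : ∀ κ r m → + 16 * κ * m + r - r ≡ + 8 * κ * m * + 2
        lem = solve-∀
        lem′ : ∀ κ r m → + 16 * κ * r - m + m ≡ + 8 * κ * r * + 2
        lem′ = solve-∀

    slice-at : SliceOf
    slice-at = start (coprime x y x∥y)
      where
      start : (∃₂ λ u v → u * x + v * y ≡ 1ℤ) → SliceOf
      start (u , v , e) = assemble (odd-c u v (trans (cong₂ _+_ (ℤ.*-comm x u) (ℤ.*-comm y v)) e))

  slice : SliceOf
  slice = start (select-residues G G? (abs (p * A₃)) (λ e → *-≢0 p≢0 A₃≢0 (ℤ.∣i∣≡0⇒i≡0 e)))
    where
    start : (∃ λ κ → ∀ ℓ → Prime ℓ → ℓ ≢ 2 → + ℓ ∣ + abs (p * A₃) → (+ ℓ ∣ + 16 * κ × ¬ G ℓ) ⊎ (+ ℓ ∣ + 16 * κ - 1ℤ × G ℓ)) → SliceOf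
    start (κ , h) = slice-at κ (λ ℓ pℓ ℓ≢2 d → h ℓ pℓ ℓ≢2 (∣-trans d m∣∣m∣))

-- Lines of representations

-- Equivalently, A + 2B₁i + 2B₂j + 2B₃k is the sum of the squares of the u_t + v_t i + w_t j + z_t k.
record Rep (a b A B₁ B₂ B₃ : ℤ) : Set where
  constructor rep
  field
    u₁ u₂ u₃ v₁ v₂ v₃ w₁ w₂ w₃ z₁ z₂ z₃ : ℤ
    eq₁ : u₁ * v₁ + u₂ * v₂ + u₃ * v₃ ≡ B₁
    eq₂ : u₁ * w₁ + u₂ * w₂ + u₃ * w₃ ≡ B₂
    eq₃ : u₁ * z₁ + u₂ * z₂ + u₃ * z₃ ≡ B₃
    eq₀ : u₁ * u₁ + u₂ * u₂ + u₃ * u₃ - a * (v₁ * v₁ + v₂ * v₂ + v₃ * v₃) - b * (w₁ * w₁ + w₂ * w₂ + w₃ * w₃)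
      - a * b * (z₁ * z₁ + z₂ * z₂ + z₃ * z₃) ≡ A

quat-cong : ∀ {x₀ x₁ x₂ x₃ y₀ y₁ y₂ y₃} → x₀ ≡ y₀ → x₁ ≡ y₁ → x₂ ≡ y₂ → x₃ ≡ y₃ → quat x₀ x₁ x₂ x₃ ≡ quat y₀ y₁ y₂ y₃
quat-cong refl refl refl refl = refl

square : ∀ a b u v w z → powQ a b (quat u v w z) 2 ≡ quat (u * u - a * (v * v) - b * (w * w) - a * b * (z * z)) (+ 2 * (u * v)) (+ 2 * (u * w)) (+ 2 * (u * z))
square a b u v w z = quat-cong (l₀ a b u v w z) (l₁ a b u v w z) (l₂ a b u v w z) (l₃ a b u v w z)
  where
  l₀ : ∀ a b u v w z → let p = u * 1ℤ - a * (v * 0ℤ) - b * (w * 0ℤ) - a * b * (z * 0ℤ); q = u * 0ℤ + v * 1ℤ + b * (w * 0ℤ - z * 0ℤ); r = u * 0ℤ + w * 1ℤ + a * (z * 0ℤ - v * 0ℤ); s = u * 0ℤ + z * 1ℤ + v * 0ℤ - w * 0ℤ in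
    u * p - a * (v * q) - b * (w * r) - a * b * (z * s) ≡ u * u - a * (v * v) - b * (w * w) - a * b * (z * z)
  l₀ = ring! 6 (λ a b u v w z → let p = u :* # 1 :- a :* (v :* # 0) :- b :* (w :* # 0) :- a :* b :* (z :* # 0); q = u :* # 0 :+ v :* # 1 :+ b :* (w :* # 0 :- z :* # 0); r = u :* # 0 :+ w :* # 1 :+ a :* (z :* # 0 :- v :* # 0); s = u :* # 0 :+ z :* # 1 :+ v :* # 0 :- w :* # 0 in
    u :* p :- a :* (v :* q) :- b :* (w :* r) :- a :* b :* (z :* s) := u :* u :- a :* (v :* v) :- b :* (w :* w) :- a :* b :* (z :* z)) refl
  l₁ : ∀ a b u v w z → let p = u * 1ℤ - a * (v * 0ℤ) - b * (w * 0ℤ) - a * b * (z * 0ℤ); q = u * 0ℤ + v * 1ℤ + b * (w * 0ℤ - z * 0ℤ); r = u * 0ℤ + w * 1ℤ + a * (z * 0ℤ - v * 0ℤ); s = u * 0ℤ + z * 1ℤ + v * 0ℤ - w * 0ℤ in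
    u * q + v * p + b * (w * s - z * r) ≡ + 2 * (u * v)
  l₁ = ring! 6 (λ a b u v w z → let p = u :* # 1 :- a :* (v :* # 0) :- b :* (w :* # 0) :- a :* b :* (z :* # 0); q = u :* # 0 :+ v :* # 1 :+ b :* (w :* # 0 :- z :* # 0); r = u :* # 0 :+ w :* # 1 :+ a :* (z :* # 0 :- v :* # 0); s = u :* # 0 :+ z :* # 1 :+ v :* # 0 :- w :* # 0 in
    u :* q :+ v :* p :+ b :* (w :* s :- z :* r) := # 2 :* (u :* v)) refl
  l₂ : ∀ a b u v w z → let p = u * 1ℤ - a * (v * 0ℤ) - b * (w * 0ℤ) - a * b * (z * 0ℤ); q = u * 0ℤ + v * 1ℤ + b * (w * 0ℤ - z * 0ℤ); r = u * 0ℤ + w * 1ℤ + a * (z * 0ℤ - v * 0ℤ); s = u * 0ℤ + z * 1ℤ + v * 0ℤ - w * 0ℤ in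
    u * r + w * p + a * (z * q - v * s) ≡ + 2 * (u * w)
  l₂ = ring! 6 (λ a b u v w z → let p = u :* # 1 :- a :* (v :* # 0) :- b :* (w :* # 0) :- a :* b :* (z :* # 0); q = u :* # 0 :+ v :* # 1 :+ b :* (w :* # 0 :- z :* # 0); r = u :* # 0 :+ w :* # 1 :+ a :* (z :* # 0 :- v :* # 0); s = u :* # 0 :+ z :* # 1 :+ v :* # 0 :- w :* # 0 in
    u :* r :+ w :* p :+ a :* (z :* q :- v :* s) := # 2 :* (u :* w)) refl
  l₃ : ∀ a b u v w z → let p = u * 1ℤ - a * (v * 0ℤ) - b * (w * 0ℤ) - a * b * (z * 0ℤ); q = u * 0ℤ + v * 1ℤ + b * (w * 0ℤ - z * 0ℤ); r = u * 0ℤ + w * 1ℤ + a * (z * 0ℤ - v * 0ℤ); s = u * 0ℤ + z * 1ℤ + v * 0ℤ - w * 0ℤ in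
    u * s + z * p + v * r - w * q ≡ + 2 * (u * z)
  l₃ = ring! 6 (λ a b u v w z → let p = u :* # 1 :- a :* (v :* # 0) :- b :* (w :* # 0) :- a :* b :* (z :* # 0); q = u :* # 0 :+ v :* # 1 :+ b :* (w :* # 0 :- z :* # 0); r = u :* # 0 :+ w :* # 1 :+ a :* (z :* # 0 :- v :* # 0); s = u :* # 0 :+ z :* # 1 :+ v :* # 0 :- w :* # 0 in
    u :* s :+ z :* p :+ v :* r :- w :* q := # 2 :* (u :* z)) refl

rep⇒sum : ∀ {a b A B₁ B₂ B₃} → Rep a b A B₁ B₂ B₃ → SumOfAtMost a b 2 3 (quat A (+ 2 * B₁) (+ 2 * B₂) (+ 2 * B₃))
rep⇒sum {a} {b} (rep u₁ u₂ u₃ v₁ v₂ v₃ w₁ w₂ w₃ z₁ z₂ z₃ e₁ e₂ e₃ e₀) =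
  quat u₁ v₁ w₁ z₁ ∷ quat u₂ v₂ w₂ z₂ ∷ quat u₃ v₃ w₃ z₃ ∷ [] , ℕ.≤-refl ,
  trans (cong₂ addQ (square a b u₁ v₁ w₁ z₁) (cong₂ addQ (square a b u₂ v₂ w₂ z₂) (cong (λ q → addQ q zeroQ) (square a b u₃ v₃ w₃ z₃))))
    (quat-cong (trans (l₀ a b (a * b) u₁ u₂ u₃ v₁ v₂ v₃ w₁ w₂ w₃ z₁ z₂ z₃) e₀) (trans (l₁ u₁ u₂ u₃ v₁ v₂ v₃) (cong (+ 2 *_) e₁))
       (trans (l₁ u₁ u₂ u₃ w₁ w₂ w₃) (cong (+ 2 *_) e₂)) (trans (l₁ u₁ u₂ u₃ z₁ z₂ z₃) (cong (+ 2 *_) e₃)))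
  where
  l₁ : ∀ u₁ u₂ u₃ v₁ v₂ v₃ → + 2 * (u₁ * v₁) + (+ 2 * (u₂ * v₂) + (+ 2 * (u₃ * v₃) + 0ℤ)) ≡ + 2 * (u₁ * v₁ + u₂ * v₂ + u₃ * v₃)
  l₁ = ring! 6 (λ u₁ u₂ u₃ v₁ v₂ v₃ → # 2 :* (u₁ :* v₁) :+ (# 2 :* (u₂ :* v₂) :+ (# 2 :* (u₃ :* v₃) :+ # 0)) := # 2 :* (u₁ :* v₁ :+ u₂ :* v₂ :+ u₃ :* v₃)) refl
  l₀ : ∀ a b d u₁ u₂ u₃ v₁ v₂ v₃ w₁ w₂ w₃ z₁ z₂ z₃ → u₁ * u₁ - a * (v₁ * v₁) - b * (w₁ * w₁) - d * (z₁ * z₁) + (u₂ * u₂ - a * (v₂ * v₂) - b * (w₂ * w₂) - d * (z₂ * z₂)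
    + (u₃ * u₃ - a * (v₃ * v₃) - b * (w₃ * w₃) - d * (z₃ * z₃) + 0ℤ)) ≡ u₁ * u₁ + u₂ * u₂ + u₃ * u₃ - a * (v₁ * v₁ + v₂ * v₂ + v₃ * v₃) - b * (w₁ * w₁ + w₂ * w₂ + w₃ * w₃)
      - d * (z₁ * z₁ + z₂ * z₂ + z₃ * z₃)
  l₀ = ring! 15 (λ a b d u₁ u₂ u₃ v₁ v₂ v₃ w₁ w₂ w₃ z₁ z₂ z₃ → u₁ :* u₁ :- a :* (v₁ :* v₁) :- b :* (w₁ :* w₁) :- d :* (z₁ :* z₁) :+ (u₂ :* u₂ :- a :* (v₂ :* v₂) :- b :* (w₂ :* w₂) :- d :* (z₂ :* z₂)
    :+ (u₃ :* u₃ :- a :* (v₃ :* v₃) :- b :* (w₃ :* w₃) :- d :* (z₃ :* z₃) :+ # 0)) := u₁ :* u₁ :+ u₂ :* u₂ :+ u₃ :* u₃ :- a :* (v₁ :* v₁ :+ v₂ :* v₂ :+ v₃ :* v₃) :- b :* (w₁ :* w₁ :+ w₂ :* w₂ :+ w₃ :* w₃)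
      :- d :* (z₁ :* z₁ :+ z₂ :* z₂ :+ z₃ :* z₃)) refl

swap-rep : ∀ {a b A B₁ B₂ B₃} → Rep a b A B₁ B₂ B₃ → Rep b a A B₂ B₁ B₃
swap-rep {a} {b} (rep u₁ u₂ u₃ v₁ v₂ v₃ w₁ w₂ w₃ z₁ z₂ z₃ e₁ e₂ e₃ e₀) =
  rep u₁ u₂ u₃ w₁ w₂ w₃ v₁ v₂ v₃ z₁ z₂ z₃ e₂ e₁ e₃
    (trans (lem a b (u₁ * u₁ + u₂ * u₂ + u₃ * u₃) (v₁ * v₁ + v₂ * v₂ + v₃ * v₃) (w₁ * w₁ + w₂ * w₂ + w₃ * w₃) (z₁ * z₁ + z₂ * z₂ + z₃ * z₃)) e₀)
  where lem : ∀ a b u v w z → u - b * w - a * v - b * a * z ≡ u - a * v - b * w - a * b * z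
        lem = solve-∀

-- For fixed R, M the representations with u = (t + q(x² + y²)τ, x, y) have first coordinate A₀ + 2τL, affine in τ.
module SliceRep (a b x y X Z q R₁ R₂ R₃ M₁ M₂ M₃ B₁ B₂ B₃ : ℤ) where
  pp = x * x + y * y
  c = x * Z - y * X
  e = X * X + Z * Z

  D : ℤ
  D = q * (pp - (a * (R₁ * R₁) + b * (R₂ * R₂) + a * b * (R₃ * R₃))) - c * (a * (R₁ * M₁) + b * (R₂ * M₂) + a * b * (R₃ * M₃))

  ⟨B,qR+cM⟩ : ℤ
  ⟨B,qR+cM⟩ = a * (B₁ * (q * R₁ + c * M₁)) + b * (B₂ * (q * R₂ + c * M₂)) + a * b * (B₃ * (q * R₃ + c * M₃))

  L : (t k₁ k₂ k₃ : ℤ) → ℤ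
  L t k₁ k₂ k₃ = t * D - ⟨B,qR+cM⟩ - pp * (a * (k₁ * M₁) + b * (k₂ * M₂) + a * b * (k₃ * M₃))

  A₀ : (t k₁ k₂ k₃ : ℤ) → ℤ
  A₀ t k₁ k₂ k₃ = let V₁ = B₁ + t * R₁; V₂ = B₂ + t * R₂; V₃ = B₃ + t * R₃ in
    t * t + pp - (a * (R₁ * R₁) + b * (R₂ * R₂) + a * b * (R₃ * R₃)) - e * (a * (V₁ * V₁) + b * (V₂ * V₂) + a * b * (V₃ * V₃))
      - + 2 * c * (a * (V₁ * k₁) + b * (V₂ * k₂) + a * b * (V₃ * k₃)) - pp * (a * (k₁ * k₁) + b * (k₂ * k₂) + a * b * (k₃ * k₃))

  module _ (unimodular : x * X + y * Z ≡ 1ℤ)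
    (norm-M : a * (M₁ * M₁) + b * (M₂ * M₂) + a * b * (M₃ * M₃) ≡ q * q * (pp - (a * (R₁ * R₁) + b * (R₂ * R₂) + a * b * (R₃ * R₃)))) where

    private
      -- The solutions of (x, y) · w = V are V(X, Z) + k(-y, x). When t grows by q(x² + y²)τ, the
      -- summand τqR(x, y) accounts for the growth of V, and τM(-y, x) is a free motion orthogonal
      -- to (x, y).
      inner : ∀ t τ R M k B → let V = B + t * R in
        (t + q * pp * τ) * - R + x * (V * X - k * y + τ * (q * R * x - M * y)) + y * (V * Z + k * x + τ * (q * R * y + M * x)) ≡ B
      inner t τ R M k B = mod1 (B + t * R) (lem x y X Z q t τ R M k B) unimodular
        where lem : ∀ x y X Z q t τ R M k B → let V = B + t * R in
                (t + q * (x * x + y * y) * τ) * - R + x * (V * X - k * y + τ * (q * R * x - M * y)) + y * (V * Z + k * x + τ * (q * R * y + M * x)) - B ≡ (B + t * R) * (x * X + y * Z - 1ℤ)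
              lem = ring! 11 (λ x y X Z q t τ R M k B → let V = B :+ t :* R in
                (t :+ q :* (x :* x :+ y :* y) :* τ) :* :- R :+ x :* (V :* X :- k :* y :+ τ :* (q :* R :* x :- M :* y)) :+ y :* (V :* Z :+ k :* x :+ τ :* (q :* R :* y :+ M :* x)) :- B := (B :+ t :* R) :* (x :* X :+ y :* Z :- # 1)) refl

      length-sq : ∀ τ R M k V → let v₂ = V * X - k * y + τ * (q * R * x - M * y); v₃ = V * Z + k * x + τ * (q * R * y + M * x) in
        - R * - R + v₂ * v₂ + v₃ * v₃ ≡ R * R + e * (V * V) + + 2 * c * (V * k) + pp * (k * k) + + 2 * τ * (V * (q * R + c * M) + pp * (k * M)) + τ * τ * pp * (q * q * (R * R) + M * M)
      length-sq τ R M k V = mod1 (+ 2 * τ * V * q * R) (lem x y X Z q τ R M k V) unimodular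
        where lem : ∀ x y X Z q τ R M k V → let v₂ = V * X - k * y + τ * (q * R * x - M * y); v₃ = V * Z + k * x + τ * (q * R * y + M * x); pp = x * x + y * y; c = x * Z - y * X; e = X * X + Z * Z in
                - R * - R + v₂ * v₂ + v₃ * v₃ - (R * R + e * (V * V) + + 2 * c * (V * k) + pp * (k * k) + + 2 * τ * (V * (q * R + c * M) + pp * (k * M)) + τ * τ * pp * (q * q * (R * R) + M * M))
                ≡ + 2 * τ * V * q * R * (x * X + y * Z - 1ℤ)
              lem = ring! 10 (λ x y X Z q τ R M k V → let v₂ = V :* X :- k :* y :+ τ :* (q :* R :* x :- M :* y); v₃ = V :* Z :+ k :* x :+ τ :* (q :* R :* y :+ M :* x); pp = x :* x :+ y :* y; c = x :* Z :- y :* X; e = X :* X :+ Z :* Z in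
                :- R :* :- R :+ v₂ :* v₂ :+ v₃ :* v₃ :- (R :* R :+ e :* (V :* V) :+ # 2 :* c :* (V :* k) :+ pp :* (k :* k) :+ # 2 :* τ :* (V :* (q :* R :+ c :* M) :+ pp :* (k :* M)) :+ τ :* τ :* pp :* (q :* q :* (R :* R) :+ M :* M))
                := # 2 :* τ :* V :* q :* R :* (x :* X :+ y :* Z :- # 1)) refl

      -- The coefficient of τ² is (x² + y²)(q²(x² + y² - N(R)) - N(M)), which `norm-M` makes zero;
      -- this is the purpose of M.
      total : ∀ t τ k₁ k₂ k₃ → let
          S = λ R M k B → R * R + e * ((B + t * R) * (B + t * R)) + + 2 * c * ((B + t * R) * k) + pp * (k * k) + + 2 * τ * ((B + t * R) * (q * R + c * M) + pp * (k * M)) + τ * τ * pp * (q * q * (R * R) + M * M) in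
        (t + q * pp * τ) * (t + q * pp * τ) + x * x + y * y - a * S R₁ M₁ k₁ B₁ - b * S R₂ M₂ k₂ B₂ - a * b * S R₃ M₃ k₃ B₃ ≡ A₀ t k₁ k₂ k₃ + + 2 * τ * L t k₁ k₂ k₃
      total t τ k₁ k₂ k₃ = mod1 (- (τ * τ * pp)) (lem a b x y c e q R₁ R₂ R₃ M₁ M₂ M₃ B₁ B₂ B₃ t τ k₁ k₂ k₃) norm-M
        where lem : ∀ a b x y c e q R₁ R₂ R₃ M₁ M₂ M₃ B₁ B₂ B₃ t τ k₁ k₂ k₃ → let
                      pp = x * x + y * y
                      V₁ = B₁ + t * R₁; V₂ = B₂ + t * R₂; V₃ = B₃ + t * R₃
                      S₁ = R₁ * R₁ + e * (V₁ * V₁) + + 2 * c * (V₁ * k₁) + pp * (k₁ * k₁) + + 2 * τ * (V₁ * (q * R₁ + c * M₁) + pp * (k₁ * M₁)) + τ * τ * pp * (q * q * (R₁ * R₁) + M₁ * M₁)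
                      S₂ = R₂ * R₂ + e * (V₂ * V₂) + + 2 * c * (V₂ * k₂) + pp * (k₂ * k₂) + + 2 * τ * (V₂ * (q * R₂ + c * M₂) + pp * (k₂ * M₂)) + τ * τ * pp * (q * q * (R₂ * R₂) + M₂ * M₂)
                      S₃ = R₃ * R₃ + e * (V₃ * V₃) + + 2 * c * (V₃ * k₃) + pp * (k₃ * k₃) + + 2 * τ * (V₃ * (q * R₃ + c * M₃) + pp * (k₃ * M₃)) + τ * τ * pp * (q * q * (R₃ * R₃) + M₃ * M₃)
                      N = a * (R₁ * R₁) + b * (R₂ * R₂) + a * b * (R₃ * R₃) in
                   (t + q * pp * τ) * (t + q * pp * τ) + x * x + y * y - a * S₁ - b * S₂ - a * b * S₃
                   - (t * t + pp - N - e * (a * (V₁ * V₁) + b * (V₂ * V₂) + a * b * (V₃ * V₃))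
                       - + 2 * c * (a * (V₁ * k₁) + b * (V₂ * k₂) + a * b * (V₃ * k₃)) - pp * (a * (k₁ * k₁) + b * (k₂ * k₂) + a * b * (k₃ * k₃))
                      + + 2 * τ * (t * (q * (pp - N) - c * (a * (R₁ * M₁) + b * (R₂ * M₂) + a * b * (R₃ * M₃)))
                         - (a * (B₁ * (q * R₁ + c * M₁)) + b * (B₂ * (q * R₂ + c * M₂)) + a * b * (B₃ * (q * R₃ + c * M₃)))
                         - pp * (a * (k₁ * M₁) + b * (k₂ * M₂) + a * b * (k₃ * M₃))))
                   ≡ - (τ * τ * pp) * (a * (M₁ * M₁) + b * (M₂ * M₂) + a * b * (M₃ * M₃) - q * q * (pp - N))
              lem = ring! 21 (λ a b x y c e q R₁ R₂ R₃ M₁ M₂ M₃ B₁ B₂ B₃ t τ k₁ k₂ k₃ → let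
                      pp = x :* x :+ y :* y
                      V₁ = B₁ :+ t :* R₁; V₂ = B₂ :+ t :* R₂; V₃ = B₃ :+ t :* R₃
                      S₁ = R₁ :* R₁ :+ e :* (V₁ :* V₁) :+ # 2 :* c :* (V₁ :* k₁) :+ pp :* (k₁ :* k₁) :+ # 2 :* τ :* (V₁ :* (q :* R₁ :+ c :* M₁) :+ pp :* (k₁ :* M₁)) :+ τ :* τ :* pp :* (q :* q :* (R₁ :* R₁) :+ M₁ :* M₁)
                      S₂ = R₂ :* R₂ :+ e :* (V₂ :* V₂) :+ # 2 :* c :* (V₂ :* k₂) :+ pp :* (k₂ :* k₂) :+ # 2 :* τ :* (V₂ :* (q :* R₂ :+ c :* M₂) :+ pp :* (k₂ :* M₂)) :+ τ :* τ :* pp :* (q :* q :* (R₂ :* R₂) :+ M₂ :* M₂)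
                      S₃ = R₃ :* R₃ :+ e :* (V₃ :* V₃) :+ # 2 :* c :* (V₃ :* k₃) :+ pp :* (k₃ :* k₃) :+ # 2 :* τ :* (V₃ :* (q :* R₃ :+ c :* M₃) :+ pp :* (k₃ :* M₃)) :+ τ :* τ :* pp :* (q :* q :* (R₃ :* R₃) :+ M₃ :* M₃)
                      N = a :* (R₁ :* R₁) :+ b :* (R₂ :* R₂) :+ a :* b :* (R₃ :* R₃) in
                   (t :+ q :* pp :* τ) :* (t :+ q :* pp :* τ) :+ x :* x :+ y :* y :- a :* S₁ :- b :* S₂ :- a :* b :* S₃
                   :- (t :* t :+ pp :- N :- e :* (a :* (V₁ :* V₁) :+ b :* (V₂ :* V₂) :+ a :* b :* (V₃ :* V₃))
                       :- # 2 :* c :* (a :* (V₁ :* k₁) :+ b :* (V₂ :* k₂) :+ a :* b :* (V₃ :* k₃)) :- pp :* (a :* (k₁ :* k₁) :+ b :* (k₂ :* k₂) :+ a :* b :* (k₃ :* k₃))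
                      :+ # 2 :* τ :* (t :* (q :* (pp :- N) :- c :* (a :* (R₁ :* M₁) :+ b :* (R₂ :* M₂) :+ a :* b :* (R₃ :* M₃)))
                         :- (a :* (B₁ :* (q :* R₁ :+ c :* M₁)) :+ b :* (B₂ :* (q :* R₂ :+ c :* M₂)) :+ a :* b :* (B₃ :* (q :* R₃ :+ c :* M₃)))
                         :- pp :* (a :* (k₁ :* M₁) :+ b :* (k₂ :* M₂) :+ a :* b :* (k₃ :* M₃))))
                   := :- (τ :* τ :* pp) :* (a :* (M₁ :* M₁) :+ b :* (M₂ :* M₂) :+ a :* b :* (M₃ :* M₃) :- q :* q :* (pp :- N))) refl

    slice-rep : ∀ {A} t k₁ k₂ k₃ τ → A ≡ A₀ t k₁ k₂ k₃ + + 2 * τ * L t k₁ k₂ k₃ → Rep a b A B₁ B₂ B₃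
    slice-rep t k₁ k₂ k₃ τ eA = rep (t + q * pp * τ) x y
      (- R₁) (V₁ * X - k₁ * y + τ * (q * R₁ * x - M₁ * y)) (V₁ * Z + k₁ * x + τ * (q * R₁ * y + M₁ * x))
      (- R₂) (V₂ * X - k₂ * y + τ * (q * R₂ * x - M₂ * y)) (V₂ * Z + k₂ * x + τ * (q * R₂ * y + M₂ * x))
      (- R₃) (V₃ * X - k₃ * y + τ * (q * R₃ * x - M₃ * y)) (V₃ * Z + k₃ * x + τ * (q * R₃ * y + M₃ * x))
      (inner t τ R₁ M₁ k₁ B₁) (inner t τ R₂ M₂ k₂ B₂) (inner t τ R₃ M₃ k₃ B₃)
      (trans (combine ((t + q * pp * τ) * (t + q * pp * τ) + x * x + y * y) (length-sq τ R₁ M₁ k₁ V₁) (length-sq τ R₂ M₂ k₂ V₂) (length-sq τ R₃ M₃ k₃ V₃))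
        (trans (total t τ k₁ k₂ k₃) (sym eA)))
      where
      V₁ = B₁ + t * R₁
      V₂ = B₂ + t * R₂
      V₃ = B₃ + t * R₃
      combine : ∀ {s₁ s₂ s₃ s₁′ s₂′ s₃′} w → s₁ ≡ s₁′ → s₂ ≡ s₂′ → s₃ ≡ s₃′ → w - a * s₁ - b * s₂ - a * b * s₃ ≡ w - a * s₁′ - b * s₂′ - a * b * s₃′
      combine w refl refl refl = refl

-- Congruences

infix 4 _≈_[_]
-- A record and not a synonym for divisibility of x - y, so that unification recovers x and y from
-- the type and congruences can be combined without naming their sides.
record _≈_[_] (x y d : ℤ) : Set where
  constructor ≈-by
  field diff : d ∣ x - y
open _≈_[_]

infixl 6 _≈+_ _≈-_
infixl 7 _≈*_

≈-≡ : ∀ {x y d} → x ≡ y → x ≈ y [ d ]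
≈-≡ {x} {d = d} refl = ≈-by (divides 0ℤ (ℤ.+-inverseʳ x))

≡≈ : ∀ x {d} → x ≈ x [ d ]
≡≈ x = ≈-≡ refl

≈-sym : ∀ {x y d} → x ≈ y [ d ] → y ≈ x [ d ]
≈-sym {x} {y} (≈-by h) = ≈-by (by1 (- 1ℤ) (lem x y) h)
  where lem : ∀ x y → y - x ≡ - 1ℤ * (x - y)
        lem = solve-∀

≈-trans : ∀ {x y z d} → x ≈ y [ d ] → y ≈ z [ d ] → x ≈ z [ d ]
≈-trans {x} {y} {z} (≈-by h) (≈-by k) = ≈-by (by2 1ℤ 1ℤ (lem x y z) h k)
  where lem : ∀ x y z → x - z ≡ 1ℤ * (x - y) + 1ℤ * (y - z)
        lem = solve-∀

_≈+_ : ∀ {x y z w d} → x ≈ y [ d ] → z ≈ w [ d ] → x + z ≈ y + w [ d ]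
_≈+_ {x} {y} {z} {w} (≈-by h) (≈-by k) = ≈-by (by2 1ℤ 1ℤ (lem x y z w) h k)
  where lem : ∀ x y z w → x + z - (y + w) ≡ 1ℤ * (x - y) + 1ℤ * (z - w)
        lem = solve-∀

_≈-_ : ∀ {x y z w d} → x ≈ y [ d ] → z ≈ w [ d ] → x - z ≈ y - w [ d ]
_≈-_ {x} {y} {z} {w} (≈-by h) (≈-by k) = ≈-by (by2 1ℤ (- 1ℤ) (lem x y z w) h k)
  where lem : ∀ x y z w → x - z - (y - w) ≡ 1ℤ * (x - y) + - 1ℤ * (z - w)
        lem = solve-∀

_≈*_ : ∀ {x y z w d} → x ≈ y [ d ] → z ≈ w [ d ] → x * z ≈ y * w [ d ]
_≈*_ {x} {y} {z} {w} (≈-by h) (≈-by k) = ≈-by (by2 z y (lem x y z w) h k)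
  where lem : ∀ x y z w → x * z - y * w ≡ z * (x - y) + y * (z - w)
        lem = solve-∀

≈-scale : ∀ {x y d} m → x ≈ y [ d ] → m * x ≈ m * y [ m * d ]
≈-scale {x} {y} {d} m (≈-by (divides q e)) = ≈-by (divides q (trans (lem m x y) (trans (cong (m *_) e) (lem′ m q d))))
  where lem : ∀ m x y → m * x - m * y ≡ m * (x - y)
        lem = solve-∀
        lem′ : ∀ m q d → m * (q * d) ≡ q * (m * d)
        lem′ = solve-∀

≈-weaken : ∀ {x y d d′} → d′ ∣ d → x ≈ y [ d ] → x ≈ y [ d′ ]
≈-weaken h (≈-by k) = ≈-by (∣-trans h k)

≈0 : ∀ {x d} → d ∣ x → x ≈ 0ℤ [ d ]
≈0 {x} {d} h = ≈-by (subst (d ∣_) (sym (ℤ.+-identityʳ x)) h)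

∣-of : ∀ {x d} → x ≈ 0ℤ [ d ] → d ∣ x
∣-of {x} {d} (≈-by h) = subst (d ∣_) (ℤ.+-identityʳ x) h

≈1 : ∀ {x} → ¬ + 2 ∣ x → x ≈ 1ℤ [ + 2 ]
≈1 {x} h = let k , e = odd-half h in ≈-by (divides k (trans (cong (_- 1ℤ) e) (lem k)))
  where lem : ∀ k → 1ℤ + k * + 2 - 1ℤ ≡ k * + 2
        lem = solve-∀

square≈ : ∀ x → x * x ≈ x [ + 2 ]
square≈ x = go (+ 2 ∣? x)
  where
  go : Dec (+ 2 ∣ x) → x * x ≈ x [ + 2 ]
  go (yes h) = ≈-trans (≈0 h ≈* ≈0 h) (≈-sym (≈0 h))
  go (no h) = ≈-trans (≈1 h ≈* ≈1 h) (≈-sym (≈1 h))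

square≈4 : ∀ {x y} → x ≈ y [ + 2 ] → x * x ≈ y * y [ + 4 ]
square≈4 {x} {y} (≈-by (divides q e)) = ≈-by (divides (q * (q + y)) (mod1 (x + y + q * + 2) (lem x y q) e))
  where lem : ∀ x y q → x * x - y * y - q * (q + y) * + 4 ≡ (x + y + q * + 2) * (x - y - q * + 2)
        lem = solve-∀

parity : ∀ x y → x ≈ y [ + 2 ] ⊎ x ≈ y + 1ℤ [ + 2 ]
parity x y = go (+ 2 ∣? x - y)
  where
  lem : ∀ x y → x - y - 1ℤ ≡ x - (y + 1ℤ)
  lem = solve-∀
  go : Dec (+ 2 ∣ x - y) → x ≈ y [ + 2 ] ⊎ x ≈ y + 1ℤ [ + 2 ]
  go (yes h) = inj₁ (≈-by h)
  go (no h) = inj₂ (≈-by (subst (+ 2 ∣_) (lem x y) (diff (≈1 h))))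

lift-mod : ∀ {x y} d → x ≈ y [ d ] → x ≈ y [ + 2 * d ] ⊎ x ≈ y + d [ + 2 * d ]
lift-mod {x} {y} d (≈-by (divides q e)) = go (parity q 0ℤ)
  where
  lem : ∀ x y d q h → x - y - h * (+ 2 * d) ≡ 1ℤ * (x - y - q * d) + d * (q - 0ℤ - h * + 2)
  lem = solve-∀
  lem′ : ∀ x y d q h → x - (y + d) - h * (+ 2 * d) ≡ 1ℤ * (x - y - q * d) + d * (q - (0ℤ + 1ℤ) - h * + 2)
  lem′ = solve-∀
  go : q ≈ 0ℤ [ + 2 ] ⊎ q ≈ 0ℤ + 1ℤ [ + 2 ] → x ≈ y [ + 2 * d ] ⊎ x ≈ y + d [ + 2 * d ]
  go (inj₁ (≈-by (divides h e′))) = inj₁ (≈-by (divides h (mod2 1ℤ d (lem x y d q h) e e′)))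
  go (inj₂ (≈-by (divides h e′))) = inj₂ (≈-by (divides h (mod2 1ℤ d (lem′ x y d q h) e e′)))

module _ (x y X Z : ℤ) (unimodular : x * X + y * Z ≡ 1ℤ) (pp-odd : ¬ + 2 ∣ x * x + y * y) (c-odd : ¬ + 2 ∣ x * Z - y * X) where
  -- From (x² + y²)(X² + Z²) = c² + 1.
  half-e : ∃ λ e′ → X * X + Z * Z ≡ e′ * + 2 × e′ ≈ 1ℤ [ + 2 ]
  half-e = go (odd-half c-odd)
    where
    go : (∃ λ h → x * Z - y * X ≡ 1ℤ + h * + 2) → ∃ λ e′ → X * X + Z * Z ≡ e′ * + 2 × e′ ≈ 1ℤ [ + 2 ]
    go (h , eh) = even (euclid {2} {x * x + y * y} {X * X + Z * Z} prime[2] (divides (1ℤ + + 2 * h + + 2 * (h * h)) prod))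
      where
      prod : (x * x + y * y) * (X * X + Z * Z) ≡ (1ℤ + + 2 * h + + 2 * (h * h)) * + 2
      prod = mod2 (x * Z - y * X + (1ℤ + h * + 2)) (x * X + y * Z + 1ℤ) (lem x y X Z h) eh unimodular
        where lem : ∀ x y X Z h → (x * x + y * y) * (X * X + Z * Z) - (1ℤ + + 2 * h + + 2 * (h * h)) * + 2
                      ≡ (x * Z - y * X + (1ℤ + h * + 2)) * (x * Z - y * X - (1ℤ + h * + 2)) + (x * X + y * Z + 1ℤ) * (x * X + y * Z - 1ℤ)
              lem = ring! 5 (λ x y X Z h → (x :* x :+ y :* y) :* (X :* X :+ Z :* Z) :- (# 1 :+ # 2 :* h :+ # 2 :* (h :* h)) :* # 2
                      := (x :* Z :- y :* X :+ (# 1 :+ h :* # 2)) :* (x :* Z :- y :* X :- (# 1 :+ h :* # 2)) :+ (x :* X :+ y :* Z :+ # 1) :* (x :* X :+ y :* Z :- # 1)) refl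
      even : + 2 ∣ x * x + y * y ⊎ + 2 ∣ X * X + Z * Z → ∃ λ e′ → X * X + Z * Z ≡ e′ * + 2 × e′ ≈ 1ℤ [ + 2 ]
      even (inj₁ d) = ⊥-elim (pp-odd d)
      even (inj₂ (divides e′ ee)) = e′ , ee , ≈1 (λ d → 2∤1 (by2 (x * x + y * y) (- (h + h * h))
          (cancelˡ {+ 2} (λ ()) (mod2 (- 1ℤ) (x * x + y * y) (lem (x * x + y * y) (X * X + Z * Z) e′ h) prod ee)) d ∣-refl))
        where lem : ∀ p e e′ h → + 2 * 1ℤ - + 2 * (p * e′ + - (h + h * h) * + 2) ≡ - 1ℤ * (p * e - (1ℤ + + 2 * h + + 2 * (h * h)) * + 2) + p * (e - e′ * + 2)
              lem = ring! 4 (λ p e e′ h → # 2 :* # 1 :- # 2 :* (p :* e′ :+ :- (h :+ h :* h) :* # 2) := :- # 1 :* (p :* e :- (# 1 :+ # 2 :* h :+ # 2 :* (h :* h)) :* # 2) :+ p :* (e :- e′ :* # 2)) refl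

sum-of-squares≈1 : ∀ x y → ¬ + 2 ∣ x * x + y * y → x * x + y * y ≈ 1ℤ [ + 4 ]
sum-of-squares≈1 x y h = go (parity x 0ℤ) (parity y 0ℤ)
  where
  go : x ≈ 0ℤ [ + 2 ] ⊎ x ≈ 0ℤ + 1ℤ [ + 2 ] → y ≈ 0ℤ [ + 2 ] ⊎ y ≈ 0ℤ + 1ℤ [ + 2 ] → x * x + y * y ≈ 1ℤ [ + 4 ]
  go (inj₁ p) (inj₁ q) = ⊥-elim (h (∣-of (p ≈* p ≈+ q ≈* q)))
  go (inj₂ p) (inj₂ q) = ⊥-elim (h (∣-of (≈-trans (p ≈* p ≈+ q ≈* q) (≈0 (divides 1ℤ refl)))))
  go (inj₁ p) (inj₂ q) = square≈4 p ≈+ square≈4 q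
  go (inj₂ p) (inj₁ q) = square≈4 p ≈+ square≈4 q

module SliceRepMod (a b x y X Z q R₁ R₂ R₃ M₁ M₂ M₃ B₁ B₂ B₃ : ℤ) where
  open SliceRep a b x y X Z q R₁ R₂ R₃ M₁ M₂ M₃ B₁ B₂ B₃

  A₀-cong : ∀ {d t t′ k₁ k₁′ k₂ k₂′ k₃ k₃′} → t ≈ t′ [ d ] → k₁ ≈ k₁′ [ d ] → k₂ ≈ k₂′ [ d ] → k₃ ≈ k₃′ [ d ] →
    A₀ t k₁ k₂ k₃ ≈ A₀ t′ k₁′ k₂′ k₃′ [ d ]
  A₀-cong t k₁ k₂ k₃ = t ≈* t ≈+ ≡≈ pp ≈- ≡≈ (a * (R₁ * R₁) + b * (R₂ * R₂) + a * b * (R₃ * R₃))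
      ≈- ≡≈ e ≈* (≡≈ a ≈* (V₁ ≈* V₁) ≈+ ≡≈ b ≈* (V₂ ≈* V₂) ≈+ ≡≈ (a * b) ≈* (V₃ ≈* V₃))
      ≈- ≡≈ (+ 2 * c) ≈* (≡≈ a ≈* (V₁ ≈* k₁) ≈+ ≡≈ b ≈* (V₂ ≈* k₂) ≈+ ≡≈ (a * b) ≈* (V₃ ≈* k₃))
      ≈- ≡≈ pp ≈* (≡≈ a ≈* (k₁ ≈* k₁) ≈+ ≡≈ b ≈* (k₂ ≈* k₂) ≈+ ≡≈ (a * b) ≈* (k₃ ≈* k₃))
    where
    V₁ = ≡≈ B₁ ≈+ t ≈* ≡≈ R₁
    V₂ = ≡≈ B₂ ≈+ t ≈* ≡≈ R₂
    V₃ = ≡≈ B₃ ≈+ t ≈* ≡≈ R₃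

  A₀-step₃ : ∀ t k₁ k₂ k₃ → A₀ t k₁ k₂ (k₃ + 1ℤ) ≡ A₀ t k₁ k₂ k₃ - + 2 * c * (a * b * (B₃ + t * R₃)) - pp * (a * b * (+ 2 * k₃ + 1ℤ))
  A₀-step₃ t k₁ k₂ k₃ = lem (t * t + pp - (a * (R₁ * R₁) + b * (R₂ * R₂) + a * b * (R₃ * R₃)) - e * (a * (V₁ * V₁) + b * (V₂ * V₂) + a * b * (V₃ * V₃)))
      (+ 2 * c) pp (a * b) (a * (V₁ * k₁) + b * (V₂ * k₂)) (a * (k₁ * k₁) + b * (k₂ * k₂)) V₃ k₃
    where
    V₁ = B₁ + t * R₁
    V₂ = B₂ + t * R₂
    V₃ = B₃ + t * R₃
    lem : ∀ s c p d u v V k → s - c * (u + d * (V * (k + 1ℤ))) - p * (v + d * ((k + 1ℤ) * (k + 1ℤ))) ≡ s - c * (u + d * (V * k)) - p * (v + d * (k * k)) - c * (d * V) - p * (d * (+ 2 * k + 1ℤ))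
    lem = ring! 8 (λ s c p d u v V k → s :- c :* (u :+ d :* (V :* (k :+ # 1))) :- p :* (v :+ d :* ((k :+ # 1) :* (k :+ # 1))) := s :- c :* (u :+ d :* (V :* k)) :- p :* (v :+ d :* (k :* k)) :- c :* (d :* V) :- p :* (d :* (# 2 :* k :+ # 1))) refl

  module _ (unimodular : x * X + y * Z ≡ 1ℤ)
    (norm-M : a * (M₁ * M₁) + b * (M₂ * M₂) + a * b * (M₃ * M₃) ≡ q * q * (pp - (a * (R₁ * R₁) + b * (R₂ * R₂) + a * b * (R₃ * R₃)))) where

    finish : ∀ {A} t k₁ k₂ k₃ λ′ → L t k₁ k₂ k₃ ≡ λ′ → A ≈ A₀ t k₁ k₂ k₃ [ + 2 * λ′ ] → Rep a b A B₁ B₂ B₃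
    finish {A} t k₁ k₂ k₃ λ′ eL (≈-by (divides τ e)) = slice-rep unimodular norm-M t k₁ k₂ k₃ τ
        (trans (mod1 1ℤ (lem A (A₀ t k₁ k₂ k₃) τ λ′) e) (cong (λ z → A₀ t k₁ k₂ k₃ + + 2 * τ * z) (sym eL)))
      where lem : ∀ A A₀ τ l → A - (A₀ + + 2 * τ * l) ≡ 1ℤ * (A - A₀ - τ * (+ 2 * l))
            lem = solve-∀

-- Completing the upper bound

module NotBothEven {a b : ℤ} (s : Slice a b (+ 4 * (a * b))) (odd-M : ¬ + 2 ∣ a * Slice.M₁ s ⊎ ¬ + 2 ∣ b * Slice.M₂ s) (B₁ B₂ B₃ : ℤ) where
  open Slice s
  private
    -- The slice has A₃ = 4ab, so its third coordinates are doubled to fit the coefficient ab. The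
    -- evenness of M₃ is what later allows k₃ alone to change parity.
    R₃ = + 2 * (+ 16 * κ)
    M₃ = - + 2
  open SliceRep a b x y X Z 1ℤ R₁ R₂ R₃ M₁ M₂ M₃ B₁ B₂ B₃
  open SliceRepMod a b x y X Z 1ℤ R₁ R₂ R₃ M₁ M₂ M₃ B₁ B₂ B₃

  private
    norm-M : a * (M₁ * M₁) + b * (M₂ * M₂) + a * b * (M₃ * M₃) ≡ 1ℤ * 1ℤ * (pp - (a * (R₁ * R₁) + b * (R₂ * R₂) + a * b * (R₃ * R₃)))
    norm-M = mod1 (- 1ℤ) (lem a b pp R₁ R₂ (+ 16 * κ) M₁ M₂) norm-eq
      where lem : ∀ a b p R₁ R₂ k M₁ M₂ → a * (M₁ * M₁) + b * (M₂ * M₂) + a * b * (- + 2 * - + 2) - 1ℤ * 1ℤ * (p - (a * (R₁ * R₁) + b * (R₂ * R₂) + a * b * (+ 2 * k * (+ 2 * k))))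
              ≡ - 1ℤ * (p - (a * (R₁ * R₁ + M₁ * M₁) + b * (R₂ * R₂ + M₂ * M₂) + + 4 * (a * b) * (k * k + 1ℤ)))
            lem = ring! 8 (λ a b p R₁ R₂ k M₁ M₂ → a :* (M₁ :* M₁) :+ b :* (M₂ :* M₂) :+ a :* b :* (:- # 2 :* :- # 2) :- # 1 :* # 1 :* (p :- (a :* (R₁ :* R₁) :+ b :* (R₂ :* R₂) :+ a :* b :* (# 2 :* k :* (# 2 :* k))))
              := :- # 1 :* (p :- (a :* (R₁ :* R₁ :+ M₁ :* M₁) :+ b :* (R₂ :* R₂ :+ M₂ :* M₂) :+ # 4 :* (a :* b) :* (k :* k :+ # 1)))) refl

    -- The homogeneous part of L is 1 at (T; K). At n times this vector L equals n - ⟨B,qR+cM⟩, so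
    -- any value of L can be prescribed.
    Direction : ℤ → ℤ → ℤ → ℤ → Set
    Direction T K₁ K₂ K₃ = T * D - pp * (a * (K₁ * M₁) + b * (K₂ * M₂) + a * b * (K₃ * M₃)) ≡ 1ℤ

    no-prime : ∀ p → Prime p → + p ∣ D → + p ∣ pp * (a * M₁) → + p ∣ pp * (b * M₂) → ¬ + p ∣ pp * (a * b * M₃)
    no-prime p pr dD d₁ d₂ d₃ = go (p ℕ.≟ 2)
      where
      odd : ¬ + 2 ∣ a * M₁ ⊎ ¬ + 2 ∣ b * M₂ → + 2 ∣ pp * (a * M₁) → + 2 ∣ pp * (b * M₂) → ⊥
      odd (inj₁ h) d _ = ∤-* {2} {pp} {a * M₁} prime[2] pp-odd h d
      odd (inj₂ h) _ d = ∤-* {2} {pp} {b * M₂} prime[2] pp-odd h d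
      lem : ∀ a b p c R₁ R₂ k M₁ M₂ → a * (M₁ * M₁) + b * (M₂ * M₂) + + 4 * (a * b) - c * (a * (R₁ * M₁) + b * (R₂ * M₂) - + 4 * (a * b) * k)
        - 1ℤ * (1ℤ * (p - (a * (R₁ * R₁) + b * (R₂ * R₂) + a * b * (+ 2 * k * (+ 2 * k)))) - c * (a * (R₁ * M₁) + b * (R₂ * M₂) + a * b * (+ 2 * k * - + 2)))
        ≡ - 1ℤ * (p - (a * (R₁ * R₁ + M₁ * M₁) + b * (R₂ * R₂ + M₂ * M₂) + + 4 * (a * b) * (k * k + 1ℤ)))
      lem = ring! 9 (λ a b p c R₁ R₂ k M₁ M₂ → a :* (M₁ :* M₁) :+ b :* (M₂ :* M₂) :+ # 4 :* (a :* b) :- c :* (a :* (R₁ :* M₁) :+ b :* (R₂ :* M₂) :- # 4 :* (a :* b) :* k)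
        :- # 1 :* (# 1 :* (p :- (a :* (R₁ :* R₁) :+ b :* (R₂ :* R₂) :+ a :* b :* (# 2 :* k :* (# 2 :* k)))) :- c :* (a :* (R₁ :* M₁) :+ b :* (R₂ :* M₂) :+ a :* b :* (# 2 :* k :* :- # 2)))
        := :- # 1 :* (p :- (a :* (R₁ :* R₁ :+ M₁ :* M₁) :+ b :* (R₂ :* R₂ :+ M₂ :* M₂) :+ # 4 :* (a :* b) :* (k :* k :+ # 1)))) refl
      lem′ : ∀ p d → p * (+ 4 * d) ≡ - + 2 * (p * (d * - + 2))
      lem′ = solve-∀
      go : Dec (p ≡ 2) → ⊥
      go (yes refl) = odd odd-M d₁ d₂
      go (no p≢2) = coprime-D p pr p≢2 (by1 1ℤ (mod1 (- 1ℤ) (lem a b pp c R₁ R₂ (+ 16 * κ) M₁ M₂) norm-eq) dD) d₁ d₂ (by1 (- + 2) (lem′ pp (a * b)) d₃)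

    direction : ∃₂ λ T K₁ → ∃₂ λ K₂ K₃ → Direction T K₁ K₂ K₃
    direction = go (coprime₅ D (pp * (a * M₁)) (pp * (b * M₂)) (pp * (a * b * M₃)) 0ℤ (λ p pr d d₁ d₂ d₃ _ → no-prime p pr d d₁ d₂ d₃))
      where
      go : (∃ λ u₀ → ∃₂ λ u₁ u₂ → ∃₂ λ u₃ u₄ → u₀ * D + u₁ * (pp * (a * M₁)) + u₂ * (pp * (b * M₂)) + u₃ * (pp * (a * b * M₃)) + u₄ * 0ℤ ≡ 1ℤ) →
        ∃₂ λ T K₁ → ∃₂ λ K₂ K₃ → Direction T K₁ K₂ K₃
      go (u₀ , u₁ , u₂ , u₃ , u₄ , e) = u₀ , - u₁ , - u₂ , - u₃ , trans (lem u₀ u₁ u₂ u₃ u₄ D pp a b (a * b) M₁ M₂ M₃) e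
        where lem : ∀ u₀ u₁ u₂ u₃ u₄ D p a b d M₁ M₂ M₃ → u₀ * D - p * (a * (- u₁ * M₁) + b * (- u₂ * M₂) + d * (- u₃ * M₃)) ≡
                u₀ * D + u₁ * (p * (a * M₁)) + u₂ * (p * (b * M₂)) + u₃ * (p * (d * M₃)) + u₄ * 0ℤ
              lem = ring! 13 (λ u₀ u₁ u₂ u₃ u₄ D p a b d M₁ M₂ M₃ → u₀ :* D :- p :* (a :* (:- u₁ :* M₁) :+ b :* (:- u₂ :* M₂) :+ d :* (:- u₃ :* M₃)) :=
                u₀ :* D :+ u₁ :* (p :* (a :* M₁)) :+ u₂ :* (p :* (b :* M₂)) :+ u₃ :* (p :* (d :* M₃)) :+ u₄ :* # 0) refl

    even-e : e ≈ 0ℤ [ + 2 ]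
    even-e = let e′ , eq , _ = half-e x y X Z unimodular pp-odd c-odd in ≈0 (divides e′ eq)

    pp≈1 : pp ≈ 1ℤ [ + 2 ]
    pp≈1 = ≈1 pp-odd

    module _ (T K₁ K₂ K₃ : ℤ) (dir : Direction T K₁ K₂ K₃) where
      L₀ : ∀ l → L ((l + ⟨B,qR+cM⟩) * T) ((l + ⟨B,qR+cM⟩) * K₁) ((l + ⟨B,qR+cM⟩) * K₂) ((l + ⟨B,qR+cM⟩) * K₃) ≡ l
      L₀ l = mod1 (l + ⟨B,qR+cM⟩) (lem l T K₁ K₂ K₃ ⟨B,qR+cM⟩ D pp a b (a * b) M₁ M₂ M₃) dir
        where lem : ∀ l T K₁ K₂ K₃ B D p a b d M₁ M₂ M₃ → (l + B) * T * D - B - p * (a * ((l + B) * K₁ * M₁) + b * ((l + B) * K₂ * M₂) + d * ((l + B) * K₃ * M₃)) - l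
                ≡ (l + B) * (T * D - p * (a * (K₁ * M₁) + b * (K₂ * M₂) + d * (K₃ * M₃)) - 1ℤ)
              lem = ring! 14 (λ l T K₁ K₂ K₃ B D p a b d M₁ M₂ M₃ → (l :+ B) :* T :* D :- B :- p :* (a :* ((l :+ B) :* K₁ :* M₁) :+ b :* ((l :+ B) :* K₂ :* M₂) :+ d :* ((l :+ B) :* K₃ :* M₃)) :- l
                := (l :+ B) :* (T :* D :- p :* (a :* (K₁ :* M₁) :+ b :* (K₂ :* M₂) :+ d :* (K₃ :* M₃)) :- # 1)) refl

      -- Raising k₃ by 1 adds 2(x² + y²)ab to L because M₃ = -2; the multiplier n gives this back
      -- without changing its own parity.
      L₁ : ∀ l → let n = l + ⟨B,qR+cM⟩ - + 2 * (pp * (a * b)) in L (n * T) (n * K₁) (n * K₂) (n * K₃ + 1ℤ) ≡ l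
      L₁ l = mod1 (l + ⟨B,qR+cM⟩ - + 2 * (pp * (a * b))) (lem l T K₁ K₂ K₃ ⟨B,qR+cM⟩ D pp a b (a * b) M₁ M₂) dir
        where lem : ∀ l T K₁ K₂ K₃ B D p a b d M₁ M₂ → let n = l + B - + 2 * (p * d) in
                n * T * D - B - p * (a * (n * K₁ * M₁) + b * (n * K₂ * M₂) + d * ((n * K₃ + 1ℤ) * - + 2)) - l
                ≡ n * (T * D - p * (a * (K₁ * M₁) + b * (K₂ * M₂) + d * (K₃ * - + 2)) - 1ℤ)
              lem = ring! 13 (λ l T K₁ K₂ K₃ B D p a b d M₁ M₂ → let n = l :+ B :- # 2 :* (p :* d) in
                n :* T :* D :- B :- p :* (a :* (n :* K₁ :* M₁) :+ b :* (n :* K₂ :* M₂) :+ d :* ((n :* K₃ :+ # 1) :* :- # 2)) :- l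
                := n :* (T :* D :- p :* (a :* (K₁ :* M₁) :+ b :* (K₂ :* M₂) :+ d :* (K₃ :* :- # 2)) :- # 1)) refl

      toggled : ∀ {d} l → + 2 * (pp * (a * b)) ≈ 0ℤ [ d ] → let n = l + ⟨B,qR+cM⟩; n′ = n - + 2 * (pp * (a * b)) in
        A₀ (n′ * T) (n′ * K₁) (n′ * K₂) (n′ * K₃ + 1ℤ) ≈ A₀ (n * T) (n * K₁) (n * K₂) (n * K₃) - + 2 * c * (a * b * (B₃ + n * T * R₃)) - pp * (a * b * (+ 2 * (n * K₃) + 1ℤ)) [ d ]
      toggled {d} l w≈0 = ≈-trans (A₀-cong (n≈ ≈* ≡≈ T) (n≈ ≈* ≡≈ K₁) (n≈ ≈* ≡≈ K₂) (n≈ ≈* ≡≈ K₃ ≈+ ≡≈ 1ℤ)) (≈-≡ (A₀-step₃ (n * T) (n * K₁) (n * K₂) (n * K₃)))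
        where
        n = l + ⟨B,qR+cM⟩
        n≈ : n - + 2 * (pp * (a * b)) ≈ n [ d ]
        n≈ = ≈-trans (≡≈ n ≈- w≈0) (≈-≡ (ℤ.+-identityʳ n))

      -- Raising k₃ changes A₀ by (x² + y²)ab(2k₃ + 1) up to even terms. This is odd, so both
      -- parities of A are reached with L = 1.
      odd-case : a ≈ 1ℤ [ + 2 ] → b ≈ 1ℤ [ + 2 ] → ∀ A → Rep a b A B₁ B₂ B₃
      odd-case a≈1 b≈1 A = go (parity A α)
        where
        n = 1ℤ + ⟨B,qR+cM⟩
        n′ = n - + 2 * (pp * (a * b))
        α = A₀ (n * T) (n * K₁) (n * K₂) (n * K₃)
        2≈0 : + 2 ≈ 0ℤ [ + 2 ]
        2≈0 = ≈0 ∣-refl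
        α′ : A₀ (n′ * T) (n′ * K₁) (n′ * K₂) (n′ * K₃ + 1ℤ) ≈ α + 1ℤ [ + 2 ]
        α′ = ≈-trans (toggled 1ℤ (2≈0 ≈* ≡≈ (pp * (a * b))))
               (≈-trans (≡≈ α ≈- 2≈0 ≈* ≡≈ c ≈* (a≈1 ≈* b≈1 ≈* ≡≈ (B₃ + n * T * R₃)) ≈- pp≈1 ≈* (a≈1 ≈* b≈1 ≈* (2≈0 ≈* ≡≈ (n * K₃) ≈+ ≡≈ 1ℤ)))
                 (≈-by (divides (- 1ℤ) (lem α c (B₃ + n * T * R₃) (n * K₃)))))
          where lem : ∀ α c V k → α - 0ℤ * c * (1ℤ * 1ℤ * V) - 1ℤ * (1ℤ * 1ℤ * (0ℤ * k + 1ℤ)) - (α + 1ℤ) ≡ - 1ℤ * + 2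
                lem = solve-∀
        go : A ≈ α [ + 2 ] ⊎ A ≈ α + 1ℤ [ + 2 ] → Rep a b A B₁ B₂ B₃
        go (inj₁ h) = finish unimodular norm-M (n * T) (n * K₁) (n * K₂) (n * K₃) 1ℤ (L₀ 1ℤ) h
        go (inj₂ h) = finish unimodular norm-M (n′ * T) (n′ * K₁) (n′ * K₂) (n′ * K₃ + 1ℤ) 1ℤ (L₁ 1ℤ) (≈-trans h (≈-sym α′))

      module _ (a≈0 : a ≈ 0ℤ [ + 2 ]) (b≈1 : b ≈ 1ℤ [ + 2 ]) (ab≈2 : a * b ≈ + 2 [ + 4 ]) (M₂≈1 : M₂ ≈ 1ℤ [ + 2 ]) (R₂≈0 : R₂ ≈ 0ℤ [ + 2 ]) where
        norm-R≈0 : a * (R₁ * R₁) + b * (R₂ * R₂) + a * b * (R₃ * R₃) ≈ 0ℤ [ + 2 ]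
        norm-R≈0 = ≈-trans (a≈0 ≈* ≡≈ (R₁ * R₁) ≈+ ≡≈ b ≈* (R₂≈0 ≈* R₂≈0) ≈+ a≈0 ≈* ≡≈ b ≈* ≡≈ (R₃ * R₃)) (≈-≡ (lem (R₁ * R₁) b (R₃ * R₃)))
          where lem : ∀ u b v → 0ℤ * u + b * (0ℤ * 0ℤ) + 0ℤ * b * v ≡ 0ℤ
                lem = solve-∀

        D≈1 : D ≈ 1ℤ [ + 2 ]
        D≈1 = ≈-trans (≡≈ 1ℤ ≈* (pp≈1 ≈- norm-R≈0) ≈- ≡≈ c ≈* (a≈0 ≈* ≡≈ (R₁ * M₁) ≈+ ≡≈ b ≈* (R₂≈0 ≈* ≡≈ M₂) ≈+ a≈0 ≈* ≡≈ b ≈* ≡≈ (R₃ * M₃)))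
                (≈-≡ (lem c (R₁ * M₁) b M₂ (R₃ * M₃)))
          where lem : ∀ c u b M v → 1ℤ * (1ℤ - 0ℤ) - c * (0ℤ * u + b * (0ℤ * M) + 0ℤ * b * v) ≡ 1ℤ
                lem = solve-∀

        T-K₂≈1 : T - K₂ ≈ 1ℤ [ + 2 ]
        T-K₂≈1 = ≈-sym (≈-trans (≈-≡ (sym dir))
            (≈-trans (≡≈ T ≈* D≈1 ≈- pp≈1 ≈* (a≈0 ≈* ≡≈ (K₁ * M₁) ≈+ b≈1 ≈* (≡≈ K₂ ≈* M₂≈1) ≈+ a≈0 ≈* ≡≈ b ≈* ≡≈ (K₃ * M₃)))
              (≈-≡ (lem T (K₁ * M₁) K₂ b (K₃ * M₃)))))
          where lem : ∀ T u K b v → T * 1ℤ - 1ℤ * (0ℤ * u + 1ℤ * (K * 1ℤ) + 0ℤ * b * v) ≡ T - K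
                lem = solve-∀

        -- Modulo 2 only n²(T² - K₂²) + 1 survives, and T - K₂ is odd by `dir`.
        A₀≈ : ∀ n → A₀ (n * T) (n * K₁) (n * K₂) (n * K₃) ≈ n + 1ℤ [ + 2 ]
        A₀≈ n = ≈-trans
            (≡≈ (n * T * (n * T)) ≈+ pp≈1 ≈- norm-R≈0
              ≈- even-e ≈* ≡≈ (a * (V₁ * V₁) + b * (V₂ * V₂) + a * b * (V₃ * V₃))
              ≈- ≈0 {+ 2} ∣-refl ≈* ≡≈ c ≈* ≡≈ (a * (V₁ * (n * K₁)) + b * (V₂ * (n * K₂)) + a * b * (V₃ * (n * K₃)))
              ≈- pp≈1 ≈* (a≈0 ≈* ≡≈ (n * K₁ * (n * K₁)) ≈+ b≈1 ≈* ≡≈ (n * K₂ * (n * K₂)) ≈+ a≈0 ≈* ≡≈ b ≈* ≡≈ (n * K₃ * (n * K₃))))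
            (≈-trans (≈-≡ (lem n T K₂ (a * (V₁ * V₁) + b * (V₂ * V₂) + a * b * (V₃ * V₃)) c
                 (a * (V₁ * (n * K₁)) + b * (V₂ * (n * K₂)) + a * b * (V₃ * (n * K₃))) (n * K₁ * (n * K₁)) b (n * K₃ * (n * K₃))))
              (≈-trans (square≈ n ≈* (T-K₂≈1 ≈* (T-K₂≈1 ≈+ ≈0 {+ 2} ∣-refl ≈* ≡≈ K₂)) ≈+ ≡≈ 1ℤ) (≈-≡ (lem′ n K₂))))
          where
          V₁ = B₁ + n * T * R₁
          V₂ = B₂ + n * T * R₂
          V₃ = B₃ + n * T * R₃
          lem : ∀ n T K u c v w b z → n * T * (n * T) + 1ℤ - 0ℤ - 0ℤ * u - 0ℤ * c * v - 1ℤ * (0ℤ * w + 1ℤ * (n * K * (n * K)) + 0ℤ * b * z) ≡ n * n * ((T - K) * (T - K + + 2 * K)) + 1ℤ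
          lem = ring! 9 (λ n T K u c v w b z → n :* T :* (n :* T) :+ # 1 :- # 0 :- # 0 :* u :- # 0 :* c :* v :- # 1 :* (# 0 :* w :+ # 1 :* (n :* K :* (n :* K)) :+ # 0 :* b :* z) := n :* n :* ((T :- K) :* (T :- K :+ # 2 :* K)) :+ # 1) refl
          lem′ : ∀ n K → n * (1ℤ * (1ℤ + 0ℤ * K)) + 1ℤ ≡ n + 1ℤ
          lem′ = solve-∀

        -- The parity of A₀ is now that of n + 1 and raising k₃ does not affect it, so L = 1 serves
        -- only one parity of A. For the other one L = 2 is used; A then matters modulo 4, and
        -- raising k₃ moves A₀ by ab ≡ 2.
        even-case : ∀ A → Rep a b A B₁ B₂ B₃
        even-case A = go (parity A α)
          where
          β = ⟨B,qR+cM⟩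
          n = 1ℤ + β
          m = + 2 + β
          m′ = m - + 2 * (pp * (a * b))
          α = A₀ (n * T) (n * K₁) (n * K₂) (n * K₃)
          γ = A₀ (m * T) (m * K₁) (m * K₂) (m * K₃)
          γ≈ : α + 1ℤ ≈ γ [ + 2 ]
          γ≈ = ≈-trans (A₀≈ n ≈+ ≡≈ 1ℤ) (≈-trans (≈-≡ (lem β)) (≈-sym (A₀≈ m)))
            where lem : ∀ β → 1ℤ + β + 1ℤ + 1ℤ ≡ + 2 + β + 1ℤ
                  lem = solve-∀
          γ′ : A₀ (m′ * T) (m′ * K₁) (m′ * K₂) (m′ * K₃ + 1ℤ) ≈ γ + + 2 [ + 4 ]
          γ′ = ≈-trans (toggled (+ 2) (≈-trans (≡≈ (+ 2) ≈* (≡≈ pp ≈* ab≈2)) (≈0 (divides pp (l₁ pp)))))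
                 (≈-trans (≡≈ γ ≈- ≡≈ (+ 2 * c) ≈* (ab≈2 ≈* ≡≈ (B₃ + m * T * R₃)) ≈- sum-of-squares≈1 x y pp-odd ≈* (ab≈2 ≈* ≡≈ (+ 2 * (m * K₃) + 1ℤ)))
                   (≈-by (divides (- (c * (B₃ + m * T * R₃)) - m * K₃ - 1ℤ) (l₂ γ c (B₃ + m * T * R₃) (m * K₃)))))
            where
            l₁ : ∀ p → + 2 * (p * + 2) ≡ p * + 4
            l₁ = solve-∀
            l₂ : ∀ γ c V k → γ - + 2 * c * (+ 2 * V) - 1ℤ * (+ 2 * (+ 2 * k + 1ℤ)) - (γ + + 2) ≡ (- (c * V) - k - 1ℤ) * + 4
            l₂ = ring! 4 (λ γ c V k → γ :- # 2 :* c :* (# 2 :* V) :- # 1 :* (# 2 :* (# 2 :* k :+ # 1)) :- (γ :+ # 2) := (:- (c :* V) :- k :- # 1) :* # 4) refl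
          lifted : A ≈ γ [ + 4 ] ⊎ A ≈ γ + + 2 [ + 4 ] → Rep a b A B₁ B₂ B₃
          lifted (inj₁ h) = finish unimodular norm-M (m * T) (m * K₁) (m * K₂) (m * K₃) (+ 2) (L₀ (+ 2)) h
          lifted (inj₂ h) = finish unimodular norm-M (m′ * T) (m′ * K₁) (m′ * K₂) (m′ * K₃ + 1ℤ) (+ 2) (L₁ (+ 2)) (≈-trans h (≈-sym γ′))
          go : A ≈ α [ + 2 ] ⊎ A ≈ α + 1ℤ [ + 2 ] → Rep a b A B₁ B₂ B₃
          go (inj₁ h) = finish unimodular norm-M (n * T) (n * K₁) (n * K₂) (n * K₃) 1ℤ (L₀ 1ℤ) h
          go (inj₂ h) = lifted (lift-mod (+ 2) (≈-trans h γ≈))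

  rep-odd : a ≈ 1ℤ [ + 2 ] → b ≈ 1ℤ [ + 2 ] → ∀ A → Rep a b A B₁ B₂ B₃
  rep-odd a≈1 b≈1 A = go direction
    where go : (∃₂ λ T K₁ → ∃₂ λ K₂ K₃ → Direction T K₁ K₂ K₃) → Rep a b A B₁ B₂ B₃
          go (T , K₁ , K₂ , K₃ , dir) = odd-case T K₁ K₂ K₃ dir a≈1 b≈1 A

  rep-one-even : a ≈ 0ℤ [ + 2 ] → b ≈ 1ℤ [ + 2 ] → a * b ≈ + 2 [ + 4 ] → M₂ ≈ 1ℤ [ + 2 ] → R₂ ≈ 0ℤ [ + 2 ] → ∀ A → Rep a b A B₁ B₂ B₃
  rep-one-even a≈0 b≈1 ab≈2 M₂≈1 R₂≈0 A = go direction
    where go : (∃₂ λ T K₁ → ∃₂ λ K₂ K₃ → Direction T K₁ K₂ K₃) → Rep a b A B₁ B₂ B₃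
          go (T , K₁ , K₂ , K₃ , dir) = even-case T K₁ K₂ K₃ dir a≈0 b≈1 ab≈2 M₂≈1 R₂≈0 A

-- Two even coefficients

module BothEven {a b : ℤ} (a≈1 : a ≈ 1ℤ [ + 2 ]) (b≈1 : b ≈ 1ℤ [ + 2 ]) (s : Slice (+ 2 * a) (+ 2 * b) (a * b))
  (r m : ℤ) (M₂≈r : Slice.M₂ s ≈ r [ + 2 ]) (R₂≈m : Slice.R₂ s ≈ m [ + 2 ]) (R₁+M₁≈1 : Slice.R₁ s + Slice.M₁ s ≈ 1ℤ [ + 2 ]) (B₁ B₂ B₃ : ℤ) where
  open Slice s
  -- The slice has A₃ = ab, a quarter of the third coefficient 4ab, so its third coordinates must be
  -- halved. For R this is 8κ; for M it would be -1/2, so M is doubled instead and q = 2.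
  open SliceRep (+ 2 * a) (+ 2 * b) x y X Z (+ 2) R₁ R₂ (+ 8 * κ) (+ 2 * M₁) (+ 2 * M₂) (- 1ℤ) B₁ B₂ B₃
  open SliceRepMod (+ 2 * a) (+ 2 * b) x y X Z (+ 2) R₁ R₂ (+ 8 * κ) (+ 2 * M₁) (+ 2 * M₂) (- 1ℤ) B₁ B₂ B₃

  private
    norm-M : + 2 * a * (+ 2 * M₁ * (+ 2 * M₁)) + + 2 * b * (+ 2 * M₂ * (+ 2 * M₂)) + + 2 * a * (+ 2 * b) * (- 1ℤ * - 1ℤ)
      ≡ + 2 * + 2 * (pp - (+ 2 * a * (R₁ * R₁) + + 2 * b * (R₂ * R₂) + + 2 * a * (+ 2 * b) * (+ 8 * κ * (+ 8 * κ))))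
    norm-M = mod1 (- + 4) (lem a b pp R₁ R₂ κ M₁ M₂) norm-eq
      where lem : ∀ a b p R₁ R₂ κ M₁ M₂ → + 2 * a * (+ 2 * M₁ * (+ 2 * M₁)) + + 2 * b * (+ 2 * M₂ * (+ 2 * M₂)) + + 2 * a * (+ 2 * b) * (- 1ℤ * - 1ℤ)
              - + 2 * + 2 * (p - (+ 2 * a * (R₁ * R₁) + + 2 * b * (R₂ * R₂) + + 2 * a * (+ 2 * b) * (+ 8 * κ * (+ 8 * κ))))
              ≡ - + 4 * (p - (+ 2 * a * (R₁ * R₁ + M₁ * M₁) + + 2 * b * (R₂ * R₂ + M₂ * M₂) + a * b * (+ 16 * κ * (+ 16 * κ) + 1ℤ)))
            lem = ring! 8 (λ a b p R₁ R₂ κ M₁ M₂ → # 2 :* a :* (# 2 :* M₁ :* (# 2 :* M₁)) :+ # 2 :* b :* (# 2 :* M₂ :* (# 2 :* M₂)) :+ # 2 :* a :* (# 2 :* b) :* (:- # 1 :* :- # 1)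
              :- # 2 :* # 2 :* (p :- (# 2 :* a :* (R₁ :* R₁) :+ # 2 :* b :* (R₂ :* R₂) :+ # 2 :* a :* (# 2 :* b) :* (# 8 :* κ :* (# 8 :* κ))))
              := :- # 4 :* (p :- (# 2 :* a :* (R₁ :* R₁ :+ M₁ :* M₁) :+ # 2 :* b :* (R₂ :* R₂ :+ M₂ :* M₂) :+ a :* b :* (# 16 :* κ :* (# 16 :* κ) :+ # 1)))) refl

    D′ = + 2 * a * (M₁ * M₁) + + 2 * b * (M₂ * M₂) + a * b - c * (+ 2 * a * (R₁ * M₁) + + 2 * b * (R₂ * M₂) - a * b * (+ 16 * κ))
    σ = a * (B₁ * (R₁ + c * M₁)) + b * (B₂ * (R₂ + c * M₂)) + a * b * (B₃ * (+ 16 * κ - c))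
    N = + 2 * a * (M₁ * M₁) + + 2 * b * (M₂ * M₂) + a * b

    2≈0 : + 2 ≈ 0ℤ [ + 2 ]
    2≈0 = ≈0 ∣-refl

    pp≈1 : pp ≈ 1ℤ [ + 2 ]
    pp≈1 = ≈1 pp-odd

    c≈1 : c ≈ 1ℤ [ + 2 ]
    c≈1 = ≈1 c-odd

    D′≈1 : D′ ≈ 1ℤ [ + 2 ]
    D′≈1 = ≈-trans (2≈0 ≈* ≡≈ a ≈* ≡≈ (M₁ * M₁) ≈+ 2≈0 ≈* ≡≈ b ≈* ≡≈ (M₂ * M₂) ≈+ a≈1 ≈* b≈1
        ≈- ≡≈ c ≈* (2≈0 ≈* ≡≈ a ≈* ≡≈ (R₁ * M₁) ≈+ 2≈0 ≈* ≡≈ b ≈* ≡≈ (R₂ * M₂) ≈- ≡≈ (a * b) ≈* (≈0 (divides (+ 8) refl) ≈* ≡≈ κ)))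
      (≈-≡ (lem a b (a * b) c (M₁ * M₁) (M₂ * M₂) (R₁ * M₁) (R₂ * M₂) κ))
      where lem : ∀ a b d c u v w z κ → 0ℤ * a * u + 0ℤ * b * v + 1ℤ * 1ℤ - c * (0ℤ * a * w + 0ℤ * b * z - d * (0ℤ * κ)) ≡ 1ℤ
            lem = solve-∀

    -- The factor 16 creates no obstruction because D′ is odd. It allows all corrections to the kᵢ
    -- to be multiples of 8 or 16, invisible in A₀ modulo 4 or 8.
    Direction : ℤ → ℤ → ℤ → ℤ → Set
    Direction T K₁ K₂ K₃ = T * D′ - + 16 * (pp * (a * (K₁ * M₁) + b * (K₂ * M₂) - a * b * K₃)) ≡ 1ℤ

    no-prime : ∀ p → Prime p → + p ∣ D′ → + p ∣ + 16 * (pp * (a * M₁)) → + p ∣ + 16 * (pp * (b * M₂)) → ¬ + p ∣ + 16 * (pp * (a * b))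
    no-prime p pr dD d₁ d₂ d₃ = go (p ℕ.≟ 2)
      where
      lem : ∀ p a M → p * (+ 2 * a * M) ≡ + 2 * (p * (a * M))
      lem = solve-∀
      go : Dec (p ≡ 2) → ⊥
      go (yes refl) = 2∤1 (∣-of (≈-trans (≈-sym D′≈1) (≈0 dD)))
      go (no p≢2) = coprime-D p pr p≢2 dD (by1 (+ 2) (lem pp a M₁) (strip (pp * (a * M₁)) d₁)) (by1 (+ 2) (lem pp b M₂) (strip (pp * (b * M₂)) d₂)) (strip (pp * (a * b)) d₃)
        where
        2∤ = odd-prime∤2 pr p≢2
        strip : ∀ z → + p ∣ + 16 * z → + p ∣ z
        strip z d with euclid {p} {+ 16} {z} pr d
        ... | inj₁ h = ⊥-elim (∤-* pr (∤-* pr 2∤ 2∤) (∤-* pr 2∤ 2∤) h)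
        ... | inj₂ h = h

    direction : ∃₂ λ T K₁ → ∃₂ λ K₂ K₃ → Direction T K₁ K₂ K₃
    direction = go (coprime₅ D′ (+ 16 * (pp * (a * M₁))) (+ 16 * (pp * (b * M₂))) (+ 16 * (pp * (a * b))) 0ℤ (λ p pr d d₁ d₂ d₃ _ → no-prime p pr d d₁ d₂ d₃))
      where
      go : (∃ λ u₀ → ∃₂ λ u₁ u₂ → ∃₂ λ u₃ u₄ → u₀ * D′ + u₁ * (+ 16 * (pp * (a * M₁))) + u₂ * (+ 16 * (pp * (b * M₂))) + u₃ * (+ 16 * (pp * (a * b))) + u₄ * 0ℤ ≡ 1ℤ) →
        ∃₂ λ T K₁ → ∃₂ λ K₂ K₃ → Direction T K₁ K₂ K₃
      go (u₀ , u₁ , u₂ , u₃ , u₄ , e) = u₀ , - u₁ , - u₂ , u₃ , trans (lem u₀ u₁ u₂ u₃ u₄ D′ pp a b (a * b) M₁ M₂) e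
        where lem : ∀ u₀ u₁ u₂ u₃ u₄ D p a b d M₁ M₂ → u₀ * D - + 16 * (p * (a * (- u₁ * M₁) + b * (- u₂ * M₂) - d * u₃)) ≡
                u₀ * D + u₁ * (+ 16 * (p * (a * M₁))) + u₂ * (+ 16 * (p * (b * M₂))) + u₃ * (+ 16 * (p * d)) + u₄ * 0ℤ
              lem = ring! 12 (λ u₀ u₁ u₂ u₃ u₄ D p a b d M₁ M₂ → u₀ :* D :- # 16 :* (p :* (a :* (:- u₁ :* M₁) :+ b :* (:- u₂ :* M₂) :- d :* u₃)) :=
                u₀ :* D :+ u₁ :* (# 16 :* (p :* (a :* M₁))) :+ u₂ :* (# 16 :* (p :* (b :* M₂))) :+ u₃ :* (# 16 :* (p :* d)) :+ u₄ :* # 0) refl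

    -- L is always even, and divisible by 4 when t is even. As A₀ ≡ t + 1 modulo 2, odd t with step
    -- 4 serves even A, and even t with step 8 or 16 serves odd A.
    L-eq : ∀ t k₁ k₂ k₃ → L t k₁ k₂ k₃ ≡ + 2 * (t * D′ - + 2 * σ - + 2 * (pp * (a * (k₁ * M₁) + b * (k₂ * M₂) - a * b * k₃)))
    L-eq t k₁ k₂ k₃ = mod1 (+ 2 * t) (lem a b pp c R₁ R₂ κ M₁ M₂ B₁ B₂ B₃ t k₁ k₂ k₃) norm-eq
      where lem : ∀ a b p c R₁ R₂ κ M₁ M₂ B₁ B₂ B₃ t k₁ k₂ k₃ → let
                    d = + 2 * a * (+ 2 * b)
                    D′ = + 2 * a * (M₁ * M₁) + + 2 * b * (M₂ * M₂) + a * b - c * (+ 2 * a * (R₁ * M₁) + + 2 * b * (R₂ * M₂) - a * b * (+ 16 * κ))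
                    σ = a * (B₁ * (R₁ + c * M₁)) + b * (B₂ * (R₂ + c * M₂)) + a * b * (B₃ * (+ 16 * κ - c)) in
                t * (+ 2 * (p - (+ 2 * a * (R₁ * R₁) + + 2 * b * (R₂ * R₂) + d * (+ 8 * κ * (+ 8 * κ)))) - c * (+ 2 * a * (R₁ * (+ 2 * M₁)) + + 2 * b * (R₂ * (+ 2 * M₂)) + d * (+ 8 * κ * - 1ℤ)))
                - (+ 2 * a * (B₁ * (+ 2 * R₁ + c * (+ 2 * M₁))) + + 2 * b * (B₂ * (+ 2 * R₂ + c * (+ 2 * M₂))) + d * (B₃ * (+ 2 * (+ 8 * κ) + c * - 1ℤ)))
                - p * (+ 2 * a * (k₁ * (+ 2 * M₁)) + + 2 * b * (k₂ * (+ 2 * M₂)) + d * (k₃ * - 1ℤ))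
                - + 2 * (t * D′ - + 2 * σ - + 2 * (p * (a * (k₁ * M₁) + b * (k₂ * M₂) - a * b * k₃)))
                ≡ + 2 * t * (p - (+ 2 * a * (R₁ * R₁ + M₁ * M₁) + + 2 * b * (R₂ * R₂ + M₂ * M₂) + a * b * (+ 16 * κ * (+ 16 * κ) + 1ℤ)))
            lem = ring! 16 (λ a b p c R₁ R₂ κ M₁ M₂ B₁ B₂ B₃ t k₁ k₂ k₃ → let
                    d = # 2 :* a :* (# 2 :* b)
                    D′ = # 2 :* a :* (M₁ :* M₁) :+ # 2 :* b :* (M₂ :* M₂) :+ a :* b :- c :* (# 2 :* a :* (R₁ :* M₁) :+ # 2 :* b :* (R₂ :* M₂) :- a :* b :* (# 16 :* κ))
                    σ = a :* (B₁ :* (R₁ :+ c :* M₁)) :+ b :* (B₂ :* (R₂ :+ c :* M₂)) :+ a :* b :* (B₃ :* (# 16 :* κ :- c)) in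
                t :* (# 2 :* (p :- (# 2 :* a :* (R₁ :* R₁) :+ # 2 :* b :* (R₂ :* R₂) :+ d :* (# 8 :* κ :* (# 8 :* κ)))) :- c :* (# 2 :* a :* (R₁ :* (# 2 :* M₁)) :+ # 2 :* b :* (R₂ :* (# 2 :* M₂)) :+ d :* (# 8 :* κ :* :- # 1)))
                :- (# 2 :* a :* (B₁ :* (# 2 :* R₁ :+ c :* (# 2 :* M₁))) :+ # 2 :* b :* (B₂ :* (# 2 :* R₂ :+ c :* (# 2 :* M₂))) :+ d :* (B₃ :* (# 2 :* (# 8 :* κ) :+ c :* :- # 1)))
                :- p :* (# 2 :* a :* (k₁ :* (# 2 :* M₁)) :+ # 2 :* b :* (k₂ :* (# 2 :* M₂)) :+ d :* (k₃ :* :- # 1))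
                :- # 2 :* (t :* D′ :- # 2 :* σ :- # 2 :* (p :* (a :* (k₁ :* M₁) :+ b :* (k₂ :* M₂) :- a :* b :* k₃)))
                := # 2 :* t :* (p :- (# 2 :* a :* (R₁ :* R₁ :+ M₁ :* M₁) :+ # 2 :* b :* (R₂ :* R₂ :+ M₂ :* M₂) :+ a :* b :* (# 16 :* κ :* (# 16 :* κ) :+ # 1)))) refl

    A₀-eq : ∀ e′ → e ≡ e′ * + 2 → ∀ t k → let V₁ = B₁ + t * R₁; V₂ = B₂ + t * R₂; V₃ = B₃ + t * (+ 8 * κ) in
      A₀ t k 0ℤ 0ℤ ≡ t * t + N - + 4 * (e′ * (a * (V₁ * V₁) + b * (V₂ * V₂) + + 2 * (a * b) * (V₃ * V₃)) + c * a * (V₁ * k)) - + 2 * a * (pp * (k * k))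
    A₀-eq e′ ee t k = mod2 1ℤ (- (+ 2 * a * (V₁ * V₁) + + 2 * b * (V₂ * V₂) + + 2 * a * (+ 2 * b) * (V₃ * V₃))) (lem a b pp c e e′ R₁ R₂ κ M₁ M₂ V₁ V₂ V₃ t k) norm-eq ee
      where
      V₁ = B₁ + t * R₁
      V₂ = B₂ + t * R₂
      V₃ = B₃ + t * (+ 8 * κ)
      lem : ∀ a b p c e e′ R₁ R₂ κ M₁ M₂ V₁ V₂ V₃ t k → let d = + 2 * a * (+ 2 * b); N = + 2 * a * (M₁ * M₁) + + 2 * b * (M₂ * M₂) + a * b in
        t * t + p - (+ 2 * a * (R₁ * R₁) + + 2 * b * (R₂ * R₂) + d * (+ 8 * κ * (+ 8 * κ))) - e * (+ 2 * a * (V₁ * V₁) + + 2 * b * (V₂ * V₂) + d * (V₃ * V₃))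
          - + 2 * c * (+ 2 * a * (V₁ * k) + + 2 * b * (V₂ * 0ℤ) + d * (V₃ * 0ℤ)) - p * (+ 2 * a * (k * k) + + 2 * b * (0ℤ * 0ℤ) + d * (0ℤ * 0ℤ))
        - (t * t + N - + 4 * (e′ * (a * (V₁ * V₁) + b * (V₂ * V₂) + + 2 * (a * b) * (V₃ * V₃)) + c * a * (V₁ * k)) - + 2 * a * (p * (k * k)))
        ≡ 1ℤ * (p - (+ 2 * a * (R₁ * R₁ + M₁ * M₁) + + 2 * b * (R₂ * R₂ + M₂ * M₂) + a * b * (+ 16 * κ * (+ 16 * κ) + 1ℤ)))
          + - (+ 2 * a * (V₁ * V₁) + + 2 * b * (V₂ * V₂) + d * (V₃ * V₃)) * (e - e′ * + 2)
      lem = ring! 16 (λ a b p c e e′ R₁ R₂ κ M₁ M₂ V₁ V₂ V₃ t k → let d = # 2 :* a :* (# 2 :* b); N = # 2 :* a :* (M₁ :* M₁) :+ # 2 :* b :* (M₂ :* M₂) :+ a :* b in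
        t :* t :+ p :- (# 2 :* a :* (R₁ :* R₁) :+ # 2 :* b :* (R₂ :* R₂) :+ d :* (# 8 :* κ :* (# 8 :* κ))) :- e :* (# 2 :* a :* (V₁ :* V₁) :+ # 2 :* b :* (V₂ :* V₂) :+ d :* (V₃ :* V₃))
          :- # 2 :* c :* (# 2 :* a :* (V₁ :* k) :+ # 2 :* b :* (V₂ :* # 0) :+ d :* (V₃ :* # 0)) :- p :* (# 2 :* a :* (k :* k) :+ # 2 :* b :* (# 0 :* # 0) :+ d :* (# 0 :* # 0))
        :- (t :* t :+ N :- # 4 :* (e′ :* (a :* (V₁ :* V₁) :+ b :* (V₂ :* V₂) :+ # 2 :* (a :* b) :* (V₃ :* V₃)) :+ c :* a :* (V₁ :* k)) :- # 2 :* a :* (p :* (k :* k)))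
        := # 1 :* (p :- (# 2 :* a :* (R₁ :* R₁ :+ M₁ :* M₁) :+ # 2 :* b :* (R₂ :* R₂ :+ M₂ :* M₂) :+ a :* b :* (# 16 :* κ :* (# 16 :* κ) :+ # 1)))
          :+ :- (# 2 :* a :* (V₁ :* V₁) :+ # 2 :* b :* (V₂ :* V₂) :+ d :* (V₃ :* V₃)) :* (e :- e′ :* # 2)) refl

    half : ∃ λ e′ → e ≡ e′ * + 2 × e′ ≈ 1ℤ [ + 2 ]
    half = half-e x y X Z unimodular pp-odd c-odd

    -- Since e = 2e′ with e′ odd, the terms containing the Vᵢ carry a factor 4. Their cofactor
    -- matters only modulo 2, where Vᵢ ≡ Bᵢ because t = 2u is even.
    A₀≈ : ∀ u k → A₀ (+ 2 * u) k 0ℤ 0ℤ ≈ N + + 4 * (u * u - (B₁ * B₁ + B₂ * B₂ + B₁ * k)) - + 2 * a * (pp * (k * k)) [ + 8 ]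
    A₀≈ u k = go half
      where
      V₁ = B₁ + + 2 * u * R₁
      V₂ = B₂ + + 2 * u * R₂
      V₃ = B₃ + + 2 * u * (+ 8 * κ)
      V≈B : ∀ B R → B + + 2 * u * R ≈ B [ + 2 ]
      V≈B B R = ≈-by (divides (u * R) (lem B u R))
        where lem : ∀ B u R → B + + 2 * u * R - B ≡ u * R * + 2
              lem = solve-∀
      lem₁ : ∀ u N y z → + 2 * u * (+ 2 * u) + N - + 4 * y - z ≡ N + + 4 * (u * u - y) - z
      lem₁ = solve-∀
      lem₂ : ∀ u v d w z → 1ℤ * (1ℤ * u + 1ℤ * v + 0ℤ * d * w) + 1ℤ * 1ℤ * z ≡ u + v + z
      lem₂ = solve-∀
      go : (∃ λ e′ → e ≡ e′ * + 2 × e′ ≈ 1ℤ [ + 2 ]) → A₀ (+ 2 * u) k 0ℤ 0ℤ ≈ N + + 4 * (u * u - (B₁ * B₁ + B₂ * B₂ + B₁ * k)) - + 2 * a * (pp * (k * k)) [ + 8 ]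
      go (e′ , ee , e′≈1) = ≈-trans
          (≈-≡ (trans (A₀-eq e′ ee (+ 2 * u) k) (lem₁ u N (e′ * (a * (V₁ * V₁) + b * (V₂ * V₂) + + 2 * (a * b) * (V₃ * V₃)) + c * a * (V₁ * k)) (+ 2 * a * (pp * (k * k))))))
          (≡≈ N ≈+ ≈-scale (+ 4) (≡≈ (u * u) ≈- ≈-trans
             (e′≈1 ≈* (a≈1 ≈* (V≈B B₁ R₁ ≈* V≈B B₁ R₁) ≈+ b≈1 ≈* (V≈B B₂ R₂ ≈* V≈B B₂ R₂) ≈+ 2≈0 ≈* ≡≈ (a * b) ≈* ≡≈ (V₃ * V₃)) ≈+ c≈1 ≈* a≈1 ≈* (V≈B B₁ R₁ ≈* ≡≈ k))
             (≈-≡ (lem₂ (B₁ * B₁) (B₂ * B₂) (a * b) (V₃ * V₃) (B₁ * k))))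
           ≈- ≡≈ (+ 2 * a * (pp * (k * k))))

    σ≈ : σ ≈ B₁ + B₂ * (r + m) - B₃ [ + 2 ]
    σ≈ = ≈-trans (a≈1 ≈* (≡≈ B₁ ≈* ≈-trans (≡≈ R₁ ≈+ c≈1 ≈* ≡≈ M₁) (≈-trans (≈-≡ (cong (λ z → R₁ + z) (ℤ.*-identityˡ M₁))) R₁+M₁≈1))
        ≈+ b≈1 ≈* (≡≈ B₂ ≈* (R₂≈m ≈+ c≈1 ≈* M₂≈r)) ≈+ a≈1 ≈* b≈1 ≈* (≡≈ B₃ ≈* (≈0 (divides (+ 8) refl) ≈* ≡≈ κ ≈- c≈1)))
      (≈-≡ (lem B₁ B₂ B₃ κ r m))
      where lem : ∀ B₁ B₂ B₃ κ r m → 1ℤ * (B₁ * 1ℤ) + 1ℤ * (B₂ * (m + 1ℤ * r)) + 1ℤ * 1ℤ * (B₃ * (0ℤ * κ - 1ℤ)) ≡ B₁ + B₂ * (r + m) - B₃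
            lem = ring! 6 (λ B₁ B₂ B₃ κ r m → # 1 :* (B₁ :* # 1) :+ # 1 :* (B₂ :* (m :+ # 1 :* r)) :+ # 1 :* # 1 :* (B₃ :* (# 0 :* κ :- # 1)) := B₁ :+ B₂ :* (r :+ m) :- B₃) refl

    double-square : ∀ {u v} d → u ≈ v [ + 2 ] → + 2 * d * (u * u) ≈ + 2 * d * (v * v) [ + 8 ]
    double-square {u} {v} d h = ≈-trans (≈-≡ (ℤ.*-assoc (+ 2) d (u * u))) (≈-trans (≈-scale (+ 2) (≡≈ d ≈* square≈4 h)) (≈-≡ (sym (ℤ.*-assoc (+ 2) d (v * v)))))

    N≈ : ∀ {w} → M₁ ≈ w [ + 2 ] → N ≈ + 2 * a * (w * w) + + 2 * b * (r * r) + a * b [ + 8 ]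
    N≈ h = double-square a h ≈+ double-square b M₂≈r ≈+ ≡≈ (a * b)

    multiple≈0 : ∀ d z → d * z ≈ 0ℤ [ d ]
    multiple≈0 d z = ≈0 (divides z (ℤ.*-comm d z))

  -- The part of A₀ modulo 8, for even t, that depends neither on M₁ nor on the choice between L = 4
  -- and L = 8.
  C : ℤ
  C = a * b + + 2 * b * (r * r) + + 4 * (B₂ * (1ℤ + r + m) + B₃)

  private
    module _ (T K₁ K₂ K₃ : ℤ) (dir : Direction T K₁ K₂ K₃) where
      T≈1 : T ≈ 1ℤ [ + 2 ]
      T≈1 = ≈-trans (≈-trans (≈-≡ (sym (lem T (pp * (a * (K₁ * M₁) + b * (K₂ * M₂) - a * b * K₃)))))
              (≡≈ T ≈* ≈-sym D′≈1 ≈- ≈-sym (≈0 {+ 16} (divides (+ 8) refl)) ≈* ≡≈ (pp * (a * (K₁ * M₁) + b * (K₂ * M₂) - a * b * K₃)))) (≈-≡ dir)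
        where lem : ∀ T z → T * 1ℤ - 0ℤ * z ≡ T
              lem = solve-∀

      rep-even′ : ∀ {w} → M₁ ≈ w [ + 2 ] → ∀ A → A ≈ 1ℤ + (+ 2 * a * (w * w) + + 2 * b * (r * r) + a * b) [ + 4 ] → Rep (+ 2 * a) (+ 2 * b) A B₁ B₂ B₃
      rep-even′ {w} M₁≈w A A≈ = finish unimodular norm-M (n * T) (+ 8 * (n * K₁)) (+ 8 * (n * K₂)) (+ 8 * (n * K₃)) (+ 2)
          (trans (L-eq (n * T) (+ 8 * (n * K₁)) (+ 8 * (n * K₂)) (+ 8 * (n * K₃))) (mod1 (+ 2 * n) (lem T K₁ K₂ K₃ σ D′ pp a b (a * b) M₁ M₂) dir))
          (≈-trans A≈ (≈-sym (go half)))
        where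
        -- At these points L = 2(n - 2σ), so L = 2; n is odd, hence so is t = nT.
        n = 1ℤ + + 2 * σ
        lem : ∀ T K₁ K₂ K₃ σ D p a b d M₁ M₂ → let n = 1ℤ + + 2 * σ in
          + 2 * (n * T * D - + 2 * σ - + 2 * (p * (a * (+ 8 * (n * K₁) * M₁) + b * (+ 8 * (n * K₂) * M₂) - d * (+ 8 * (n * K₃))))) - + 2
          ≡ + 2 * n * (T * D - + 16 * (p * (a * (K₁ * M₁) + b * (K₂ * M₂) - d * K₃)) - 1ℤ)
        lem = ring! 12 (λ T K₁ K₂ K₃ σ D p a b d M₁ M₂ → let n = # 1 :+ # 2 :* σ in
          # 2 :* (n :* T :* D :- # 2 :* σ :- # 2 :* (p :* (a :* (# 8 :* (n :* K₁) :* M₁) :+ b :* (# 8 :* (n :* K₂) :* M₂) :- d :* (# 8 :* (n :* K₃))))) :- # 2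
          := # 2 :* n :* (T :* D :- # 16 :* (p :* (a :* (K₁ :* M₁) :+ b :* (K₂ :* M₂) :- d :* K₃)) :- # 1)) refl
        t≈1 : n * T ≈ 1ℤ [ + 2 ]
        t≈1 = (≡≈ 1ℤ ≈+ 2≈0 ≈* ≡≈ σ) ≈* T≈1
        k≈ : ∀ K → + 8 * (n * K) ≈ 0ℤ [ + 4 ]
        k≈ K = ≈-weaken (divides (+ 2) refl) (multiple≈0 (+ 8) (n * K))
        lem₂ : ∀ N y a p → 1ℤ * 1ℤ + N - 0ℤ * y - + 2 * a * (p * (0ℤ * 0ℤ)) ≡ 1ℤ + N
        lem₂ = solve-∀
        go : (∃ λ e′ → e ≡ e′ * + 2 × e′ ≈ 1ℤ [ + 2 ]) → A₀ (n * T) (+ 8 * (n * K₁)) (+ 8 * (n * K₂)) (+ 8 * (n * K₃)) ≈ 1ℤ + (+ 2 * a * (w * w) + + 2 * b * (r * r) + a * b) [ + 4 ]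
        go (e′ , ee , _) = ≈-trans (A₀-cong (≡≈ (n * T)) (k≈ K₁) (k≈ K₂) (k≈ K₃)) (≈-trans (≈-≡ (A₀-eq e′ ee (n * T) 0ℤ))
            (≈-trans (square≈4 t≈1 ≈+ ≈-weaken (divides (+ 2) refl) (N≈ M₁≈w) ≈- ≈0 {+ 4} ∣-refl ≈* ≡≈ Y ≈- ≡≈ (+ 2 * a * (pp * (0ℤ * 0ℤ))))
              (≈-≡ (lem₂ (+ 2 * a * (w * w) + + 2 * b * (r * r) + a * b) Y a pp))))
          where
          V₁ = B₁ + n * T * R₁
          V₂ = B₂ + n * T * R₂
          V₃ = B₃ + n * T * (+ 8 * κ)
          Y = e′ * (a * (V₁ * V₁) + b * (V₂ * V₂) + + 2 * (a * b) * (V₃ * V₃)) + c * a * (V₁ * 0ℤ)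

      u≈ : ∀ n {n′} → n ≈ n′ [ + 2 ] → n * T * (n * T) ≈ n′ [ + 2 ]
      u≈ n {n′} h = ≈-trans (square≈ (n * T)) (≈-trans (h ≈* T≈1) (≈-≡ (ℤ.*-identityʳ n′)))

      L-odd : ∀ n h → L (+ 2 * (n * T)) (+ 16 * (n * K₁) + h) (+ 16 * (n * K₂)) (+ 16 * (n * K₃)) ≡ + 4 * (n - σ - pp * (a * (h * M₁)))
      L-odd n h = trans (L-eq (+ 2 * (n * T)) (+ 16 * (n * K₁) + h) (+ 16 * (n * K₂)) (+ 16 * (n * K₃))) (mod1 (+ 4 * n) (lem n h T K₁ K₂ K₃ σ D′ pp a b (a * b) M₁ M₂) dir)
        where lem : ∀ n h T K₁ K₂ K₃ σ D p a b d M₁ M₂ →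
                + 2 * (+ 2 * (n * T) * D - + 2 * σ - + 2 * (p * (a * ((+ 16 * (n * K₁) + h) * M₁) + b * (+ 16 * (n * K₂) * M₂) - d * (+ 16 * (n * K₃))))) - + 4 * (n - σ - p * (a * (h * M₁)))
                ≡ + 4 * n * (T * D - + 16 * (p * (a * (K₁ * M₁) + b * (K₂ * M₂) - d * K₃)) - 1ℤ)
              lem = ring! 14 (λ n h T K₁ K₂ K₃ σ D p a b d M₁ M₂ →
                # 2 :* (# 2 :* (n :* T) :* D :- # 2 :* σ :- # 2 :* (p :* (a :* ((# 16 :* (n :* K₁) :+ h) :* M₁) :+ b :* (# 16 :* (n :* K₂) :* M₂) :- d :* (# 16 :* (n :* K₃))))) :- # 4 :* (n :- σ :- p :* (a :* (h :* M₁)))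
                := # 4 :* n :* (T :* D :- # 16 :* (p :* (a :* (K₁ :* M₁) :+ b :* (K₂ :* M₂) :- d :* K₃)) :- # 1)) refl

      A₀-odd : ∀ n h → A₀ (+ 2 * (n * T)) (+ 16 * (n * K₁) + h) (+ 16 * (n * K₂)) (+ 16 * (n * K₃)) ≈ A₀ (+ 2 * (n * T)) h 0ℤ 0ℤ [ + 8 ]
      A₀-odd n h = A₀-cong (≡≈ (+ 2 * (n * T))) (≈-trans (k≈ K₁ ≈+ ≡≈ h) (≈-≡ (ℤ.+-identityˡ h))) (k≈ K₂) (k≈ K₃)
        where
        k≈ : ∀ K → + 16 * (n * K) ≈ 0ℤ [ + 8 ]
        k≈ K = ≈-weaken (divides (+ 2) refl) (multiple≈0 (+ 16) (n * K))

      rep-odd₁′ : ∀ {w} → M₁ ≈ w [ + 2 ] → ∀ A → A ≈ C + + 2 * a * (w * w) + + 4 [ + 8 ] → Rep (+ 2 * a) (+ 2 * b) A B₁ B₂ B₃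
      rep-odd₁′ {w} M₁≈w A A≈ = finish unimodular norm-M (+ 2 * (n * T)) (+ 16 * (n * K₁) + 0ℤ) (+ 16 * (n * K₂)) (+ 16 * (n * K₃)) (+ 4)
          (trans (L-odd n 0ℤ) (lem σ pp a M₁)) (≈-trans A≈ (≈-sym α≈))
        where
        n = 1ℤ + σ
        lem : ∀ σ p a M → + 4 * (1ℤ + σ - σ - p * (a * (0ℤ * M))) ≡ + 4
        lem = solve-∀
        bracket : n * T * (n * T) - (B₁ * B₁ + B₂ * B₂ + B₁ * 0ℤ) ≈ 1ℤ + (B₂ * (1ℤ + r + m) + B₃) [ + 2 ]
        bracket = ≈-trans (u≈ n (≡≈ 1ℤ ≈+ σ≈) ≈- (square≈ B₁ ≈+ square≈ B₂ ≈+ ≡≈ (B₁ * 0ℤ))) (≈-by (divides (- B₂ - B₃) (lem₂ B₁ B₂ B₃ r m)))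
          where lem₂ : ∀ B₁ B₂ B₃ r m → 1ℤ + (B₁ + B₂ * (r + m) - B₃) - (B₁ + B₂ + B₁ * 0ℤ) - (1ℤ + (B₂ * (1ℤ + r + m) + B₃)) ≡ (- B₂ - B₃) * + 2
                lem₂ = ring! 5 (λ B₁ B₂ B₃ r m → # 1 :+ (B₁ :+ B₂ :* (r :+ m) :- B₃) :- (B₁ :+ B₂ :+ B₁ :* # 0) :- (# 1 :+ (B₂ :* (# 1 :+ r :+ m) :+ B₃)) := (:- B₂ :- B₃) :* # 2) refl
        α≈ : A₀ (+ 2 * (n * T)) (+ 16 * (n * K₁) + 0ℤ) (+ 16 * (n * K₂)) (+ 16 * (n * K₃)) ≈ C + + 2 * a * (w * w) + + 4 [ + 8 ]
        α≈ = ≈-trans (A₀-odd n 0ℤ) (≈-trans (A₀≈ (n * T) 0ℤ) (≈-trans (N≈ M₁≈w ≈+ ≈-scale (+ 4) bracket ≈- ≡≈ (+ 2 * a * (pp * (0ℤ * 0ℤ))))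
               (≈-≡ (lem₃ (+ 2 * a * (w * w)) (+ 2 * b * (r * r)) (a * b) (B₂ * (1ℤ + r + m) + B₃) a pp))))
          where lem₃ : ∀ u v d z a p → u + v + d + + 4 * (1ℤ + z) - + 2 * a * (p * (0ℤ * 0ℤ)) ≡ d + v + + 4 * z + u + + 4
                lem₃ = solve-∀

      -- With L = 8 the number A has to be matched modulo 16. A second starting point comes from
      -- adding (2b, 0, 2M₁) to k: L stays the same, since a·2b·M₁ and ab·2M₁ cancel. It differs by
      -- 8 modulo 16 precisely when k₁ ≡ B₁ modulo 2, which explains the summand B₁ of k₁.
      rep-odd₂′ : ∀ {w} → M₁ ≈ w + B₁ [ + 2 ] → ∀ A → A ≈ C + + 2 * a * (w * w) [ + 8 ] → Rep (+ 2 * a) (+ 2 * b) A B₁ B₂ B₃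
      rep-odd₂′ {w} M₁≈ A A≈ = go (lift-mod (+ 8) (≈-trans A≈ (≈-sym α≈)))
        where
        -- Makes n - σ - (x² + y²)aB₁M₁ equal to 2, hence L = 8 by `L-odd`.
        n = + 2 + σ + pp * (a * (B₁ * M₁))
        t = + 2 * (n * T)
        k₁ = + 16 * (n * K₁) + B₁
        k₂ = + 16 * (n * K₂)
        k₃ = + 16 * (n * K₃)
        w≈ : M₁ + B₁ ≈ w [ + 2 ]
        w≈ = ≈-trans (M₁≈ ≈+ ≡≈ B₁) (≈-by (divides B₁ (lem w B₁)))
          where lem : ∀ w B → w + B + B - w ≡ B * + 2
                lem = solve-∀
        bracket : n * T * (n * T) - (B₁ * B₁ + B₂ * B₂ + B₁ * B₁) ≈ B₂ * (1ℤ + r + m) + B₃ + B₁ * (M₁ - 1ℤ) [ + 2 ]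
        bracket = ≈-trans (u≈ n (2≈0 ≈+ σ≈ ≈+ pp≈1 ≈* (a≈1 ≈* ≡≈ (B₁ * M₁))) ≈- (square≈ B₁ ≈+ square≈ B₂ ≈+ square≈ B₁)) (≈-by (divides (- B₂ - B₃) (lem₂ B₁ B₂ B₃ r m M₁)))
          where lem₂ : ∀ B₁ B₂ B₃ r m M → 0ℤ + (B₁ + B₂ * (r + m) - B₃) + 1ℤ * (1ℤ * (B₁ * M)) - (B₁ + B₂ + B₁) - (B₂ * (1ℤ + r + m) + B₃ + B₁ * (M - 1ℤ)) ≡ (- B₂ - B₃) * + 2
                lem₂ = ring! 6 (λ B₁ B₂ B₃ r m M → # 0 :+ (B₁ :+ B₂ :* (r :+ m) :- B₃) :+ # 1 :* (# 1 :* (B₁ :* M)) :- (B₁ :+ B₂ :+ B₁) :- (B₂ :* (# 1 :+ r :+ m) :+ B₃ :+ B₁ :* (M :- # 1)) := (:- B₂ :- B₃) :* # 2) refl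
        pp-term : + 2 * a * (pp * (B₁ * B₁)) ≈ + 2 * a * (B₁ * B₁) [ + 8 ]
        pp-term = ≈-trans (≈-≡ (ℤ.*-assoc (+ 2) a (pp * (B₁ * B₁)))) (≈-trans (≈-scale (+ 2) (≡≈ a ≈* (sum-of-squares≈1 x y pp-odd ≈* ≡≈ (B₁ * B₁)))) (≈-≡ (lem a (B₁ * B₁))))
          where lem : ∀ a z → + 2 * (a * (1ℤ * z)) ≡ + 2 * a * z
                lem = solve-∀
        -- The terms brought in by k₁ ≡ B₁ turn M₁² into (M₁ + B₁)²; therefore w is the residue of
        -- M₁ + B₁ here and not that of M₁.
        complete-square : + 2 * a * (M₁ * M₁) + + 4 * (B₁ * (M₁ - 1ℤ)) - + 2 * a * (B₁ * B₁) ≈ + 2 * a * ((M₁ + B₁) * (M₁ + B₁)) [ + 8 ]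
        complete-square = ≈-trans (≈-≡ (lem₁ a M₁ B₁)) (≈-trans (≡≈ (+ 2 * a * ((M₁ + B₁) * (M₁ + B₁))) ≈- ≈-scale (+ 4) z≈0) (≈-≡ (lem₃ (+ 2 * a * ((M₁ + B₁) * (M₁ + B₁))))))
          where
          lem₁ : ∀ a M B → + 2 * a * (M * M) + + 4 * (B * (M - 1ℤ)) - + 2 * a * (B * B) ≡ + 2 * a * ((M + B) * (M + B)) - + 4 * (a * (M * B + B * B) - (M * B - B))
          lem₁ = ring! 3 (λ a M B → # 2 :* a :* (M :* M) :+ # 4 :* (B :* (M :- # 1)) :- # 2 :* a :* (B :* B) := # 2 :* a :* ((M :+ B) :* (M :+ B)) :- # 4 :* (a :* (M :* B :+ B :* B) :- (M :* B :- B))) refl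
          lem₂ : ∀ M B → 1ℤ * (M * B + B) - (M * B - B) - 0ℤ ≡ B * + 2
          lem₂ = solve-∀
          z≈0 : a * (M₁ * B₁ + B₁ * B₁) - (M₁ * B₁ - B₁) ≈ 0ℤ [ + 2 ]
          z≈0 = ≈-trans (a≈1 ≈* (≡≈ (M₁ * B₁) ≈+ square≈ B₁) ≈- ≡≈ (M₁ * B₁ - B₁)) (≈-by (divides B₁ (lem₂ M₁ B₁)))
          lem₃ : ∀ u → u - + 4 * 0ℤ ≡ u
          lem₃ = solve-∀
        α≈ : A₀ t k₁ k₂ k₃ ≈ C + + 2 * a * (w * w) [ + 8 ]
        α≈ = ≈-trans (A₀-odd n B₁) (≈-trans (A₀≈ (n * T) B₁) (≈-trans (N≈r ≈+ ≈-scale (+ 4) bracket ≈- pp-term)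
               (≈-trans (≈-≡ (lem₁ (+ 2 * a * (M₁ * M₁)) (+ 2 * b * (r * r)) (a * b) (B₂ * (1ℤ + r + m) + B₃) (B₁ * (M₁ - 1ℤ)) (+ 2 * a * (B₁ * B₁))))
                 (≡≈ C ≈+ ≈-trans complete-square (double-square a w≈)))))
          where
          N≈r : N ≈ + 2 * a * (M₁ * M₁) + + 2 * b * (r * r) + a * b [ + 8 ]
          N≈r = N≈ (≡≈ M₁)
          lem₁ : ∀ u v d z y p → u + v + d + + 4 * (z + y) - p ≡ d + v + + 4 * z + (u + + 4 * y - p)
          lem₁ = solve-∀
        V₁ = B₁ + t * R₁
        V₃ = B₃ + t * (+ 8 * κ)
        δ = c * (a * b * V₁) + + 2 * (c * (a * b * (V₃ * M₁))) + pp * (a * b * (k₁ + b + + 2 * (M₁ * k₃ + M₁ * M₁)))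
        shift : A₀ t (k₁ + + 2 * b) k₂ (k₃ + + 2 * M₁) ≡ A₀ t k₁ k₂ k₃ - + 8 * δ
        shift = lem (t * t + pp - (+ 2 * a * (R₁ * R₁) + + 2 * b * (R₂ * R₂) + + 2 * a * (+ 2 * b) * (+ 8 * κ * (+ 8 * κ)))
            - e * (+ 2 * a * (V₁ * V₁) + + 2 * b * (V₂ * V₂) + + 2 * a * (+ 2 * b) * (V₃ * V₃))) a b c pp V₁ V₂ V₃ k₁ k₂ k₃ M₁
          where
          V₂ = B₂ + t * R₂
          lem : ∀ s a b c p V₁ V₂ V₃ k₁ k₂ k₃ M → let d = + 2 * a * (+ 2 * b) in
            s - + 2 * c * (+ 2 * a * (V₁ * (k₁ + + 2 * b)) + + 2 * b * (V₂ * k₂) + d * (V₃ * (k₃ + + 2 * M)))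
              - p * (+ 2 * a * ((k₁ + + 2 * b) * (k₁ + + 2 * b)) + + 2 * b * (k₂ * k₂) + d * ((k₃ + + 2 * M) * (k₃ + + 2 * M)))
            ≡ s - + 2 * c * (+ 2 * a * (V₁ * k₁) + + 2 * b * (V₂ * k₂) + d * (V₃ * k₃))
              - p * (+ 2 * a * (k₁ * k₁) + + 2 * b * (k₂ * k₂) + d * (k₃ * k₃))
              - + 8 * (c * (a * b * V₁) + + 2 * (c * (a * b * (V₃ * M))) + p * (a * b * (k₁ + b + + 2 * (M * k₃ + M * M))))
          lem = ring! 12 (λ s a b c p V₁ V₂ V₃ k₁ k₂ k₃ M → let d = # 2 :* a :* (# 2 :* b) in
            s :- # 2 :* c :* (# 2 :* a :* (V₁ :* (k₁ :+ # 2 :* b)) :+ # 2 :* b :* (V₂ :* k₂) :+ d :* (V₃ :* (k₃ :+ # 2 :* M)))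
              :- p :* (# 2 :* a :* ((k₁ :+ # 2 :* b) :* (k₁ :+ # 2 :* b)) :+ # 2 :* b :* (k₂ :* k₂) :+ d :* ((k₃ :+ # 2 :* M) :* (k₃ :+ # 2 :* M)))
            := s :- # 2 :* c :* (# 2 :* a :* (V₁ :* k₁) :+ # 2 :* b :* (V₂ :* k₂) :+ d :* (V₃ :* k₃))
              :- p :* (# 2 :* a :* (k₁ :* k₁) :+ # 2 :* b :* (k₂ :* k₂) :+ d :* (k₃ :* k₃))
              :- # 8 :* (c :* (a :* b :* V₁) :+ # 2 :* (c :* (a :* b :* (V₃ :* M))) :+ p :* (a :* b :* (k₁ :+ b :+ # 2 :* (M :* k₃ :+ M :* M))))) refl
        δ≈1 : δ ≈ 1ℤ [ + 2 ]
        δ≈1 = ≈-trans (c≈1 ≈* (a≈1 ≈* b≈1 ≈* (≡≈ B₁ ≈+ 2≈0 ≈* ≡≈ (n * T) ≈* ≡≈ R₁)) ≈+ 2≈0 ≈* ≡≈ (c * (a * b * (V₃ * M₁)))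
               ≈+ pp≈1 ≈* (a≈1 ≈* b≈1 ≈* (≈0 (divides (+ 8) refl) ≈* ≡≈ (n * K₁) ≈+ ≡≈ B₁ ≈+ b≈1 ≈+ 2≈0 ≈* ≡≈ (M₁ * k₃ + M₁ * M₁))))
             (≈-by (divides B₁ (lem B₁ (n * T) R₁ (c * (a * b * (V₃ * M₁))) (n * K₁) (M₁ * k₃ + M₁ * M₁))))
          where lem : ∀ B u R v w z → 1ℤ * (1ℤ * 1ℤ * (B + 0ℤ * u * R)) + 0ℤ * v + 1ℤ * (1ℤ * 1ℤ * (0ℤ * w + B + 1ℤ + 0ℤ * z)) - 1ℤ ≡ B * + 2
                lem = ring! 6 (λ B u R v w z → # 1 :* (# 1 :* # 1 :* (B :+ # 0 :* u :* R)) :+ # 0 :* v :+ # 1 :* (# 1 :* # 1 :* (# 0 :* w :+ B :+ # 1 :+ # 0 :* z)) :- # 1 := B :* # 2) refl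
        α′≈ : A₀ t (k₁ + + 2 * b) k₂ (k₃ + + 2 * M₁) ≈ A₀ t k₁ k₂ k₃ + + 8 [ + 16 ]
        α′≈ = ≈-trans (≈-≡ shift) (≈-trans (≡≈ (A₀ t k₁ k₂ k₃) ≈- ≈-scale (+ 8) δ≈1) (≈-by (divides (- 1ℤ) (lem (A₀ t k₁ k₂ k₃)))))
          where lem : ∀ u → u - + 8 - (u + + 8) ≡ - 1ℤ * + 16
                lem = solve-∀
        L≡8 : L t k₁ k₂ k₃ ≡ + 8
        L≡8 = trans (L-odd n B₁) (lem σ pp a B₁ M₁)
          where lem : ∀ σ p a B M → + 4 * (+ 2 + σ + p * (a * (B * M)) - σ - p * (a * (B * M))) ≡ + 8
                lem = solve-∀
        L′≡8 : L t (k₁ + + 2 * b) k₂ (k₃ + + 2 * M₁) ≡ + 8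
        L′≡8 = trans (L-eq t (k₁ + + 2 * b) k₂ (k₃ + + 2 * M₁)) (trans (lem t D′ σ pp a b M₁ M₂ k₁ k₂ k₃) (trans (sym (L-eq t k₁ k₂ k₃)) L≡8))
          where lem : ∀ t D σ p a b M₁ M₂ k₁ k₂ k₃ → + 2 * (t * D - + 2 * σ - + 2 * (p * (a * ((k₁ + + 2 * b) * M₁) + b * (k₂ * M₂) - a * b * (k₃ + + 2 * M₁))))
                   ≡ + 2 * (t * D - + 2 * σ - + 2 * (p * (a * (k₁ * M₁) + b * (k₂ * M₂) - a * b * k₃)))
                lem = ring! 11 (λ t D σ p a b M₁ M₂ k₁ k₂ k₃ → # 2 :* (t :* D :- # 2 :* σ :- # 2 :* (p :* (a :* ((k₁ :+ # 2 :* b) :* M₁) :+ b :* (k₂ :* M₂) :- a :* b :* (k₃ :+ # 2 :* M₁))))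
                   := # 2 :* (t :* D :- # 2 :* σ :- # 2 :* (p :* (a :* (k₁ :* M₁) :+ b :* (k₂ :* M₂) :- a :* b :* k₃)))) refl
        go : A ≈ A₀ t k₁ k₂ k₃ [ + 16 ] ⊎ A ≈ A₀ t k₁ k₂ k₃ + + 8 [ + 16 ] → Rep (+ 2 * a) (+ 2 * b) A B₁ B₂ B₃
        go (inj₁ h) = finish unimodular norm-M t k₁ k₂ k₃ (+ 8) L≡8 h
        go (inj₂ h) = finish unimodular norm-M t (k₁ + + 2 * b) k₂ (k₃ + + 2 * M₁) (+ 8) L′≡8 (≈-trans h (≈-sym α′≈))

  rep-even : ∀ {w} → M₁ ≈ w [ + 2 ] → ∀ A → A ≈ 1ℤ + (+ 2 * a * (w * w) + + 2 * b * (r * r) + a * b) [ + 4 ] → Rep (+ 2 * a) (+ 2 * b) A B₁ B₂ B₃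
  rep-even h A A≈ = go direction
    where go : (∃₂ λ T K₁ → ∃₂ λ K₂ K₃ → Direction T K₁ K₂ K₃) → Rep (+ 2 * a) (+ 2 * b) A B₁ B₂ B₃
          go (T , K₁ , K₂ , K₃ , dir) = rep-even′ T K₁ K₂ K₃ dir h A A≈

  rep-odd₁ : ∀ {w} → M₁ ≈ w [ + 2 ] → ∀ A → A ≈ C + + 2 * a * (w * w) + + 4 [ + 8 ] → Rep (+ 2 * a) (+ 2 * b) A B₁ B₂ B₃
  rep-odd₁ h A A≈ = go direction
    where go : (∃₂ λ T K₁ → ∃₂ λ K₂ K₃ → Direction T K₁ K₂ K₃) → Rep (+ 2 * a) (+ 2 * b) A B₁ B₂ B₃
          go (T , K₁ , K₂ , K₃ , dir) = rep-odd₁′ T K₁ K₂ K₃ dir h A A≈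

  rep-odd₂ : ∀ {w} → M₁ ≈ w + B₁ [ + 2 ] → ∀ A → A ≈ C + + 2 * a * (w * w) [ + 8 ] → Rep (+ 2 * a) (+ 2 * b) A B₁ B₂ B₃
  rep-odd₂ {w} h A A≈ = go direction
    where go : (∃₂ λ T K₁ → ∃₂ λ K₂ K₃ → Direction T K₁ K₂ K₃) → Rep (+ 2 * a) (+ 2 * b) A B₁ B₂ B₃
          go (T , K₁ , K₂ , K₃ , dir) = rep-odd₂′ T K₁ K₂ K₃ dir {w} h A A≈

-- Choice of parities, with multiplication of α or β by i

rotate₁ : ∀ {A₁ A₂ A₃} → NormSum A₁ A₂ A₃ → NormSum A₁ A₂ A₃
rotate₁ {A₁} {A₂} {A₃} n = record { g = g ; Y = Y ; r₁ = - m₁ ; m₁ = r₁ ; r₂ = r₂ ; m₂ = m₂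
    ; value = trans value (lem A₁ r₁ m₁ (A₂ * (r₂ * r₂ + m₂ * m₂)) A₃) ; g∥Y = g∥Y ; p-odd = p-odd ; p∥A₃ = p∥A₃ }
  where
  open NormSum n
  lem : ∀ A r m u v → A * (r * r + m * m) + u + v ≡ A * (- m * - m + r * r) + u + v
  lem = solve-∀

rotate₂ : ∀ {A₁ A₂ A₃} → NormSum A₁ A₂ A₃ → NormSum A₁ A₂ A₃
rotate₂ {A₁} {A₂} {A₃} n = record { g = g ; Y = Y ; r₁ = r₁ ; m₁ = m₁ ; r₂ = - m₂ ; m₂ = r₂
    ; value = trans value (lem A₂ r₂ m₂ (A₁ * (r₁ * r₁ + m₁ * m₁)) A₃) ; g∥Y = g∥Y ; p-odd = p-odd ; p∥A₃ = p∥A₃ }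
  where
  open NormSum n
  lem : ∀ A r m u v → u + A * (r * r + m * m) + v ≡ u + A * (- m * - m + r * r) + v
  lem = solve-∀

≈-neg : ∀ z → - z ≈ z [ + 2 ]
≈-neg z = ≈-by (divides (- z) (lem z))
  where lem : ∀ z → - z - z ≡ - z * + 2
        lem = solve-∀

≈-of-sum : ∀ {u v} → + 2 ∣ u + v → u ≈ v [ + 2 ]
≈-of-sum {u} {v} d = ≈-by (by2 1ℤ (- v) (lem u v) d ∣-refl)
  where lem : ∀ u v → u - v ≡ 1ℤ * (u + v) + - v * + 2
        lem = solve-∀

1≉0 : ¬ 1ℤ ≈ 0ℤ [ + 2 ]
1≉0 h = 2∤1 (∣-of h)

≉0 : ∀ {z} → z ≈ 1ℤ [ + 2 ] → ¬ + 2 ∣ z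
≉0 h d = 1≉0 (≈-trans (≈-sym h) (≈0 d))

split-primes : ∀ {a b} → Admissible a b → ∀ q → Prime q → + q ∣ a * b → (+ q ∣ a × ¬ + q ∣ b) ⊎ (+ q ∣ b × ¬ + q ∣ a)
split-primes {a} {b} adm q pq d with euclid {q} {a} {b} pq d
... | inj₁ h = inj₁ (h , Admissible.disjoint adm q pq h)
... | inj₂ h = inj₂ (h , λ h′ → Admissible.disjoint adm q pq h′ h)

strip-2 : ∀ q → Prime q → q ≢ 2 → ∀ z → + q ∣ + 2 * z → + q ∣ z
strip-2 q pq q≢2 z d with euclid {q} {+ 2} {z} pq d
... | inj₁ h = ⊥-elim (odd-prime∤2 pq q≢2 h)
... | inj₂ h = h

∤-2* : ∀ q → Prime q → q ≢ 2 → ∀ z → ¬ + q ∣ z → ¬ + q ∣ + 2 * z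
∤-2* q pq q≢2 z h d = h (strip-2 q pq q≢2 z d)

module _ {a b : ℤ} (adm : Admissible a b) (i : Isotropic a b) (prim : Primitive i)
         (avoid : ∀ q → Prime q → + q ∣ + 2 * (a * b) → ¬ + q ∣ Isotropic.P i) (B₁ B₂ B₃ : ℤ) where
  open Admissible adm

  private
    a≢0 : a ≢ 0ℤ
    a≢0 = ∤⇒≢0 odd-a
    b≢0 : b ≢ 0ℤ
    b≢0 = ∤⇒≢0 odd-b
    ab-odd : ¬ + 2 ∣ a * b
    ab-odd = ∤-* {2} {a} {b} prime[2] odd-a odd-b

  -- p is odd and A₃ even, so one of r₁, r₂, m₁, m₂ is odd. A rotation makes it r₁ or r₂, which are
  -- M₁ and M₂ modulo 2; this settles the coprimality of the coefficients of L at 2.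
  represent-odd : ∀ A → Rep a b A B₁ B₂ B₃
  represent-odd A = choose (norm-sum-odd adm i prim avoid)
    where
    primes : ∀ q → Prime q → q ≢ 2 → + q ∣ + 4 * (a * b) → (+ q ∣ a × ¬ + q ∣ b) ⊎ (+ q ∣ b × ¬ + q ∣ a)
    primes q pq q≢2 d = split-primes adm q pq (strip-2 q pq q≢2 (a * b) (strip-2 q pq q≢2 (+ 2 * (a * b)) (subst (+ q ∣_) (lem (a * b)) d)))
      where lem : ∀ d → + 4 * d ≡ + 2 * (+ 2 * d)
            lem = solve-∀
    use : (n : NormSum a b (+ 4 * (a * b))) → ¬ + 2 ∣ NormSum.r₁ n ⊎ ¬ + 2 ∣ NormSum.r₂ n → Rep a b A B₁ B₂ B₃
    use n h = go (slice n (*-≢0 {+ 4} (λ ()) (*-≢0 a≢0 b≢0)) primes)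
      where
      open NormSum n
      go : SliceOf n (*-≢0 {+ 4} (λ ()) (*-≢0 a≢0 b≢0)) primes → Rep a b A B₁ B₂ B₃
      go (s , (dM₁ , dM₂) , _) = NotBothEven.rep-odd s (odd h) B₁ B₂ B₃ (≈1 odd-a) (≈1 odd-b) A
        where
        open Slice s
        odd : ¬ + 2 ∣ r₁ ⊎ ¬ + 2 ∣ r₂ → ¬ + 2 ∣ a * M₁ ⊎ ¬ + 2 ∣ b * M₂
        odd (inj₁ r) = inj₁ (∤-* {2} {a} {M₁} prime[2] odd-a (≉0 (≈-trans (≈-by dM₁) (≈1 r))))
        odd (inj₂ r) = inj₂ (∤-* {2} {b} {M₂} prime[2] odd-b (≉0 (≈-trans (≈-by dM₂) (≈1 r))))
    choose : NormSum a b (+ 4 * (a * b)) → Rep a b A B₁ B₂ B₃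
    choose n = go (+ 2 ∣? r₁) (+ 2 ∣? r₂) (+ 2 ∣? m₁) (+ 2 ∣? m₂)
      where
      open NormSum n
      -odd : ∀ m → ¬ + 2 ∣ m → ¬ + 2 ∣ - m
      -odd m h = ≉0 (≈-trans (≈-neg m) (≈1 h))
      go : Dec (+ 2 ∣ r₁) → Dec (+ 2 ∣ r₂) → Dec (+ 2 ∣ m₁) → Dec (+ 2 ∣ m₂) → Rep a b A B₁ B₂ B₃
      go (no h) _ _ _ = use n (inj₁ h)
      go _ (no h) _ _ = use n (inj₂ h)
      go _ _ (no h) _ = use (rotate₁ n) (inj₁ (-odd m₁ h))
      go _ _ _ (no h) = use (rotate₂ n) (inj₂ (-odd m₂ h))
      go (yes d₁) (yes d₂) (yes d₃) (yes d₄) = ⊥-elim (p-odd (subst (+ 2 ∣_) (sym value) (∣-of (≈-trans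
          (≡≈ a ≈* (≈0 d₁ ≈* ≈0 d₁ ≈+ ≈0 d₃ ≈* ≈0 d₃) ≈+ ≡≈ b ≈* (≈0 d₂ ≈* ≈0 d₂ ≈+ ≈0 d₄ ≈* ≈0 d₄) ≈+ ≈0 {+ 4} (divides (+ 2) refl) ≈* ≡≈ (a * b))
          (≈-≡ (lem a b (a * b)))))))
        where lem : ∀ a b d → a * (0ℤ * 0ℤ + 0ℤ * 0ℤ) + b * (0ℤ * 0ℤ + 0ℤ * 0ℤ) + 0ℤ * d ≡ 0ℤ
              lem = solve-∀

  represent-one-even : ∀ A → Rep (+ 2 * a) b A B₁ B₂ B₃
  represent-one-even A = use (subst (λ A₃ → ∃ λ (n : NormSum (+ 2 * a) b A₃) → ¬ + 2 ∣ NormSum.r₂ n) (lem₀ a b) (norm-sum-one-even adm i prim avoid))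
    where
    lem₀ : ∀ a b → a * b * + 8 ≡ + 4 * (+ 2 * a * b)
    lem₀ = solve-∀
    A₃≢0 : + 4 * (+ 2 * a * b) ≢ 0ℤ
    A₃≢0 = *-≢0 {+ 4} (λ ()) (*-≢0 (*-≢0 {+ 2} (λ ()) a≢0) b≢0)
    primes : ∀ q → Prime q → q ≢ 2 → + q ∣ + 4 * (+ 2 * a * b) → (+ q ∣ + 2 * a × ¬ + q ∣ b) ⊎ (+ q ∣ b × ¬ + q ∣ + 2 * a)
    primes q pq q≢2 d = go (split-primes adm q pq (strip-2 q pq q≢2 (a * b) (strip-2 q pq q≢2 (+ 2 * (a * b)) (strip-2 q pq q≢2 (+ 2 * (+ 2 * (a * b))) (subst (+ q ∣_) (lem a b) d)))))
      where
      lem : ∀ a b → + 4 * (+ 2 * a * b) ≡ + 2 * (+ 2 * (+ 2 * (a * b)))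
      lem = solve-∀
      go : (+ q ∣ a × ¬ + q ∣ b) ⊎ (+ q ∣ b × ¬ + q ∣ a) → (+ q ∣ + 2 * a × ¬ + q ∣ b) ⊎ (+ q ∣ b × ¬ + q ∣ + 2 * a)
      go (inj₁ (h , h′)) = inj₁ (∣n⇒∣m*n (+ 2) h , h′)
      go (inj₂ (h , h′)) = inj₂ (h , ∤-2* q pq q≢2 a h′)
    use : (∃ λ (n : NormSum (+ 2 * a) b (+ 4 * (+ 2 * a * b))) → ¬ + 2 ∣ NormSum.r₂ n) → Rep (+ 2 * a) b A B₁ B₂ B₃
    use (n , r₂-odd) = go (slice n A₃≢0 primes)
      where
      open NormSum n
      -- p ≡ b(r₂² + m₂²) modulo 2, where p, b and r₂ are odd.
      m₂≈0 : m₂ ≈ 0ℤ [ + 2 ]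
      m₂≈0 = ≈-trans (≈-sym (square≈ m₂)) (≈-trans (≈-≡ (lem a (r₁ * r₁ + m₁ * m₁) (m₂ * m₂) (+ 2 * a * b)))
          (≈-trans (≈-sym (≈0 ∣-refl ≈* ≡≈ a ≈* ≡≈ (r₁ * r₁ + m₁ * m₁) ≈+ ≈1 odd-b ≈* (≈1 r₂-odd ≈* ≈1 r₂-odd ≈+ ≡≈ (m₂ * m₂))
              ≈+ ≈0 (divides (+ 2) refl) ≈* ≡≈ (+ 2 * a * b)) ≈- ≡≈ 1ℤ)
            (≈-trans (≈-≡ (cong (_- 1ℤ) (sym value))) (≈1 p-odd ≈- ≡≈ 1ℤ))))
        where lem : ∀ a u z d → z ≡ 0ℤ * a * u + 1ℤ * (1ℤ * 1ℤ + z) + 0ℤ * d - 1ℤ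
              lem = solve-∀
      ab≈2 : + 2 * a * b ≈ + 2 [ + 4 ]
      ab≈2 = ≈-trans (≈-≡ (ℤ.*-assoc (+ 2) a b)) (≈-scale (+ 2) (≈1 ab-odd))
      go : SliceOf n A₃≢0 primes → Rep (+ 2 * a) b A B₁ B₂ B₃
      go (s , (_ , dM₂) , (_ , dR₂)) = NotBothEven.rep-one-even s (inj₂ (∤-* {2} {b} {M₂} prime[2] odd-b (≉0 M₂≈1))) B₁ B₂ B₃
          (≈0 (∣m⇒∣m*n a ∣-refl)) (≈1 odd-b) ab≈2 M₂≈1 (≈-trans (≈-of-sum {R₂} {m₂} dR₂) m₂≈0) A
        where
        open Slice s
        M₂≈1 : M₂ ≈ 1ℤ [ + 2 ]
        M₂≈1 = ≈-trans (≈-by dM₂) (≈1 r₂-odd)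

  represent-both-even : ∀ A → Rep (+ 2 * a) (+ 2 * b) A B₁ B₂ B₃
  represent-both-even A = use (subst (λ A₃ → ∃ λ (n : NormSum (+ 2 * a) (+ 2 * b) A₃) → ¬ + 2 ∣ NormSum.r₁ n + NormSum.m₁ n) (ℤ.*-identityʳ (a * b)) (norm-sum-both-even adm i prim avoid))
    where
    A₃≢0 : a * b ≢ 0ℤ
    A₃≢0 = *-≢0 a≢0 b≢0
    primes : ∀ q → Prime q → q ≢ 2 → + q ∣ a * b → (+ q ∣ + 2 * a × ¬ + q ∣ + 2 * b) ⊎ (+ q ∣ + 2 * b × ¬ + q ∣ + 2 * a)
    primes q pq q≢2 d = go (split-primes adm q pq d)
      where
      go : (+ q ∣ a × ¬ + q ∣ b) ⊎ (+ q ∣ b × ¬ + q ∣ a) → (+ q ∣ + 2 * a × ¬ + q ∣ + 2 * b) ⊎ (+ q ∣ + 2 * b × ¬ + q ∣ + 2 * a)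
      go (inj₁ (h , h′)) = inj₁ (∣n⇒∣m*n (+ 2) h , ∤-2* q pq q≢2 b h′)
      go (inj₂ (h , h′)) = inj₂ (∣n⇒∣m*n (+ 2) h , ∤-2* q pq q≢2 a h′)
    use : (∃ λ (n : NormSum (+ 2 * a) (+ 2 * b) (a * b)) → ¬ + 2 ∣ NormSum.r₁ n + NormSum.m₁ n) → Rep (+ 2 * a) (+ 2 * b) A B₁ B₂ B₃
    use (n , r₁+m₁-odd) = select (parity A 0ℤ)
      where
      open NormSum n
      a≈1 = ≈1 odd-a
      b≈1 = ≈1 odd-b
      Goal = Rep (+ 2 * a) (+ 2 * b) A B₁ B₂ B₃
      Cont : ℤ → Set
      Cont w = (s : Slice (+ 2 * a) (+ 2 * b) (a * b)) → let open Slice s in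
        M₁ ≈ w [ + 2 ] → M₂ ≈ r₂ [ + 2 ] → R₂ ≈ m₂ [ + 2 ] → R₁ + M₁ ≈ 1ℤ [ + 2 ] → Goal
      -- Since r₁ + m₁ is odd, either α or iα has real part congruent to w, and the rotation
      -- preserves the parity of r₁ + m₁ and leaves r₂, m₂ alone.
      with-slice : ∀ w → Cont w → Goal
      with-slice w k = rot (parity r₁ w)
        where
        go : (n′ : NormSum (+ 2 * a) (+ 2 * b) (a * b)) → NormSum.r₁ n′ ≈ w [ + 2 ] → NormSum.m₁ n′ + NormSum.r₁ n′ ≈ 1ℤ [ + 2 ] → NormSum.r₂ n′ ≡ r₂ → NormSum.m₂ n′ ≡ m₂ →
          SliceOf n′ A₃≢0 primes → Goal
        go n′ r≈ h refl refl (s , (dM₁ , dM₂) , (dR₁ , dR₂)) = k s (≈-trans (≈-by dM₁) r≈) (≈-by dM₂) (≈-of-sum {R₂} {m₂} dR₂)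
            (≈-trans (≈-of-sum {R₁} {NormSum.m₁ n′} dR₁ ≈+ ≈-by dM₁) h)
          where open Slice s
        rot : r₁ ≈ w [ + 2 ] ⊎ r₁ ≈ w + 1ℤ [ + 2 ] → Goal
        rot (inj₁ h) = go n h (≈-trans (≈-≡ (ℤ.+-comm m₁ r₁)) (≈1 r₁+m₁-odd)) refl refl (slice n A₃≢0 primes)
        rot (inj₂ h) = go (rotate₁ n) (≈-trans (≈-≡ (lem r₁ m₁)) (≈-trans (h ≈- ≈1 r₁+m₁-odd) (≈-≡ (lem′ w))))
            (≈-trans (≡≈ r₁ ≈+ ≈-neg m₁) (≈1 r₁+m₁-odd)) refl refl (slice (rotate₁ n) A₃≢0 primes)
          where lem : ∀ r m → - m ≡ r - (r + m)
                lem = solve-∀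
                lem′ : ∀ w → w + 1ℤ - 1ℤ ≡ w
                lem′ = solve-∀
      2≈0 : + 2 ≈ 0ℤ [ + 2 ]
      2≈0 = ≈0 ∣-refl
      2a≈2 : + 2 * a ≈ + 2 [ + 4 ]
      2a≈2 = ≈-scale (+ 2) a≈1
      -- The residues of A that are reached modulo 4, for even and odd A. Passing from w = 0 to w =
      -- 1 adds 2a ≡ 2, so each function covers both classes of its parity.
      E C : ℤ → ℤ
      E w = 1ℤ + (+ 2 * a * (w * w) + + 2 * b * (r₂ * r₂) + a * b)
      C w = a * b + + 2 * b * (r₂ * r₂) + + 4 * (B₂ * (1ℤ + r₂ + m₂) + B₃) + + 2 * a * (w * w)
      even : ∀ w → A ≈ E w [ + 4 ] → Goal
      even w h = with-slice w (λ s h₁ h₂ h₃ h₄ → BothEven.rep-even a≈1 b≈1 s r₂ m₂ h₂ h₃ h₄ B₁ B₂ B₃ {w} h₁ A h)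
      -- Modulo 8 the class splits in two: C w is served by the step 16, with M₁ ≡ w + B₁, and C w +
      -- 4 by the step 8, with M₁ ≡ w.
      odd : ∀ w → A ≈ C w [ + 4 ] → Goal
      odd w h = lifted (lift-mod (+ 4) h)
        where
        lifted : A ≈ C w [ + 8 ] ⊎ A ≈ C w + + 4 [ + 8 ] → Goal
        lifted (inj₁ h) = with-slice (w + B₁) (λ s h₁ h₂ h₃ h₄ → BothEven.rep-odd₂ a≈1 b≈1 s r₂ m₂ h₂ h₃ h₄ B₁ B₂ B₃ {w} h₁ A h)
        lifted (inj₂ h) = with-slice w (λ s h₁ h₂ h₃ h₄ → BothEven.rep-odd₁ a≈1 b≈1 s r₂ m₂ h₂ h₃ h₄ B₁ B₂ B₃ {w} h₁ A h)
      select : A ≈ 0ℤ [ + 2 ] ⊎ A ≈ 0ℤ + 1ℤ [ + 2 ] → Goal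
      select (inj₁ A≈0) = go (lift-mod (+ 2) (≈-trans A≈0 (≈-sym E≈0)))
        where
        lem : ∀ a b z → 1ℤ + (0ℤ * a * (0ℤ * 0ℤ) + 0ℤ * b * z + 1ℤ * 1ℤ) - 0ℤ ≡ 1ℤ * + 2
        lem = solve-∀
        E≈0 : E 0ℤ ≈ 0ℤ [ + 2 ]
        E≈0 = ≈-trans (≡≈ 1ℤ ≈+ (2≈0 ≈* ≡≈ a ≈* ≡≈ (0ℤ * 0ℤ) ≈+ 2≈0 ≈* ≡≈ b ≈* ≡≈ (r₂ * r₂) ≈+ a≈1 ≈* b≈1)) (≈-by (divides 1ℤ (lem a b (r₂ * r₂))))
        lem₁ : ∀ a u v → 1ℤ + (a * (0ℤ * 0ℤ) + u + v) + + 2 ≡ 1ℤ + (+ 2 * (1ℤ * 1ℤ) + u + v)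
        lem₁ = solve-∀
        go : A ≈ E 0ℤ [ + 4 ] ⊎ A ≈ E 0ℤ + + 2 [ + 4 ] → Goal
        go (inj₁ h) = even 0ℤ h
        go (inj₂ h) = even 1ℤ (≈-trans h (≈-trans (≈-≡ (lem₁ (+ 2 * a) (+ 2 * b * (r₂ * r₂)) (a * b)))
            (≡≈ 1ℤ ≈+ (≈-sym 2a≈2 ≈* ≡≈ (1ℤ * 1ℤ) ≈+ ≡≈ (+ 2 * b * (r₂ * r₂)) ≈+ ≡≈ (a * b)))))
      select (inj₂ A≈1) = go (lift-mod (+ 2) (≈-trans A≈1 (≈-sym C≈1)))
        where
        lem : ∀ a b z u → 1ℤ * 1ℤ + 0ℤ * b * z + 0ℤ * u + 0ℤ * a * (0ℤ * 0ℤ) ≡ 1ℤ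
        lem = solve-∀
        C≈1 : C 0ℤ ≈ 1ℤ [ + 2 ]
        C≈1 = ≈-trans (a≈1 ≈* b≈1 ≈+ 2≈0 ≈* ≡≈ b ≈* ≡≈ (r₂ * r₂) ≈+ ≈0 {+ 4} (divides (+ 2) refl) ≈* ≡≈ (B₂ * (1ℤ + r₂ + m₂) + B₃) ≈+ 2≈0 ≈* ≡≈ a ≈* ≡≈ (0ℤ * 0ℤ))
            (≈-≡ (lem a b (r₂ * r₂) (B₂ * (1ℤ + r₂ + m₂) + B₃)))
        lem₁ : ∀ a u → u + a * (0ℤ * 0ℤ) + + 2 ≡ u + + 2 * (1ℤ * 1ℤ)
        lem₁ = solve-∀
        C′ = a * b + + 2 * b * (r₂ * r₂) + + 4 * (B₂ * (1ℤ + r₂ + m₂) + B₃)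
        go : A ≈ C 0ℤ [ + 4 ] ⊎ A ≈ C 0ℤ + + 2 [ + 4 ] → Goal
        go (inj₁ h) = odd 0ℤ h
        go (inj₂ h) = odd 1ℤ (≈-trans h (≈-trans (≈-≡ (lem₁ (+ 2 * a) C′)) (≡≈ C′ ≈+ ≈-sym 2a≈2 ≈* ≡≈ (1ℤ * 1ℤ))))

-- Squarefree coefficients and the lower bound

squarefree⇒∤ : ∀ {n} → SquareFree (+ n) → ∀ p → Prime p → ¬ + p * + p ∣ + n
squarefree⇒∤ sf p pr d = ¬prime[1] (subst Prime (sf (+ p) (∣⇒∣ᵤ d)) pr)

-- A common prime of a and b divides their gcd, which is at most 2; it is therefore 2 and does not
-- divide the odd parts.
admissible : ∀ {a b a′ b′} → a ≢ 0 → SquareFree (+ a) → SquareFree (+ b) → gcd (+ a) (+ b) ≤ + 2 →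
  + a′ ∣ + a → + b′ ∣ + b → ¬ + 2 ∣ + a′ → ¬ + 2 ∣ + b′ → Admissible (+ a′) (+ b′)
admissible {a} {b} {a′} a≢0 sfa sfb g≤2 da db odd-a odd-b = record
  { odd-a = odd-a ; odd-b = odd-b
  ; disjoint = λ p pr d d′ → odd-a (subst (λ q → + q ∣ + a′) (p≡2 p pr (∣-trans d da) (∣-trans d′ db)) d)
  ; sqf-a = λ p pr d → squarefree⇒∤ sfa p pr (∣-trans d da)
  ; sqf-b = λ p pr d → squarefree⇒∤ sfb p pr (∣-trans d db) }
  where
  p≡2 : ∀ p → Prime p → + p ∣ + a → + p ∣ + b → p ≡ 2
  p≡2 p pr d d′ = ℕ.≤-antisym (ℕ.≤-trans (ℕ∣.∣⇒≤ {{ℕ.≢-nonZero (gcd[m,n]≢0 a b (inj₁ a≢0))}} (gcd-greatest {+ a} {+ b} {+ p} (∣⇒∣ᵤ d) (∣⇒∣ᵤ d′))) (ℤ.drop‿+≤+ g≤2)) (prime≥2 pr)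

odd-part : ∀ a → SquareFree (+ a) → ¬ + 2 ∣ + a ⊎ ∃ λ a′ → + a ≡ + 2 * + a′ × ¬ + 2 ∣ + a′
odd-part a sf with + 2 ∣? + a
... | no h = inj₁ h
... | yes d with ∣⇒∣ᵤ d
...   | ℕ∣.divides a′ refl = inj₂ (a′ , trans (ℤ.pos-* a′ 2) (ℤ.*-comm (+ a′) (+ 2)) , λ d′ → squarefree⇒∤ sf 2 prime[2] (four d′))
  where
  four : + 2 ∣ + a′ → + 2 * + 2 ∣ + (a′ ℕ.* 2)
  four (divides q e) = divides q (trans (ℤ.pos-* a′ 2) (trans (cong (_* + 2) e) (ℤ.*-assoc q (+ 2) (+ 2))))

represent : ∀ a b → a ≢ 0 → SquareFree (+ a) → SquareFree (+ b) → gcd (+ a) (+ b) ≤ + 2 → ∀ A B₁ B₂ B₃ → Rep (+ a) (+ b) A B₁ B₂ B₃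
represent a b a≢0 sfa sfb g≤2 A B₁ B₂ B₃ = go (odd-part a sfa) (odd-part b sfb)
  where
  ∣2* : ∀ {n n′} → + n ≡ + 2 * + n′ → + n′ ∣ + n
  ∣2* e = divides (+ 2) e
  go : ¬ + 2 ∣ + a ⊎ (∃ λ a′ → + a ≡ + 2 * + a′ × ¬ + 2 ∣ + a′) → ¬ + 2 ∣ + b ⊎ (∃ λ b′ → + b ≡ + 2 * + b′ × ¬ + 2 ∣ + b′) → Rep (+ a) (+ b) A B₁ B₂ B₃
  go (inj₁ oa) (inj₁ ob) = let adm = admissible a≢0 sfa sfb g≤2 ∣-refl ∣-refl oa ob; i , pi , av = good a b adm
    in represent-odd adm i pi av B₁ B₂ B₃ A
  go (inj₂ (a′ , ea , oa)) (inj₁ ob) = let adm = admissible a≢0 sfa sfb g≤2 (∣2* ea) ∣-refl oa ob; i , pi , av = good a′ b adm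
    in subst (λ a → Rep a (+ b) A B₁ B₂ B₃) (sym ea) (represent-one-even adm i pi av B₁ B₂ B₃ A)
  go (inj₁ oa) (inj₂ (b′ , eb , ob)) = let adm = swap-admissible (admissible a≢0 sfa sfb g≤2 ∣-refl (∣2* eb) oa ob); i , pi , av = good b′ a adm
    in swap-rep (subst (λ b → Rep b (+ a) A B₂ B₁ B₃) (sym eb) (represent-one-even adm i pi av B₂ B₁ B₃ A))
  go (inj₂ (a′ , ea , oa)) (inj₂ (b′ , eb , ob)) = let adm = admissible a≢0 sfa sfb g≤2 (∣2* ea) (∣2* eb) oa ob; i , pi , av = good a′ b′ adm
    in subst₂ (λ a b → Rep a b A B₁ B₂ B₃) (sym ea) (sym eb) (represent-both-even adm i pi av B₁ B₂ B₃ A)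

even-imaginary : ∀ {a b y} → InLQk a b 2 y → ∃₂ λ A B₁ → ∃₂ λ B₂ B₃ → quat A (+ 2 * B₁) (+ 2 * B₂) (+ 2 * B₃) ≡ y
even-imaginary {a} {b} (gen (quat u v w z)) = _ , _ , _ , _ , sym (square a b u v w z)
even-imaginary zro = 0ℤ , 0ℤ , 0ℤ , 0ℤ , refl
even-imaginary (neg h) with even-imaginary h
... | A , B₁ , B₂ , B₃ , refl = - A , - B₁ , - B₂ , - B₃ , quat-cong refl (lem B₁) (lem B₂) (lem B₃)
  where lem : ∀ x → + 2 * - x ≡ - (+ 2 * x)
        lem = solve-∀
even-imaginary (add h h′) with even-imaginary h | even-imaginary h′
... | A , B₁ , B₂ , B₃ , refl | A′ , B₁′ , B₂′ , B₃′ , refl = A + A′ , B₁ + B₁′ , B₂ + B₂′ , B₃ + B₃′ , quat-cong refl (lem B₁ B₁′) (lem B₂ B₂′) (lem B₃ B₃′)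
  where lem : ∀ x y → + 2 * (x + y) ≡ + 2 * x + + 2 * y
        lem = solve-∀

addQ-identityʳ : ∀ x → addQ x zeroQ ≡ x
addQ-identityʳ (quat x y z w) = quat-cong (ℤ.+-identityʳ x) (ℤ.+-identityʳ y) (ℤ.+-identityʳ z) (ℤ.+-identityʳ w)

zeroQ² : ∀ a b → powQ a b zeroQ 2 ≡ zeroQ
zeroQ² a b = trans (square a b 0ℤ 0ℤ 0ℤ 0ℤ) (quat-cong (lem a b) refl refl refl)
  where lem : ∀ a b → 0ℤ * 0ℤ - a * (0ℤ * 0ℤ) - b * (0ℤ * 0ℤ) - a * b * (0ℤ * 0ℤ) ≡ 0ℤ
        lem = solve-∀

pad-to-two : ∀ a b xs → length xs ℕ.≤ 2 → ∃₂ λ p q → addQ (powQ a b p 2) (powQ a b q 2) ≡ sumPow a b 2 xs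
pad-to-two a b [] _ = zeroQ , zeroQ , cong₂ addQ (zeroQ² a b) (zeroQ² a b)
pad-to-two a b (x ∷ []) _ = x , zeroQ , cong (addQ (powQ a b x 2)) (zeroQ² a b)
pad-to-two a b (x ∷ y ∷ []) _ = x , y , cong (addQ (powQ a b x 2)) (sym (addQ-identityʳ (powQ a b y 2)))
pad-to-two a b (_ ∷ _ ∷ _ ∷ _) (s≤s (s≤s ()))

-- Two squares do not suffice

NonNeg : ℤ → Set
NonNeg x = ∃ λ n → x ≡ + n

nn-+ : ∀ {x y} → NonNeg x → NonNeg y → NonNeg (x + y)
nn-+ (m , refl) (n , refl) = m ℕ.+ n , refl

nn-* : ∀ {x y} → NonNeg x → NonNeg y → NonNeg (x * y)
nn-* (m , refl) (n , refl) = m ℕ.* n , sym (ℤ.pos-* m n)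

nn-sq : ∀ x → NonNeg (x * x)
nn-sq x = abs x ℕ.* abs x , sq-abs x

-- A vector orthogonal to u is a multiple of (−u₂, u₁) as soon as u · v = 1.
orthogonal-norm : ∀ u₁ u₂ v₁ v₂ w₁ w₂ → u₁ * v₁ + u₂ * v₂ ≡ 1ℤ → u₁ * w₁ + u₂ * w₂ ≡ 0ℤ → let f = v₁ * w₂ - v₂ * w₁ in
  w₁ * w₁ + w₂ * w₂ ≡ f * f * (u₁ * u₁ + u₂ * u₂)
orthogonal-norm u₁ u₂ v₁ v₂ w₁ w₂ e e′ = trans (cong₂ (λ x y → x * x + y * y) e₁ e₂) (l₃ u₁ u₂ (v₁ * w₂ - v₂ * w₁))
  where
  l₁ : ∀ u₁ u₂ v₁ v₂ w₁ w₂ → w₁ - - u₂ * (v₁ * w₂ - v₂ * w₁) ≡ - w₁ * (u₁ * v₁ + u₂ * v₂ - 1ℤ) + v₁ * (u₁ * w₁ + u₂ * w₂ - 0ℤ)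
  l₁ = ring! 6 (λ u₁ u₂ v₁ v₂ w₁ w₂ → w₁ :- :- u₂ :* (v₁ :* w₂ :- v₂ :* w₁) := :- w₁ :* (u₁ :* v₁ :+ u₂ :* v₂ :- # 1) :+ v₁ :* (u₁ :* w₁ :+ u₂ :* w₂ :- # 0)) refl
  l₂ : ∀ u₁ u₂ v₁ v₂ w₁ w₂ → w₂ - u₁ * (v₁ * w₂ - v₂ * w₁) ≡ - w₂ * (u₁ * v₁ + u₂ * v₂ - 1ℤ) + v₂ * (u₁ * w₁ + u₂ * w₂ - 0ℤ)
  l₂ = ring! 6 (λ u₁ u₂ v₁ v₂ w₁ w₂ → w₂ :- u₁ :* (v₁ :* w₂ :- v₂ :* w₁) := :- w₂ :* (u₁ :* v₁ :+ u₂ :* v₂ :- # 1) :+ v₂ :* (u₁ :* w₁ :+ u₂ :* w₂ :- # 0)) refl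
  l₃ : ∀ u₁ u₂ f → - u₂ * f * (- u₂ * f) + u₁ * f * (u₁ * f) ≡ f * f * (u₁ * u₁ + u₂ * u₂)
  l₃ = solve-∀
  e₁ : w₁ ≡ - u₂ * (v₁ * w₂ - v₂ * w₁)
  e₁ = mod2 (- w₁) v₁ (l₁ u₁ u₂ v₁ v₂ w₁ w₂) e e′
  e₂ : w₂ ≡ u₁ * (v₁ * w₂ - v₂ * w₁)
  e₂ = mod2 (- w₂) v₂ (l₂ u₁ u₂ v₁ v₂ w₁ w₂) e e′

-- 1 + k² is 1 or 2 modulo 4. The left side is 0 for even e, because A is even, and a + A for odd e,
-- that is 0 or 3.
not-square+1 : ∀ a A e k → A ≈ 0ℤ [ + 2 ] → a + A ≈ 0ℤ [ + 4 ] ⊎ a + A ≈ + 3 [ + 4 ] → e * (A + a * e) ≢ 1ℤ + k * k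
not-square+1 a A e k A≈0@(≈-by (divides h eh)) a+A eq = go (parity e 0ℤ) (parity k 0ℤ) a+A
  where
  k≈0 : k ≈ 0ℤ [ + 2 ] → 1ℤ + k * k ≈ 1ℤ [ + 4 ]
  k≈0 h = ≡≈ 1ℤ ≈+ square≈4 h
  k≈1 : k ≈ 0ℤ + 1ℤ [ + 2 ] → 1ℤ + k * k ≈ + 2 [ + 4 ]
  k≈1 h = ≡≈ 1ℤ ≈+ square≈4 h
  e-even : e ≈ 0ℤ [ + 2 ] → e * (A + a * e) ≈ 0ℤ [ + 4 ]
  e-even (≈-by (divides f ef)) = ≈-by (divides (f * (h + a * f)) (mod2 (A + a * e + f * + 2 * a) (f * + 2) (lem a A e f h) ef eh))
    where lem : ∀ a A e f h → e * (A + a * e) - 0ℤ - f * (h + a * f) * + 4 ≡ (A + a * e + f * + 2 * a) * (e - 0ℤ - f * + 2) + f * + 2 * (A - 0ℤ - h * + 2)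
          lem = ring! 5 (λ a A e f h → e :* (A :+ a :* e) :- # 0 :- f :* (h :+ a :* f) :* # 4 := (A :+ a :* e :+ f :* # 2 :* a) :* (e :- # 0 :- f :* # 2) :+ f :* # 2 :* (A :- # 0 :- h :* # 2)) refl
  e-odd : e ≈ 0ℤ + 1ℤ [ + 2 ] → e * (A + a * e) ≈ a + A [ + 4 ]
  e-odd e≈1@(≈-by (divides f ef)) = ≈-trans (≈-≡ (lem a A e)) (≈-trans (≡≈ a ≈* square≈4 e≈1 ≈+ eA) (≈-≡ (cong (_+ A) (ℤ.*-identityʳ a))))
    where
    lem : ∀ a A e → e * (A + a * e) ≡ a * (e * e) + e * A
    lem = solve-∀
    eA : e * A ≈ A [ + 4 ]
    eA = ≈-by (divides (f * h) (mod2 A (f * + 2) (lem′ A e f h) ef eh))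
      where lem′ : ∀ A e f h → e * A - A - f * h * + 4 ≡ A * (e - (0ℤ + 1ℤ) - f * + 2) + f * + 2 * (A - 0ℤ - h * + 2)
            lem′ = solve-∀
  clash : ∀ {x y} → e * (A + a * e) ≈ x [ + 4 ] → 1ℤ + k * k ≈ y [ + 4 ] → x ≈ y [ + 4 ]
  clash p q = ≈-trans (≈-sym p) (≈-trans (≈-≡ eq) q)
  go : e ≈ 0ℤ [ + 2 ] ⊎ e ≈ 0ℤ + 1ℤ [ + 2 ] → k ≈ 0ℤ [ + 2 ] ⊎ k ≈ 0ℤ + 1ℤ [ + 2 ] → a + A ≈ 0ℤ [ + 4 ] ⊎ a + A ≈ + 3 [ + 4 ] → ⊥
  go (inj₁ p) (inj₁ q) _ = from-no (+ 4 ∣? - 1ℤ) (diff (clash (e-even p) (k≈0 q)))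
  go (inj₁ p) (inj₂ q) _ = from-no (+ 4 ∣? - + 2) (diff (clash (e-even p) (k≈1 q)))
  go (inj₂ p) (inj₁ q) (inj₁ r) = from-no (+ 4 ∣? - 1ℤ) (diff (clash (≈-trans (e-odd p) r) (k≈0 q)))
  go (inj₂ p) (inj₂ q) (inj₁ r) = from-no (+ 4 ∣? - + 2) (diff (clash (≈-trans (e-odd p) r) (k≈1 q)))
  go (inj₂ p) (inj₁ q) (inj₂ r) = from-no (+ 4 ∣? + 2) (diff (clash (≈-trans (e-odd p) r) (k≈0 q)))
  go (inj₂ p) (inj₂ q) (inj₂ r) = from-no (+ 4 ∣? 1ℤ) (diff (clash (≈-trans (e-odd p) r) (k≈1 q)))

module _ (α β A : ℕ) (A≢0 : A ≢ 0) (A≈0 : + A ≈ 0ℤ [ + 2 ]) (a+A : + α + + A ≈ 0ℤ [ + 4 ] ⊎ + α + + A ≈ + 3 [ + 4 ]) where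
  private
    a = + α
    b = + β

  -- The vectors w and z are multiples f and h of (-u₂, u₁), so the real part reads U(1 - bf² -
  -- abh²) - aE = A. As A is positive, bf² + abh² = 0 and U = A + aE; Lagrange's identity for EU
  -- then contradicts `not-square+1`.
  not-two-squares : ∀ u₁ v₁ w₁ z₁ u₂ v₂ w₂ z₂ → addQ (powQ a b (quat u₁ v₁ w₁ z₁) 2) (powQ a b (quat u₂ v₂ w₂ z₂) 2) ≢ quat (+ A) (+ 2) 0ℤ 0ℤ
  not-two-squares u₁ v₁ w₁ z₁ u₂ v₂ w₂ z₂ eq = go (nn-+ (nn-* (β , refl) (nn-sq f)) (nn-* (nn-* (α , refl) (β , refl)) (nn-sq h)))
    where
    eq′ = trans (sym (cong₂ addQ (square a b u₁ v₁ w₁ z₁) (square a b u₂ v₂ w₂ z₂))) eq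
    halve : ∀ x y s → + 2 * x + + 2 * y ≡ + 2 * s → x + y ≡ s
    halve x y s e = cancelˡ {+ 2} (λ ()) (trans (ℤ.*-distribˡ-+ (+ 2) x y) e)
    uv : u₁ * v₁ + u₂ * v₂ ≡ 1ℤ
    uv = halve (u₁ * v₁) (u₂ * v₂) 1ℤ (cong c1 eq′)
    uw : u₁ * w₁ + u₂ * w₂ ≡ 0ℤ
    uw = halve (u₁ * w₁) (u₂ * w₂) 0ℤ (cong c2 eq′)
    uz : u₁ * z₁ + u₂ * z₂ ≡ 0ℤ
    uz = halve (u₁ * z₁) (u₂ * z₂) 0ℤ (cong c3 eq′)
    f = v₁ * w₂ - v₂ * w₁
    h = v₁ * z₂ - v₂ * z₁
    U = u₁ * u₁ + u₂ * u₂
    E = v₁ * v₁ + v₂ * v₂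
    real-part : U - a * E - (b * (f * f) + a * b * (h * h)) * U ≡ + A
    real-part = trans (sym (trans (lem a b (a * b) u₁ v₁ w₁ z₁ u₂ v₂ w₂ z₂)
        (trans (cong₂ (λ x y → U - a * E - b * x - a * b * y) (orthogonal-norm u₁ u₂ v₁ v₂ w₁ w₂ uv uw) (orthogonal-norm u₁ u₂ v₁ v₂ z₁ z₂ uv uz))
          (lem′ U (a * E) b (a * b) (f * f) (h * h))))) (cong c0 eq′)
      where
      lem : ∀ a b d u₁ v₁ w₁ z₁ u₂ v₂ w₂ z₂ → u₁ * u₁ - a * (v₁ * v₁) - b * (w₁ * w₁) - d * (z₁ * z₁) + (u₂ * u₂ - a * (v₂ * v₂) - b * (w₂ * w₂) - d * (z₂ * z₂))
        ≡ u₁ * u₁ + u₂ * u₂ - a * (v₁ * v₁ + v₂ * v₂) - b * (w₁ * w₁ + w₂ * w₂) - d * (z₁ * z₁ + z₂ * z₂)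
      lem = ring! 11 (λ a b d u₁ v₁ w₁ z₁ u₂ v₂ w₂ z₂ → u₁ :* u₁ :- a :* (v₁ :* v₁) :- b :* (w₁ :* w₁) :- d :* (z₁ :* z₁) :+ (u₂ :* u₂ :- a :* (v₂ :* v₂) :- b :* (w₂ :* w₂) :- d :* (z₂ :* z₂))
        := u₁ :* u₁ :+ u₂ :* u₂ :- a :* (v₁ :* v₁ :+ v₂ :* v₂) :- b :* (w₁ :* w₁ :+ w₂ :* w₂) :- d :* (z₁ :* z₁ :+ z₂ :* z₂)) refl
      lem′ : ∀ U e b d f h → U - e - b * (f * U) - d * (h * U) ≡ U - e - (b * f + d * h) * U
      lem′ = solve-∀
    go : NonNeg (b * (f * f) + a * b * (h * h)) → ⊥
    go (zero , e) = not-square+1 a (+ A) E (u₁ * v₂ - u₂ * v₁) A≈0 a+A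
        (trans (cong (λ z → E * (z + a * E)) (trans (sym real-part) (cong (λ z → U - a * E - z * U) e)))
          (mod1 (u₁ * v₁ + u₂ * v₂ + 1ℤ) (lem a u₁ u₂ v₁ v₂) uv))
      where lem : ∀ a u₁ u₂ v₁ v₂ → let U = u₁ * u₁ + u₂ * u₂; E = v₁ * v₁ + v₂ * v₂; k = u₁ * v₂ - u₂ * v₁ in
              E * (U - a * E - 0ℤ * U + a * E) - (1ℤ + k * k) ≡ (u₁ * v₁ + u₂ * v₂ + 1ℤ) * (u₁ * v₁ + u₂ * v₂ - 1ℤ)
            lem = ring! 5 (λ a u₁ u₂ v₁ v₂ → let U = u₁ :* u₁ :+ u₂ :* u₂; E = v₁ :* v₁ :+ v₂ :* v₂; k = u₁ :* v₂ :- u₂ :* v₁ in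
              E :* (U :- a :* E :- # 0 :* U :+ a :* E) :- (# 1 :+ k :* k) := (u₁ :* v₁ :+ u₂ :* v₂ :+ # 1) :* (u₁ :* v₁ :+ u₂ :* v₂ :- # 1)) refl
    go (suc n , e) = sum-pos (nn-+ (nn-* (α , refl) (nn-+ (nn-sq v₁) (nn-sq v₂))) (nn-* (nn-+ (nn-sq u₁) (nn-sq u₂)) (n , refl)))
      where
      lem : ∀ U e n → U - e - (1ℤ + n) * U + (e + U * n) ≡ 0ℤ
      lem = solve-∀
      total : + A + (a * E + U * + n) ≡ 0ℤ
      total = trans (cong (λ z → z + (a * E + U * + n)) (trans (sym real-part) (cong (λ z → U - a * E - z * U) e))) (lem U (a * E) (+ n))
      sum-pos : NonNeg (a * E + U * + n) → ⊥
      sum-pos (k , ek) = A≢0 (ℕ.m+n≡0⇒m≡0 A (ℤ.+-injective (trans (sym (cong (λ z → + A + z) ek)) total)))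

  -- (1 + i)² = 1 - a + 2i, and adding A + a - 1 copies of 1² gives A + 2i.
  in-LQ² : ∀ α′ → α ≡ suc α′ → InLQk a b 2 (quat (+ A) (+ 2) 0ℤ 0ℤ)
  in-LQ² α′ refl = subst (InLQk a b 2) (trans (cong (λ q → addQ q (quat (+ (A ℕ.+ α′)) 0ℤ 0ℤ 0ℤ)) (square a b 1ℤ 1ℤ 0ℤ 0ℤ))
      (quat-cong (lem (+ A) b (+ α′)) refl refl refl)) (add (gen (quat 1ℤ 1ℤ 0ℤ 0ℤ)) (ones (A ℕ.+ α′)))
    where
    lem : ∀ A b α → 1ℤ * 1ℤ - (1ℤ + α) * (1ℤ * 1ℤ) - b * (0ℤ * 0ℤ) - (1ℤ + α) * b * (0ℤ * 0ℤ) + (A + α) ≡ A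
    lem = solve-∀
    lem₁ : ∀ a b → 1ℤ * 1ℤ - a * (0ℤ * 0ℤ) - b * (0ℤ * 0ℤ) - a * b * (0ℤ * 0ℤ) ≡ 1ℤ
    lem₁ = solve-∀
    ones : ∀ n → InLQk a b 2 (quat (+ n) 0ℤ 0ℤ 0ℤ)
    ones zero = zro
    ones (suc n) = subst (InLQk a b 2) (trans (cong (λ q → addQ q (quat (+ n) 0ℤ 0ℤ 0ℤ)) (square a b 1ℤ 0ℤ 0ℤ 0ℤ))
        (quat-cong (cong (_+ + n) (lem₁ a b)) refl refl refl)) (add (gen oneQ) (ones n))

  two-insufficient : ∀ α′ → α ≡ suc α′ → ∀ h → h ℕ.≤ 2 → ¬ WaringBound a b 2 h
  two-insufficient α′ e h h≤2 bound = go (bound (quat (+ A) (+ 2) 0ℤ 0ℤ) (in-LQ² α′ e))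
    where
    go : SumOfAtMost a b 2 h (quat (+ A) (+ 2) 0ℤ 0ℤ) → ⊥
    go (xs , len , eq) = two (pad-to-two a b xs (ℕ.≤-trans len h≤2))
      where
      two : (∃₂ λ p q → addQ (powQ a b p 2) (powQ a b q 2) ≡ sumPow a b 2 xs) → ⊥
      two (quat u₁ v₁ w₁ z₁ , quat u₂ v₂ w₂ z₂ , e) = not-two-squares u₁ v₁ w₁ z₁ u₂ v₂ w₂ z₂ (trans e eq)

-- A = 2 for a ≡ 1, 2 and A = 4 for a ≡ 3 modulo 4 make a + A congruent to 3, 0 and 3; a ≡ 0 is
-- excluded because a is squarefree.
lower-bound : ∀ α′ β → SquareFree (+ suc α′) → ∀ h → h ℕ.≤ 2 → ¬ WaringBound (+ suc α′) (+ β) 2 h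
lower-bound α′ β sf = go (parity (+ α) 0ℤ)
  where
  α = suc α′
  Bound = ∀ h → h ℕ.≤ 2 → ¬ WaringBound (+ α) (+ β) 2 h
  with-A : ∀ A → A ≢ 0 → + A ≈ 0ℤ [ + 2 ] → + α + + A ≈ 0ℤ [ + 4 ] ⊎ + α + + A ≈ + 3 [ + 4 ] → Bound
  with-A A A≢0 A≈0 a+A = two-insufficient α β A A≢0 A≈0 a+A α′ refl
  even : + α ≈ 0ℤ [ + 4 ] ⊎ + α ≈ + 2 [ + 4 ] → Bound
  even (inj₁ h) = ⊥-elim (squarefree⇒∤ sf 2 prime[2] (∣-of h))
  even (inj₂ h) = with-A 2 (λ ()) (≈0 ∣-refl) (inj₁ (≈-trans (h ≈+ ≡≈ (+ 2)) (≈0 ∣-refl)))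
  odd : + α ≈ 1ℤ [ + 4 ] ⊎ + α ≈ + 3 [ + 4 ] → Bound
  odd (inj₁ h) = with-A 2 (λ ()) (≈0 ∣-refl) (inj₂ (h ≈+ ≡≈ (+ 2)))
  odd (inj₂ h) = with-A 4 (λ ()) (≈0 (divides (+ 2) refl)) (inj₂ (h ≈+ ≈0 {+ 4} ∣-refl))
  go : + α ≈ 0ℤ [ + 2 ] ⊎ + α ≈ 0ℤ + 1ℤ [ + 2 ] → Bound
  go (inj₁ h) = even (lift-mod (+ 2) h)
  go (inj₂ h) = odd (lift-mod (+ 2) h)

theorem1p2 : (a b : ℤ) → + 0 < a → + 0 < b → SquareFree a → SquareFree b →
    gcd a b ≤ + 2 → IsWaringNumber a b 2 3
theorem1p2 (+ zero) _ (ℤ.+<+ ())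
theorem1p2 (+ suc _) (+ zero) _ (ℤ.+<+ ())
theorem1p2 (+ suc α) (+ suc β) _ _ sfa sfb g≤2 = s≤s z≤n , upper , λ h _ h<3 → lower-bound α (suc β) sfa h (ℕ.≤-pred h<3)
  where
  upper : WaringBound (+ suc α) (+ suc β) 2 3
  upper y h = go (even-imaginary h)
    where
    go : (∃₂ λ A B₁ → ∃₂ λ B₂ B₃ → quat A (+ 2 * B₁) (+ 2 * B₂) (+ 2 * B₃) ≡ y) → SumOfAtMost (+ suc α) (+ suc β) 2 3 y
    go (A , B₁ , B₂ , B₃ , e) = subst (SumOfAtMost (+ suc α) (+ suc β) 2 3) e (rep⇒sum (represent (suc α) (suc β) (λ ()) sfa sfb g≤2 A B₁ B₂ B₃))
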